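{- Let $G$ be a finite simple graph with no $K_4$-minor and with maximum degree $\Delta$. Then for every positive integer $k$ with $k\ge\frac{\Delta+3}{2}$, the graph $G$ admits an equitable $k$-coloring.
   Context: An equitable $k$-coloring of a graph $G$ is a proper vertex coloring $\alpha\colon V(G)\to\{1,\dots,k\}$ (adjacent vertices receive distinct colors) such that for every two colors $i,j\in\{1,\dots,k\}$ the sizes $|\alpha^{ -1}(\{i\})|$ and $|\alpha^{ -1}(\{j\})|$ differ by at most one (color classes may be empty). -}

module Defs where

open import Data.Nat using (ℕ; zero; suc; _+_; _≤_; _⊔_)
open import Data.Fin using (Fin)
open import Data.Fin.Properties using (_≟_)
open import Data.Bool using (Bool; true; false)
open import Data.List using (List; length; filter; map; foldr)
open import Data.List using (allFin)
open import Data.Maybe using (Maybe; just; nothing)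
open import Data.Product using (Σ; ∃; ∃-syntax; _×_; _,_)
open import Relation.Binary.PropositionalEquality using (_≡_; _≢_)
open import Relation.Nullary using (¬_)

record Graph (n : ℕ) : Set where
  field
    adj   : Fin n → Fin n → Bool
    sym   : ∀ u v → adj u v ≡ adj v u
    irrfl : ∀ v → adj v v ≡ false
open Graph public

Adj : ∀ {n} → Graph n → Fin n → Fin n → Set
Adj G u v = adj G u v ≡ true

degree : ∀ {n} → Graph n → Fin n → ℕ
degree {n} G v = length (filter (λ u → Data.Bool._≟_ (adj G v u) true) (allFin n))

maxDegree : ∀ {n} → Graph n → ℕ
maxDegree {n} G = foldr _⊔_ 0 (map (degree G) (allFin n))

data WalkIn {n} (G : Graph n) (S : Fin n → Set) : Fin n → Fin n → Set where
  here : ∀ {u} → S u → WalkIn G S u u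
  step : ∀ {u w v} → S u → Adj G u w → WalkIn G S w v → WalkIn G S u v

-- G has a K₄-minor: there are four pairwise disjoint, nonempty vertex sets
-- (branch sets; encoded by b v = just i meaning v lies in branch set i,
-- b v = nothing meaning v is in no branch set), each inducing a connected
-- subgraph, and every two distinct branch sets are joined by an edge.
HasK4Minor : ∀ {n} → Graph n → Set
HasK4Minor {n} G =
  Σ (Fin n → Maybe (Fin 4)) λ b →
    ((i : Fin 4) → ∃[ v ] b v ≡ just i)
  × ((i : Fin 4) → ∀ u v → b u ≡ just i → b v ≡ just i →
       WalkIn G (λ x → b x ≡ just i) u v)
  × ((i j : Fin 4) → i ≢ j →
       ∃[ u ] ∃[ v ] (b u ≡ just i × b v ≡ just j × Adj G u v))

classSize : ∀ {n k} → (Fin n → Fin k) → Fin k → ℕ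
classSize {n} α i = length (filter (λ v → α v ≟ i) (allFin n))

Proper : ∀ {n k} → Graph n → (Fin n → Fin k) → Set
Proper G α = ∀ u v → Adj G u v → α u ≢ α v

EquitableColoring : ∀ {n} → Graph n → (k : ℕ) → (Fin n → Fin k) → Set
EquitableColoring G k α =
  Proper G α × (∀ i j → classSize α i ≤ classSize α j + 1)

HasEquitableColoring : ∀ {n} → Graph n → ℕ → Set
HasEquitableColoring {n} G k = Σ (Fin n → Fin k) (EquitableColoring G k)

{-# OPTIONS --safe #-}
module Submission where

-- Write k = 2 + j, so that all degrees are at most 2 j + 1. A K₄-minor-free graph is a subgraph of a 2-tree: a longest
-- path argument finds a vertex with at most two neighbours, which is removed after joining its neighbours. The colouring
-- is found by induction on the number of vertices, keeping the 2-tree fixed: remove a set S of k vertices, colour the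
-- rest equitably and give the vertices of S distinct colours. This is possible when S = {v₁, …, vₖ} with vᵢ having at most
-- k − i neighbours outside S. It is also possible when vₖ₋₁ and vₖ see only x and y respectively, for an edge x y of
-- the 2-tree, because that edge can be added to G − S, forcing x and y to get distinct colours.
--
-- Such a set S is found in a smallest part of the 2-tree, hanging on an edge x y, that has more than j vertices or
-- contains vertices u ≠ v such that u does not see y and v does not see x. All smaller parts being small and without
-- such pairs, either S exists (with further vertices chosen by peeling off the 2-tree), or the part consists of j + 1
-- common neighbours of x and y, and then x and y are coloured by hand.

open import Defs hiding (sym)
open Defs using () renaming (sym to adj-sym)
open import Data.Nat using (ℕ; zero; suc; _+_; _*_; _∸_; _⊔_; _≤_; _<_; z≤n; s≤s; s≤s⁻¹)
open import Data.Nat.Properties hiding (_≟_)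
open import Algebra.Properties.CommutativeSemigroup +-commutativeSemigroup using (x∙yz≈y∙xz)
open import Data.Bool using (Bool; true; false; if_then_else_; _∧_; _∨_)
open import Data.Bool.Properties using (∧-comm; ∨-comm)
open import Data.Fin as Fin using (Fin)
open import Data.Fin.Patterns using (0F; 1F; 2F; 3F)
import Data.Fin.Properties as FinP
open import Data.List using (List; []; _∷_; _++_; [_]; length; map; filter; foldr; allFin; take; _ʳ++_; reverse)
open import Data.List.Properties using (++-assoc; ++-identityʳ; length-++; length-map; length-tabulate; length-take; map-cong-local; ʳ++-defn; reverse-++; length-reverse)
open import Data.List.Membership.Propositional using (_∈_; _∉_; find; lose)
open import Data.List.Membership.Propositional.Properties
open import Data.List.Relation.Unary.Any using (here; there; any?)
open import Data.List.Relation.Unary.All as All using ([]; _∷_)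
import Data.List.Relation.Unary.All.Properties as AllP
open import Data.List.Relation.Unary.AllPairs using ([]; _∷_)
open import Data.List.Relation.Unary.Linked using (Linked; []; [-]; _∷_)
open import Data.List.Relation.Unary.Unique.Propositional using (Unique)
import Data.List.Relation.Unary.Unique.Propositional.Properties as UniqueP
open import Data.List.Relation.Binary.Pointwise using (Pointwise; []; _∷_)
open import Data.List.Relation.Binary.Permutation.Propositional as Perm using (_↭_; prep; swap; ↭-sym)
open import Data.List.Relation.Binary.Permutation.Propositional.Properties as PermP using (∈-resp-↭; ↭-length; shift)
import Data.List.Relation.Binary.Permutation.Setoid.Properties as PermS
open import Data.Maybe using (Maybe; just; nothing)
open import Data.Product using (∃-syntax; _×_; _,_; proj₁; proj₂)
open import Data.Sum using (_⊎_; inj₁; inj₂; [_,_]′)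
open import Data.Empty using (⊥; ⊥-elim)
open import Function using (_∘_; id; case_of_)
open import Relation.Binary using (DecidableEquality; tri<; tri≈; tri>)
open import Relation.Binary.PropositionalEquality using (_≡_; _≢_; refl; sym; trans; cong; cong₂; subst; subst₂; setoid)
open import Relation.Nullary using (¬_; Dec; yes; no; does; ¬?; contradiction)
open import Relation.Nullary.Decidable using (dec-true; dec-false; _×-dec_; _⊎-dec_)

-- The degree bound is what an apex needs: one that sees `j` other vertices of S keeps at most
-- `j + 1 = k − 1` neighbours outside and can be coloured first. The induction runs over subgraphs
-- of one fixed 2-tree instead of over graphs without K₄-minor, so that adding an edge of the 2-tree
-- stays within the class at no cost. The price is that deleted vertices remain in the tree: each of
-- x, y and z may be absent from the current graph. Isolated vertices are therefore removed
-- beforehand (they take the rarest colour), and later an edge certifies that an apex is still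
-- present. The main obstacle is the exact size k of S. Around a vertex z over x y, the pieces
-- hanging on x z and z y may have `2 j + 1` vertices together with z, too many for S to contain
-- them all; a vertex of S is then allowed to keep neighbours in its own piece, and these have to be
-- counted.

private variable
  Elem Image : Set

-- Counting in lists without repetitions.

bit : Bool → ℕ
bit true  = 1
bit false = 0

count : (Elem → Bool) → List Elem → ℕ
count f []       = 0
count f (x ∷ xs) = bit (f x) + count f xs

bool : ∀ b → b ≡ true ⊎ b ≡ false
bool true  = inj₁ refl
bool false = inj₂ refl

true≢false : ∀ {b} → b ≡ true → b ≡ false → ⊥
true≢false refl ()

bit≤1 : ∀ b → bit b ≤ 1
bit≤1 true  = ≤-refl
bit≤1 false = z≤n

count-++ : ∀ (f : Elem → Bool) xs {ys} → count f (xs ++ ys) ≡ count f xs + count f ys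
count-++ f []       = refl
count-++ f (x ∷ xs) = trans (cong (bit (f x) +_) (count-++ f xs)) (sym (+-assoc (bit (f x)) _ _))

count-↭ : ∀ (f : Elem → Bool) {xs ys} → xs ↭ ys → count f xs ≡ count f ys
count-↭ f Perm.refl = refl
count-↭ f (prep x p) = cong (bit (f x) +_) (count-↭ f p)
count-↭ f (swap x y p) = trans (x∙yz≈y∙xz (bit (f x)) (bit (f y)) _) (cong (λ n → bit (f y) + (bit (f x) + n)) (count-↭ f p))
count-↭ f (Perm.trans p q) = trans (count-↭ f p) (count-↭ f q)

count-map : ∀ (f : Image → Bool) (g : Elem → Image) xs → count f (map g xs) ≡ count (f ∘ g) xs
count-map f g []       = refl
count-map f g (x ∷ xs) = cong (bit (f (g x)) +_) (count-map f g xs)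

count-mono : ∀ {f g : Elem → Bool} xs → (∀ {x} → x ∈ xs → f x ≡ true → g x ≡ true) → count f xs ≤ count g xs
count-mono [] h = z≤n
count-mono {f = f} (x ∷ xs) h with f x in eq
... | false = ≤-trans (count-mono xs (h ∘ there)) (m≤n+m _ _)
... | true rewrite h (here refl) eq = s≤s (count-mono xs (h ∘ there))

count-cong : ∀ {f g : Elem → Bool} xs → (∀ {x} → x ∈ xs → f x ≡ g x) → count f xs ≡ count g xs
count-cong [] h = refl
count-cong (x ∷ xs) h = cong₂ (λ b n → bit b + n) (h (here refl)) (count-cong xs (h ∘ there))

count-all : ∀ {f : Elem → Bool} xs → (∀ {x} → x ∈ xs → f x ≡ true) → count f xs ≡ length xs
count-all [] h = refl
count-all (x ∷ xs) h rewrite h (here refl) = cong suc (count-all xs (h ∘ there))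

count-none : ∀ {f : Elem → Bool} xs → (∀ {x} → x ∈ xs → f x ≡ true → ⊥) → count f xs ≡ 0
count-none [] h = refl
count-none {f = f} (x ∷ xs) h with f x in eq
... | false = count-none xs (h ∘ there)
... | true  = ⊥-elim (h (here refl) eq)

count-∈ : ∀ {f : Elem → Bool} {x xs} → x ∈ xs → f x ≡ true → 1 ≤ count f xs
count-∈ (here refl) fx rewrite fx = s≤s z≤n
count-∈ (there x∈) fx = ≤-trans (count-∈ x∈ fx) (m≤n+m _ _)

count-∉ : ∀ {f : Elem → Bool} xs → count f xs ≡ 0 → ∀ {x} → x ∈ xs → f x ≡ true → ⊥
count-∉ xs c x∈ fx = <⇒≢ (count-∈ x∈ fx) (sym c)

private
  insert-perm : ∀ (ys : List Elem) {x zs} → ys ++ x ∷ zs ↭ x ∷ ys ++ zs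
  insert-perm ys = shift _ ys _

∈⇒↭ : ∀ {x : Elem} {xs} → x ∈ xs → ∃[ ys ] xs ↭ x ∷ ys
∈⇒↭ x∈ with ys , zs , refl ← ∈-∃++ x∈ = ys ++ zs , insert-perm ys

Unique-resp : ∀ {xs ys : List Elem} → xs ↭ ys → Unique xs → Unique ys
Unique-resp {Elem} = PermS.Unique-resp-↭ (setoid Elem) ∘ Perm.↭⇒↭ₛ

head∉ : ∀ {x : Elem} {xs} → Unique (x ∷ xs) → x ∉ xs
head∉ = UniqueP.Unique[x∷xs]⇒x∉xs

tail-unique : ∀ {x : Elem} {xs} → Unique (x ∷ xs) → Unique xs
tail-unique (_ ∷ u) = u

cons-unique : ∀ {x : Elem} {xs} → x ∉ xs → Unique xs → Unique (x ∷ xs)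
cons-unique x∉ u = AllP.¬Any⇒All¬ _ x∉ ∷ u

++-unique : ∀ {xs ys : List Elem} → Unique xs → Unique ys → (∀ {v} → v ∈ xs → v ∈ ys → ⊥) → Unique (xs ++ ys)
++-unique u w d = UniqueP.++⁺ u w (λ (p , q) → d p q)

++-unique⁻ : ∀ (xs : List Elem) {ys} → Unique (xs ++ ys) → Unique xs × Unique ys × (∀ {v} → v ∈ xs → v ∈ ys → ⊥)
++-unique⁻ [] u = [] , u , λ ()
++-unique⁻ (x ∷ xs) u with a , b , d ← ++-unique⁻ xs (tail-unique u) =
  cons-unique (head∉ u ∘ ∈-++⁺ˡ) a , b , λ where
    (here refl) q → head∉ u (∈-++⁺ʳ xs q)
    (there p)   q → d p q

count-⊆ : ∀ (f : Elem → Bool) {xs ys} → Unique xs → (∀ {x} → x ∈ xs → f x ≡ true → x ∈ ys) → count f xs ≤ count f ys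
count-⊆ f {[]} u s = z≤n
count-⊆ f {x ∷ xs} u s with f x in eq
... | false = count-⊆ f (tail-unique u) (s ∘ there)
... | true with zs , p ← ∈⇒↭ (s (here refl) eq) rewrite count-↭ f p | eq =
  s≤s (count-⊆ f (tail-unique u) λ {w} w∈ fw → case ∈-resp-↭ p (s (there w∈) fw) of λ where
    (here refl) → ⊥-elim (head∉ u w∈)
    (there w∈zs) → w∈zs)

count≤length : ∀ (f : Elem → Bool) xs → count f xs ≤ length xs
count≤length f [] = z≤n
count≤length f (x ∷ xs) = +-mono-≤ (bit≤1 (f x)) (count≤length f xs)

count-covered : ∀ (f : Elem → Bool) {xs} ys → Unique xs → (∀ {x} → x ∈ xs → f x ≡ true → x ∈ ys) → count f xs ≤ length ys
count-covered f ys u s = ≤-trans (count-⊆ f u s) (count≤length f ys)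

length-⊆ : ∀ {xs : List Elem} ys → Unique xs → (∀ {x} → x ∈ xs → x ∈ ys) → length xs ≤ length ys
length-⊆ {xs = xs} ys u s = subst (_≤ length ys) (count-all {f = λ _ → true} xs (λ _ → refl)) (count-covered _ ys u (λ p _ → s p))

-- The exceptional element `t` occurs at most once in `xs`. In the application `f` is `g` with one
-- edge added, and `t` is its far end.
count-extra : ∀ {f g : Elem → Bool} {t xs} → Unique xs → (∀ {x} → x ∈ xs → f x ≡ true → g x ≡ true ⊎ x ≡ t) → count f xs ≤ 1 + count g xs
count-extra {xs = []} u h = z≤n
count-extra {f = f} {g} {xs = x ∷ xs} u h with f x in eq
... | false = ≤-trans (count-extra (tail-unique u) (h ∘ there)) (s≤s (m≤n+m _ (bit (g x))))
... | true with h (here refl) eq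
...   | inj₁ gx rewrite gx = s≤s (count-extra (tail-unique u) (h ∘ there))
...   | inj₂ refl = s≤s (≤-trans (count-mono xs λ y∈ fy → [ id , (λ { refl → ⊥-elim (head∉ u y∈) }) ]′ (h (there y∈) fy)) (m≤n+m _ (bit (g x))))

length-filter : ∀ {P : Elem → Set} (P? : ∀ x → Dec (P x)) xs → length (filter P? xs) ≡ count (does ∘ P?) xs
length-filter P? []       = refl
length-filter P? (x ∷ xs) with does (P? x)
... | true  = cong suc (length-filter P? xs)
... | false = length-filter P? xs

∈-subst : ∀ {x : Elem} {xs ys} → xs ≡ ys → x ∈ xs → x ∈ ys
∈-subst refl = id

length>0 : ∀ {x : Elem} {xs} → x ∈ xs → 0 < length xs
length>0 (here _)  = s≤s z≤n
length>0 (there _) = s≤s z≤n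

-- Differences of lists and the pigeonhole principle.

module ListDiff {V : Set} (_≟_ : DecidableEquality V) where
  open import Data.List.Membership.DecPropositional _≟_ using (_∈?_) public

  infixl 6 _∖_
  _∖_ : List V → List V → List V
  U ∖ S = filter (λ w → ¬? (w ∈? S)) U

  ∈-∖⁺ : ∀ {U S w} → w ∈ U → w ∉ S → w ∈ U ∖ S
  ∈-∖⁺ = ∈-filter⁺ _

  ∈-∖⁻ : ∀ U {S w} → w ∈ U ∖ S → w ∈ U × w ∉ S
  ∈-∖⁻ U = ∈-filter⁻ _ {xs = U}

  ∖-unique : ∀ {U} S → Unique U → Unique (U ∖ S)
  ∖-unique S = UniqueP.filter⁺ _

  count-∖ : ∀ f {U S} → Unique U → Unique S → (∀ {w} → w ∈ S → w ∈ U) → count f U ≡ count f S + count f (U ∖ S)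
  count-∖ f {U} {S} uU uS s = trans
    (≤-antisym
      (count-⊆ f uU λ {w} w∈ _ → case w ∈? S of λ where
        (yes p) → ∈-++⁺ˡ p
        (no p) → ∈-++⁺ʳ S (∈-∖⁺ w∈ p))
      (count-⊆ f (++-unique uS (∖-unique S uU) λ p q → proj₂ (∈-∖⁻ U q) p) λ w∈ _ →
        [ s , proj₁ ∘ ∈-∖⁻ U ]′ (∈-++⁻ S w∈)))
    (count-++ f S)

  length-∖ : ∀ {U S} → Unique U → Unique S → (∀ {w} → w ∈ S → w ∈ U) → length U ≡ length S + length (U ∖ S)
  length-∖ {U} {S} uU uS s = trans (sym (all U)) (trans (count-∖ _ uU uS s) (cong₂ _+_ (all S) (all (U ∖ S))))
    where
    all : ∀ xs → count (λ _ → true) xs ≡ length xs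
    all xs = count-all xs (λ _ → refl)

  missing : ∀ L (F : List V) → Unique L → length F < length L → ∃[ c ] (c ∈ L × c ∉ F)
  missing L F u lt with any? (λ c → ¬? (c ∈? F)) L
  ... | yes p with c , c∈ , c∉ ← find p = c , c∈ , c∉
  ... | no p = contradiction (length-⊆ F u λ {c} c∈ → case c ∈? F of λ where
          (yes q) → q
          (no q) → ⊥-elim (p (lose c∈ q))) (<⇒≱ lt)

map-injective : ∀ {A B : Set} (f : A → B) {xs} → Unique (map f xs) → ∀ {x y} → x ∈ xs → y ∈ xs → f x ≡ f y → x ≡ y
map-injective f u (here refl) (here refl) e = refl
map-injective f {_ ∷ xs} u (here refl) (there y∈) e = ⊥-elim (head∉ u (subst (_∈ map f xs) (sym e) (∈-map⁺ f y∈)))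
map-injective f {_ ∷ xs} u (there x∈) (here refl) e = ⊥-elim (head∉ u (subst (_∈ map f xs) e (∈-map⁺ f x∈)))
map-injective f u (there x∈) (there y∈) e = map-injective f (tail-unique u) x∈ y∈ e

-- The number of colours is K = 2 + j, so that the degree bound 2 K − 3 becomes 1 + 2 j.

module Equitable {V : Set} (_≟_ : DecidableEquality V) where

  -- Extending a balanced colouring to a removed set.

  module Colour (j : ℕ) where
    open ListDiff _≟_

    K : ℕ
    K = 2 + j

    Adjacency : Set
    Adjacency = V → V → Bool

    open ListDiff (FinP._≟_ {K}) using () renaming (missing to missing-colour) public

    size : (V → Fin K) → List V → Fin K → ℕ
    size α U i = count (λ v → does (α v FinP.≟ i)) U

    ProperOn : Adjacency → List V → (V → Fin K) → Set
    ProperOn adj U α = ∀ {u v} → u ∈ U → v ∈ U → adj u v ≡ true → α u ≢ α v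

    Balanced : List V → (V → Fin K) → Set
    Balanced U α = ∀ i i′ → size α U i ≤ size α U i′ + 1

    Good : Adjacency → List V → Set
    Good adj U = ∃[ α ] (ProperOn adj U α × Balanced U α)

    paint : List V → List (Fin K) → (V → Fin K) → V → Fin K
    paint (v ∷ vs) (c ∷ cs) α w = if does (w ≟ v) then c else paint vs cs α w
    paint _ _ α w = α w

    paint-head : ∀ v vs c cs {α} → paint (v ∷ vs) (c ∷ cs) α v ≡ c
    paint-head v vs c cs rewrite dec-true (v ≟ v) refl = refl

    paint-tail : ∀ v vs c cs {α w} → w ≢ v → paint (v ∷ vs) (c ∷ cs) α w ≡ paint vs cs α w
    paint-tail v vs c cs {w = w} w≢v rewrite dec-false (w ≟ v) w≢v = refl

    paint-off : ∀ vs cs {α w} → w ∉ vs → paint vs cs α w ≡ α w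
    paint-off [] cs w∉ = refl
    paint-off (v ∷ vs) [] w∉ = refl
    paint-off (v ∷ vs) (c ∷ cs) w∉ = trans (paint-tail v vs c cs (w∉ ∘ here)) (paint-off vs cs (w∉ ∘ there))

    map-paint : ∀ {P : V → Fin K → Set} {vs cs α} → Unique vs → Pointwise P vs cs → map (paint vs cs α) vs ≡ cs
    map-paint u [] = refl
    map-paint {vs = v ∷ vs} {c ∷ cs} {α} u (p ∷ ps) = cong₂ _∷_ (paint-head v vs c cs)
      (trans (map-cong-local (All.tabulate λ w∈ → paint-tail v vs c cs λ { refl → head∉ u w∈ })) (map-paint (tail-unique u) ps))

    paint-on : ∀ {P : V → Fin K → Set} {vs cs α w} → Unique vs → Pointwise P vs cs → w ∈ vs → P w (paint vs cs α w)
    paint-on {P} {v ∷ vs} {c ∷ cs} u (p ∷ ps) (here refl) = subst (P v) (sym (paint-head v vs c cs)) p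
    paint-on {P} {v ∷ vs} {c ∷ cs} u (p ∷ ps) (there w∈) =
      subst (P _) (sym (paint-tail v vs c cs λ { refl → head∉ u w∈ })) (paint-on (tail-unique u) ps w∈)

    Fits : Adjacency → (V → Fin K) → List V → V → Fin K → Set
    Fits adj α U′ v c = ∀ {w} → w ∈ U′ → adj v w ≡ true → α w ≢ c

    size-paint : ∀ {U S cs α} {P : V → Fin K → Set} → Unique U → Unique S → (∀ {w} → w ∈ S → w ∈ U) → Pointwise P S cs →
      ∀ i → size (paint S cs α) U i ≡ count (λ c → does (c FinP.≟ i)) cs + size α (U ∖ S) i
    size-paint {U} {S} {cs} {α} uU uS s fits i = trans (count-∖ _ uU uS s) (cong₂ _+_
      (trans (sym (count-map (λ c → does (c FinP.≟ i)) (paint S cs α) S)) (cong (count (λ c → does (c FinP.≟ i))) (map-paint uS fits)))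
      (count-cong (U ∖ S) λ w∈ → cong (λ c → does (c FinP.≟ i)) (paint-off S cs (proj₂ (∈-∖⁻ U w∈)))))

    once : ∀ {cs : List (Fin K)} → Unique cs → ∀ i → count (λ c → does (c FinP.≟ i)) cs ≤ 1
    once u i = count-covered _ [ i ] u λ {c} _ e → case c FinP.≟ i of λ where
      (yes p) → here p
      (no p) → ⊥-elim (true≢false e (dec-false (c FinP.≟ i) p))

    count-allFin : ∀ {cs} → cs ↭ allFin K → ∀ i → count (λ c → does (c FinP.≟ i)) cs ≡ 1
    count-allFin p i = trans (count-↭ _ p) (≤-antisym (once (UniqueP.allFin⁺ K) i) (count-∈ {f = λ c → does (c FinP.≟ i)} {xs = allFin K} (∈-allFin i) (dec-true (i FinP.≟ i) refl)))

    ∖-self : ∀ U → ∀ {w : V} → w ∈ U ∖ U → ⊥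
    ∖-self U w∈ = proj₂ (∈-∖⁻ U w∈) (proj₁ (∈-∖⁻ U w∈))

    smallest : ∀ (f : Fin K → ℕ) → ∃[ σ ] (∀ i → f σ ≤ f i)
    smallest = go
      where
      go : ∀ {n} (f : Fin (suc n) → ℕ) → ∃[ σ ] (∀ i → f σ ≤ f i)
      go {zero} f = Fin.zero , λ { Fin.zero → ≤-refl }
      go {suc n} f with σ , h ← go (f ∘ Fin.suc) with ≤-total (f Fin.zero) (f (Fin.suc σ))
      ... | inj₁ le = Fin.zero , λ { Fin.zero → ≤-refl ; (Fin.suc i) → ≤-trans le (h i) }
      ... | inj₂ le = Fin.suc σ , λ { Fin.zero → le ; (Fin.suc i) → h i }

    module _ {adj : Adjacency} (symm : ∀ {u v} → adj u v ≡ true → adj v u ≡ true) (irr : ∀ {u} → adj u u ≡ true → ⊥) where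

      paint-proper : ∀ {U S cs α} → Unique S → Unique cs → ProperOn adj (U ∖ S) α →
        Pointwise (Fits adj α (U ∖ S)) S cs → ProperOn adj U (paint S cs α)
      paint-proper {U} {S} {cs} {α} uS ucs pr fits {u} {v} u∈ v∈ uv eq with u ∈? S | v ∈? S
      ... | yes p | yes q = irr (subst (λ w → adj u w ≡ true) (sym (map-injective _ (subst Unique (sym (map-paint uS fits)) ucs) p q eq)) uv)
      ... | yes p | no q = paint-on uS fits p (∈-∖⁺ v∈ q) uv (trans (sym (paint-off S cs q)) (sym eq))
      ... | no p | yes q = paint-on uS fits q (∈-∖⁺ u∈ p) (symm uv) (trans (sym (paint-off S cs p)) eq)
      ... | no p | no q = pr (∈-∖⁺ u∈ p) (∈-∖⁺ v∈ q) uv (trans (sym (paint-off S cs p)) (trans eq (paint-off S cs q)))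

      -- Since `cs` runs through every colour exactly once, each class grows by exactly one and the
      -- balance is inherited.
      extend : ∀ {U S cs α} → Unique U → Unique S → (∀ {w} → w ∈ S → w ∈ U) → ProperOn adj (U ∖ S) α → Balanced (U ∖ S) α →
        cs ↭ allFin K → Pointwise (Fits adj α (U ∖ S)) S cs → Good adj U
      extend {U} {S} {cs} {α} uU uS s pr bal p fits = paint S cs α ,
        (λ {u} {v} → paint-proper uS (Unique-resp (↭-sym p) (UniqueP.allFin⁺ K)) pr fits {u} {v}) , λ i i′ → begin
          size (paint S cs α) U i             ≡⟨ grows i ⟩
          suc (size α (U ∖ S) i)              ≤⟨ s≤s (bal i i′) ⟩
          suc (size α (U ∖ S) i′) + 1         ≡⟨ cong (_+ 1) (grows i′) ⟨
          size (paint S cs α) U i′ + 1        ∎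
        where
        open ≤-Reasoning
        grows : ∀ i → size (paint S cs α) U i ≡ suc (size α (U ∖ S) i)
        grows i = trans (size-paint uU uS s fits i) (cong (_+ size α (U ∖ S) i) (count-allFin p i))

      -- With distinct colours on all vertices every class has size at most one. The colouring being
      -- extended lives on the empty list `U ∖ U`, so its constant value is a dummy.
      few-vertices : ∀ {U} → Unique U → length U ≤ K → Good adj U
      few-vertices {U} uU le = paint U cs (λ _ → Fin.zero) ,
        (λ {u} {v} → paint-proper uU ucs (λ w∈ → ⊥-elim (∖-self U w∈)) fits {u} {v}) , λ i i′ →
          ≤-trans (≤-trans (≤-reflexive (trans (size-paint uU uU id fits i) (trans (cong (count (λ c → does (c FinP.≟ i)) cs +_) (nil i)) (+-identityʳ _)))) (once ucs i)) (m≤n+m 1 _)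
        where
        cs = take (length U) (allFin K)
        ucs = UniqueP.take⁺ (length U) (UniqueP.allFin⁺ K)
        nil : ∀ i → size (λ _ → Fin.zero) (U ∖ U) i ≡ 0
        nil i = count-none (U ∖ U) λ w∈ _ → ∖-self U w∈
        zipAny : ∀ vs (cs : List (Fin K)) → length vs ≡ length cs → (∀ {w} → w ∈ vs → w ∈ U) → Pointwise (Fits adj (λ _ → Fin.zero) (U ∖ U)) vs cs
        zipAny [] [] e s = []
        zipAny (v ∷ vs) (c ∷ cs) e s = (λ w∈ → ⊥-elim (∖-self U w∈)) ∷ zipAny vs cs (suc-injective e) (s ∘ there)
        fits = zipAny U cs (sym (trans (length-take (length U) (allFin K)) (trans (cong (length U Data.Nat.⊓_) (length-tabulate {n = K} id)) (m≤n⇒m⊓n≡m le)))) id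

      add-to-smallest : ∀ {U v α σ} → Unique U → v ∈ U → ProperOn adj (U ∖ [ v ]) α → Balanced (U ∖ [ v ]) α →
        (∀ i → size α (U ∖ [ v ]) σ ≤ size α (U ∖ [ v ]) i) → Fits adj α (U ∖ [ v ]) v σ →
        ProperOn adj U (paint [ v ] [ σ ] α) × Balanced U (paint [ v ] [ σ ] α)
      add-to-smallest {U} {v} {α} {σ} uU v∈ pr bal least fits =
        (λ {u} {w} → paint-proper ([] ∷ []) ([] ∷ []) pr pw {u} {w}) , λ i i′ → subst₂′ (sz i) (sz i′) (bal′ i i′)
        where
        pw : Pointwise (Fits adj α (U ∖ [ v ])) [ v ] [ σ ]
        pw = fits ∷ []
        s = size α (U ∖ [ v ])
        sz : ∀ i → size (paint [ v ] [ σ ] α) U i ≡ bit (does (σ FinP.≟ i)) + s i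
        sz i = trans (size-paint uU ([] ∷ []) (λ { (here refl) → v∈ }) pw i) (cong (_+ s i) (+-identityʳ _))
        subst₂′ : ∀ {a b c d} → a ≡ c → b ≡ d → c ≤ d + 1 → a ≤ b + 1
        subst₂′ refl refl h = h
        bal′ : ∀ i i′ → bit (does (σ FinP.≟ i)) + s i ≤ bit (does (σ FinP.≟ i′)) + s i′ + 1
        bal′ i i′ with σ FinP.≟ i
        ... | yes refl = ≤-trans (s≤s (least i′)) (≤-trans (≤-reflexive (+-comm 1 _)) (+-monoˡ-≤ 1 (m≤n+m (s i′) _)))
        ... | no _ = ≤-trans (bal i i′) (+-monoˡ-≤ 1 (m≤n+m (s i′) _))

    -- Quantifying over every list `L` of distinct colours, not only the full palette, is what
    -- allows vertices to be prepended: the later ones must cope with whatever the earlier ones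
    -- leave over.
    Assignable : Adjacency → (V → Fin K) → List V → List V → Set
    Assignable adj α U′ vs = ∀ L → Unique L → length L ≡ length vs → ∃[ cs ] (cs ↭ L × Pointwise (Fits adj α U′) vs cs)

    module _ {adj : Adjacency} {α : V → Fin K} {U′ : List V} where

      nbrColours : V → List (Fin K)
      nbrColours v = map α (filter (λ w → adj v w Data.Bool.≟ true) U′)

      length-nbrColours : ∀ v → length (nbrColours v) ≡ count (adj v) U′
      length-nbrColours v = trans (length-map α (filter (λ w → adj v w Data.Bool.≟ true) U′)) (go U′)
        where
        go : ∀ U → length (filter (λ w → adj v w Data.Bool.≟ true) U) ≡ count (adj v) U
        go [] = refl
        go (w ∷ U) with adj v w
        ... | true = cong suc (go U)
        ... | false = go U

      ∉nbrColours : ∀ {v c} → c ∉ nbrColours v → Fits adj α U′ v c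
      ∉nbrColours c∉ w∈ vw refl = c∉ (∈-map⁺ α (∈-filter⁺ _ w∈ vw))

      assign-[] : Assignable adj α U′ []
      assign-[] [] _ _ = [] , Perm.refl , []

      -- Greedy step: the `1 + length vs` colours of `L` outnumber those forbidden at `v`. The head
      -- of the list chooses first, so vertices with many neighbours in `U′` belong at the front of
      -- S.
      assign-∷ : ∀ {v vs} → count (adj v) U′ ≤ length vs → Assignable adj α U′ vs → Assignable adj α U′ (v ∷ vs)
      assign-∷ {v} {vs} le rest L uL eq
        with c , c∈ , c∉ ← missing-colour L (nbrColours v) uL (≤-trans (s≤s (≤-trans (≤-reflexive (length-nbrColours v)) le)) (≤-reflexive (sym eq)))
        with L′ , p ← ∈⇒↭ c∈
        with cs , q , fits ← rest L′ (tail-unique (Unique-resp p uL)) (suc-injective (trans (sym (↭-length p)) eq)) =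
        c ∷ cs , Perm.trans (prep c q) (↭-sym p) , ∉nbrColours c∉ ∷ fits

      assign-++ : ∀ {d} P {vs} → (∀ {e} → e ∈ P → count (adj e) U′ ≤ d) → d ≤ length vs → Assignable adj α U′ vs → Assignable adj α U′ (P ++ vs)
      assign-++ [] h le rest = rest
      assign-++ {d} (e ∷ P) {vs} h le rest = assign-∷ {e} {P ++ vs} (≤-trans (h (here refl)) (≤-trans le (≤-trans (m≤n+m _ (length P)) (≤-reflexive (sym (length-++ P))))))
        (assign-++ P (h ∘ there) le rest)

      -- Each vertex has at most one forbidden colour. Of the two ways to hand out two colours, both
      -- fail only if the forbidden colours exist and coincide.
      assign-pair : ∀ {u v x y} → (∀ {w} → w ∈ U′ → adj u w ≡ true → w ≡ x) → (∀ {w} → w ∈ U′ → adj v w ≡ true → w ≡ y) →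
        α x ≢ α y ⊎ count (adj u) U′ ≡ 0 ⊎ count (adj v) U′ ≡ 0 → Assignable adj α U′ (u ∷ v ∷ [])
      assign-pair {u} {v} {x} {y} hu hv h (c ∷ d ∷ []) uL eq = go h
        where
        direct : Fits adj α U′ u c → Fits adj α U′ v d → ∃[ cs ] (cs ↭ c ∷ d ∷ [] × Pointwise (Fits adj α U′) (u ∷ v ∷ []) cs)
        direct p q = c ∷ d ∷ [] , Perm.refl , p ∷ q ∷ []
        crossed : Fits adj α U′ u d → Fits adj α U′ v c → ∃[ cs ] (cs ↭ c ∷ d ∷ [] × Pointwise (Fits adj α U′) (u ∷ v ∷ []) cs)
        crossed p q = d ∷ c ∷ [] , swap d c Perm.refl , p ∷ q ∷ []
        c≢d : c ≢ d
        c≢d refl = head∉ uL (here refl)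
        fu : ∀ {e} → α x ≢ e → Fits adj α U′ u e
        fu n w∈ uw refl = n (cong α (sym (hu w∈ uw)))
        fv : ∀ {e} → α y ≢ e → Fits adj α U′ v e
        fv n w∈ vw refl = n (cong α (sym (hv w∈ vw)))
        free : ∀ {w e} → count (adj w) U′ ≡ 0 → Fits adj α U′ w e
        free z w∈ uw _ = count-∉ U′ z w∈ uw
        go : α x ≢ α y ⊎ count (adj u) U′ ≡ 0 ⊎ count (adj v) U′ ≡ 0 → _
        go (inj₂ (inj₁ z)) with α y FinP.≟ c
        ... | yes refl = direct (free z) (fv c≢d)
        ... | no n = crossed (free z) (fv n)
        go (inj₂ (inj₂ z)) with α x FinP.≟ c
        ... | yes refl = crossed (fu c≢d) (free z)
        ... | no n = direct (fu n) (free z)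
        go (inj₁ n) with α x FinP.≟ c | α y FinP.≟ d
        ... | no p | no q = direct (fu p) (fv q)
        ... | yes refl | _ = crossed (fu c≢d) (fv (n ∘ sym))
        ... | no p | yes refl = crossed (fu n) (fv (c≢d ∘ sym))

  -- Reductions to a smaller graph.

  module Reductions (j : ℕ) (_—_ : V → V → Set) (—-sym : ∀ {u v} → u — v → v — u) where
    open ListDiff _≟_
    open Colour j

    -- The relation `_—_` will be adjacency in the fixed 2-tree; `support` is all that the induction
    -- remembers of the absence of a K₄-minor.
    record Valid (adj : Adjacency) (U : List V) : Set where
      field
        unique  : Unique U
        symm    : ∀ {u v} → adj u v ≡ true → adj v u ≡ true
        irr     : ∀ {u} → adj u u ≡ true → ⊥
        support : ∀ {u v} → adj u v ≡ true → u — v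
        inside  : ∀ {u v} → adj u v ≡ true → v ∈ U
        degree≤ : ∀ v → count (adj v) U ≤ 1 + 2 * j

    -- An adjacency is defined on all of `V`, so edges at removed vertices must be cut off before
    -- `inside` holds for the smaller list.
    restrict : List V → Adjacency → Adjacency
    restrict U f u v = does (u ∈? U) ∧ (does (v ∈? U) ∧ f u v)

    restrict⁻ : ∀ U f {u v} → restrict U f u v ≡ true → u ∈ U × v ∈ U × f u v ≡ true
    restrict⁻ U f {u} {v} e with u ∈? U | v ∈? U
    ... | yes p | yes q = p , q , e
    ... | yes p | no q = ⊥-elim (true≢false e refl)
    ... | no p | _ = ⊥-elim (true≢false e refl)

    restrict⁺ : ∀ U f {u v} → u ∈ U → v ∈ U → f u v ≡ true → restrict U f u v ≡ true
    restrict⁺ U f {u} {v} p q e rewrite dec-true (u ∈? U) p | dec-true (v ∈? U) q = e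

    restrict-valid : ∀ {U f} → Unique U → (∀ {u v} → f u v ≡ true → f v u ≡ true) → (∀ {u} → f u u ≡ true → ⊥) →
      (∀ {u v} → f u v ≡ true → u — v) → (∀ {v} → v ∈ U → count (f v) U ≤ 1 + 2 * j) → Valid (restrict U f) U
    restrict-valid {U} {f} uU s i p d = record
      { unique  = uU
      ; symm    = λ e → let a , b , c = restrict⁻ U f e in restrict⁺ U f b a (s c)
      ; irr     = λ e → i (proj₂ (proj₂ (restrict⁻ U f e)))
      ; support = λ e → p (proj₂ (proj₂ (restrict⁻ U f e)))
      ; inside  = λ e → proj₁ (proj₂ (restrict⁻ U f e))
      ; degree≤ = deg
      }
      where
      deg : ∀ v → count (restrict U f v) U ≤ 1 + 2 * j
      deg v = case v ∈? U of λ where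
        (yes v∈) → ≤-trans (count-mono U λ _ e → proj₂ (proj₂ (restrict⁻ U f e))) (d v∈)
        (no v∉) → ≤-trans (≤-reflexive (count-none U λ _ e → v∉ (proj₁ (restrict⁻ U f e)))) z≤n

    proper-restrict : ∀ {U f α} → ProperOn (restrict U f) U α → ProperOn f U α
    proper-restrict {U} {f} pr u∈ v∈ e = pr u∈ v∈ (restrict⁺ U f u∈ v∈ e)

    module _ {adj : Adjacency} {U : List V} (valid : Valid adj U) where
      open Valid valid

      Smaller : Set
      Smaller = ∀ {adj′ U′} → length U′ < length U → (∀ {w} → w ∈ U′ → w ∈ U) → Valid adj′ U′ → Good adj′ U′

      module _ (smaller : Smaller) where

        colour-rest : ∀ f {S s} → Unique S → (∀ {w} → w ∈ S → w ∈ U) → s ∈ S → (∀ {u v} → f u v ≡ true → f v u ≡ true) → (∀ {u} → f u u ≡ true → ⊥) →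
          (∀ {u v} → f u v ≡ true → u — v) → (∀ {v} → v ∈ U ∖ S → count (f v) (U ∖ S) ≤ 1 + 2 * j) →
          ∃[ α ] (ProperOn f (U ∖ S) α × Balanced (U ∖ S) α)
        colour-rest f {S} {s} uS S⊆ s∈ sf irf suf d
          with α , pr , bal ← smaller
            (subst (length (U ∖ S) <_) (sym (length-∖ unique uS S⊆)) (m<n+m _ (length>0 s∈))) (proj₁ ∘ ∈-∖⁻ U)
            (restrict-valid {f = f} (∖-unique S unique) sf irf suf d) = α , proper-restrict {f = f} pr , bal

        degree-rest : ∀ {S} → Unique S → (∀ {w} → w ∈ S → w ∈ U) → ∀ v → count (adj v) S + count (adj v) (U ∖ S) ≤ 1 + 2 * j
        degree-rest uS S⊆ v = subst (_≤ 1 + 2 * j) (count-∖ (adj v) unique uS S⊆) (degree≤ v)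

        remove : ∀ S → Unique S → (∀ {w} → w ∈ S → w ∈ U) → length S ≡ K →
          (∀ α → Assignable adj α (U ∖ S) S) → Good adj U
        remove S@(_ ∷ _) uS S⊆ lS asg
          with α , pr , bal ← colour-rest adj uS S⊆ (here refl) symm irr support (λ {v} _ → m+n≤o⇒n≤o _ (degree-rest uS S⊆ v))
          with cs , p , fits ← asg α (allFin K) (UniqueP.allFin⁺ K) (trans (length-tabulate {n = K} id) (sym lS)) =
          extend symm irr unique uS S⊆ pr bal p fits

        -- If the last two vertices each have a single neighbour left, those two neighbours are forced to get
        -- distinct colours by an extra edge; the edge keeps the degrees since each of them lost a neighbour.
        remove-pair : ∀ S {u v x y} → Unique S → (∀ {w} → w ∈ S → w ∈ U) → length S ≡ K → u ∈ S → v ∈ S → x — y → x ≢ y →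
          (∀ {w} → w ∈ U ∖ S → adj u w ≡ true → w ≡ x) → (∀ {w} → w ∈ U ∖ S → adj v w ≡ true → w ≡ y) →
          (∀ α → Assignable adj α (U ∖ S) (u ∷ v ∷ []) → Assignable adj α (U ∖ S) S) → Good adj U
        remove-pair S {u} {v} {x} {y} uS S⊆ lS u∈ v∈ x—y x≢y hu hv asg
          with any? (λ w → adj u w Data.Bool.≟ true) (U ∖ S) | any? (λ w → adj v w Data.Bool.≟ true) (U ∖ S)
        -- If `u` or `v` has no neighbour left, the pair can be coloured whatever `x` and `y` get.
        -- No edge is added then, and `x` or `y` may even lie outside `U ∖ S`.
        ... | no n | _ = remove S uS S⊆ lS λ α → asg α (assign-pair hu hv (inj₂ (inj₁ (count-none (U ∖ S) λ w∈ e → n (lose w∈ e)))))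
        ... | yes _ | no n = remove S uS S⊆ lS λ α → asg α (assign-pair hu hv (inj₂ (inj₂ (count-none (U ∖ S) λ w∈ e → n (lose w∈ e)))))
        ... | yes p | yes q
          with a , a∈ , ua ← find p | b , b∈ , vb ← find q
          with refl ← hu a∈ ua | refl ← hv b∈ vb = joined
          where
          f : Adjacency
          f a b = adj a b ∨ ((does (a ≟ x) ∧ does (b ≟ y)) ∨ (does (a ≟ y) ∧ does (b ≟ x)))
          f⁻ : ∀ {a b} → f a b ≡ true → adj a b ≡ true ⊎ (a ≡ x × b ≡ y) ⊎ (a ≡ y × b ≡ x)
          f⁻ {a} {b} e with adj a b
          ... | true = inj₁ refl
          ... | false with a ≟ x | b ≟ y | a ≟ y | b ≟ x
          ... | yes r | yes s | _ | _ = inj₂ (inj₁ (r , s))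
          ... | yes r | no s | yes r′ | yes s′ = inj₂ (inj₂ (r′ , s′))
          ... | no r | _ | yes r′ | yes s′ = inj₂ (inj₂ (r′ , s′))
          f-adj : ∀ {a b} → adj a b ≡ true → f a b ≡ true
          f-adj e rewrite e = refl
          f-xy : f x y ≡ true
          f-xy rewrite dec-true (x ≟ x) refl | dec-true (y ≟ y) refl with adj x y
          ... | true = refl
          ... | false = refl
          f-yx : f y x ≡ true
          f-yx rewrite dec-true (x ≟ x) refl | dec-true (y ≟ y) refl with adj y x | does (y ≟ x) ∧ does (x ≟ y)
          ... | true | _ = refl
          ... | false | true = refl
          ... | false | false = refl
          f-sym : ∀ {a b} → f a b ≡ true → f b a ≡ true
          f-sym e with f⁻ e
          ... | inj₁ r = f-adj (symm r)
          ... | inj₂ (inj₁ (refl , refl)) = f-yx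
          ... | inj₂ (inj₂ (refl , refl)) = f-xy
          f-irr : ∀ {a} → f a a ≡ true → ⊥
          f-irr e with f⁻ e
          ... | inj₁ r = irr r
          ... | inj₂ (inj₁ (refl , refl)) = x≢y refl
          ... | inj₂ (inj₂ (refl , refl)) = x≢y refl
          f-sup : ∀ {a b} → f a b ≡ true → a — b
          f-sup e with f⁻ e
          ... | inj₁ r = support r
          ... | inj₂ (inj₁ (refl , refl)) = x—y
          ... | inj₂ (inj₂ (refl , refl)) = —-sym x—y
          R = U ∖ S
          uR = ∖-unique S unique
          more : ∀ {a s t} → s ∈ S → adj a s ≡ true → (∀ {b} → f a b ≡ true → adj a b ≡ true ⊎ b ≡ t) → count (f a) R ≤ 1 + 2 * j
          more {a} s∈ as h = ≤-trans (count-extra uR λ _ → h) (≤-trans (+-monoˡ-≤ (count (adj a) R) (count-∈ {f = adj a} s∈ as)) (degree-rest uS S⊆ a))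
          f-deg : ∀ {a} → a ∈ R → count (f a) R ≤ 1 + 2 * j
          f-deg {a} a∈ = by-cases (a ≟ x) (a ≟ y)
            where
            by-cases : Dec (a ≡ x) → Dec (a ≡ y) → count (f a) R ≤ 1 + 2 * j
            by-cases (yes refl) _ = more u∈ (symm ua) λ e → case f⁻ e of λ where
              (inj₁ r) → inj₁ r
              (inj₂ (inj₁ (_ , r))) → inj₂ r
              (inj₂ (inj₂ (r , _))) → ⊥-elim (x≢y r)
            by-cases (no n) (yes refl) = more v∈ (symm vb) λ e → case f⁻ e of λ where
              (inj₁ r) → inj₁ r
              (inj₂ (inj₁ (r , _))) → ⊥-elim (n r)
              (inj₂ (inj₂ (_ , r))) → inj₂ r
            by-cases (no n) (no m) = ≤-trans (count-mono R λ _ e → case f⁻ e of λ where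
                (inj₁ r) → r
                (inj₂ (inj₁ (r , _))) → ⊥-elim (n r)
                (inj₂ (inj₂ (r , _))) → ⊥-elim (m r)) (m+n≤o⇒n≤o _ (degree-rest uS S⊆ a))
          joined : Good adj U
          joined
            with α , pr , bal ← colour-rest f uS S⊆ u∈ f-sym f-irr f-sup f-deg
            with cs , p , fits ← asg α (assign-pair hu hv (inj₁ (pr a∈ b∈ f-xy))) (allFin K) (UniqueP.allFin⁺ K) (trans (length-tabulate {n = K} id) (sym lS)) =
            extend symm irr unique uS S⊆ (λ {a} {b} a∈ b∈ e → pr {a} {b} a∈ b∈ (f-adj e)) bal p fits

        -- Nothing restricts the colour of `v`, so it can go to a smallest class.
        isolated : ∀ {v} → v ∈ U → (∀ {w} → adj v w ≡ true → ⊥) → Good adj U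
        isolated {v} v∈ iso
          with α , pr , bal ← colour-rest adj {[ v ]} ([] ∷ []) (λ { (here refl) → v∈ }) (here refl) symm irr support
            (λ {w} _ → m+n≤o⇒n≤o _ (degree-rest {[ v ]} ([] ∷ []) (λ { (here refl) → v∈ }) w))
          with σ , least ← smallest (size α (U ∖ [ v ])) =
          paint [ v ] [ σ ] α , add-to-smallest symm irr unique v∈ (λ {a} {b} → pr {a} {b}) bal least (λ _ e → ⊥-elim (iso e))

  -- Peeling, and completing a set to exactly `K` vertices.

  module Configurations (j : ℕ) (_—_ : V → V → Set) (—-sym : ∀ {u v} → u — v → v — u)
    {adj : V → V → Bool} {U : List V}
    (valid : Reductions.Valid j _—_ —-sym adj U) (smaller : Reductions.Smaller j _—_ —-sym valid)
    (nonisolated : ∀ {v} → v ∈ U → ∃[ w ] adj v w ≡ true)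
    where
    open ListDiff _≟_
    open Colour j
    open Reductions j _—_ —-sym
    open Valid valid

    infix 4 _~_ _≁_ _⊆_
    _~_ _≁_ : V → V → Set
    u ~ v = adj u v ≡ true
    u ≁ v = adj u v ≡ false

    _⊆_ : List V → List V → Set
    M ⊆ N = ∀ {w} → w ∈ M → w ∈ N

    Closed : V → V → List V → Set
    Closed x y M = ∀ {d w} → d ∈ M → d ~ w → w ∈ M ⊎ w ≡ x ⊎ w ≡ y

    -- A form of 2-degeneracy that survives gluing. `X` is what has not been peeled yet; `p` and `q`
    -- may lie outside `M`, so the two vertices on which a part hangs are counted too, and only
    -- neighbours already peeled from `M` are free.
    Peelable : List V → Set
    Peelable M = ∀ X → X ⊆ M → ∀ {x} → x ∈ X →
      ∃[ e ] (e ∈ X × ∃[ p ] ∃[ q ] (∀ {w} → e ~ w → (w ∈ M × w ∉ X) ⊎ w ≡ p ⊎ w ≡ q))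

    outside : ∀ {v} S L → (∀ {w} → v ~ w → w ∉ S → w ∈ L) → count (adj v) (U ∖ S) ≤ length L
    outside S L h = count-covered _ L (∖-unique S unique) λ w∈ e → h e (proj₂ (∈-∖⁻ U w∈))

    Slim : List V → List V → V → Set
    Slim M S e = ∃[ p ] ∃[ q ] (∀ {w} → e ~ w → (w ∈ M × w ∈ S) ⊎ w ≡ p ⊎ w ≡ q)

    -- Everything peeled before a vertex ends up in the same set, so at most two of its neighbours
    -- remain outside. Vertices obtained in this way can pad S to the right size.
    peel : ∀ {M} → Peelable M → ∀ S₀ t → t ≤ length (M ∖ S₀) → Unique M →
      ∃[ P ] (Unique P × length P ≡ t × P ⊆ M × (∀ {w} → w ∈ P → w ∉ S₀) × (∀ {e} → e ∈ P → Slim M (P ++ S₀) e))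
    peel pl S₀ zero le uM = [] , [] , refl , (λ ()) , (λ ()) , λ ()
    peel {M} pl S₀ (suc t) le uM
      with x ∷ X ← M ∖ S₀ in eq
      with e , e∈ , p , q , h ← pl (M ∖ S₀) (proj₁ ∘ ∈-∖⁻ M) (subst (x ∈_) (sym eq) (here refl))
      with e∈M , e∉ ← ∈-∖⁻ M e∈
      with P , uP , lP , P⊆ , fresh , slim ← peel pl (e ∷ S₀) t (s≤s⁻¹ (≤-trans le (≤-trans (≤-reflexive (cong length (sym eq)))
        (length-⊆ (e ∷ (M ∖ (e ∷ S₀))) (∖-unique S₀ uM) λ {w} w∈ → case w ≟ e of λ where
          (yes refl) → here refl
          (no n) → there (∈-∖⁺ (proj₁ (∈-∖⁻ M w∈)) λ { (here r) → n r ; (there r) → proj₂ (∈-∖⁻ M w∈) r }))))) uM =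
      e ∷ P , cons-unique (λ e∈P → fresh e∈P (here refl)) uP , cong suc lP ,
      (λ { (here refl) → e∈M ; (there r) → P⊆ r }) ,
      (λ { (here refl) → e∉ ; (there r) → fresh r ∘ there }) , λ where
        (here refl) → p , q , λ {w} ew → case h ew of λ where
          (inj₁ (w∈ , w∉)) → case w ∈? S₀ of λ where
            (yes r) → inj₁ (w∈ , there (∈-++⁺ʳ P r))
            (no r) → ⊥-elim (w∉ (∈-∖⁺ w∈ r))
          (inj₂ r) → inj₂ r
        (there r) → case slim r of λ where
          (p′ , q′ , h′) → p′ , q′ , λ {w} ew → case h′ ew of λ where
            (inj₁ (w∈ , w∈S)) → inj₁ (w∈ , [ there ∘ ∈-++⁺ˡ , (λ { (here refl) → here refl ; (there s) → there (∈-++⁺ʳ P s) }) ]′ (∈-++⁻ P w∈S))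
            (inj₂ s) → inj₂ s

    -- S is listed in the order in which it is coloured: `h` holds the vertices that may keep many
    -- neighbours, `r` is the prescribed tail, and the fillers, with at most two neighbours left, go
    -- in between.
    record Completion (M h r : List V) : Set where
      field
        filler  : List V
        filler⊆ : filler ⊆ M
        length-filler : length filler + length (h ++ r) ≡ K
        uniqueS : Unique (h ++ filler ++ r)
        S⊆      : h ++ filler ++ r ⊆ U
        lengthS : length (h ++ filler ++ r) ≡ K
        core    : h ++ r ⊆ h ++ filler ++ r
        slim    : ∀ {e} → e ∈ filler → Slim M (h ++ filler ++ r) e
      S : List V
      S = h ++ filler ++ r

      filler≤2 : ∀ {e} → e ∈ filler → count (adj e) (U ∖ S) ≤ 2
      filler≤2 e∈ with p , q , f ← slim e∈ = outside S (p ∷ q ∷ []) λ ew w∉ → case f ew of λ where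
        (inj₁ (_ , w∈)) → ⊥-elim (w∉ w∈)
        (inj₂ (inj₁ refl)) → here refl
        (inj₂ (inj₂ refl)) → there (here refl)

      -- Lying outside `M`, the vertex `x` must be one of the two exceptional neighbours of `e`; as
      -- a member of S it no longer counts.
      filler≤1 : ∀ {e x} → e ∈ filler → e ~ x → x ∉ M → x ∈ S → count (adj e) (U ∖ S) ≤ 1
      filler≤1 e∈ ex x∉M x∈S with p , q , f ← slim e∈ = case f ex of λ where
        (inj₁ (x∈M , _)) → ⊥-elim (x∉M x∈M)
        (inj₂ (inj₁ refl)) → outside S [ q ] λ ew w∉ → case f ew of λ where
          (inj₁ (_ , w∈)) → ⊥-elim (w∉ w∈)
          (inj₂ (inj₁ refl)) → ⊥-elim (w∉ x∈S)
          (inj₂ (inj₂ refl)) → here refl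
        (inj₂ (inj₂ refl)) → outside S [ p ] λ ew w∉ → case f ew of λ where
          (inj₁ (_ , w∈)) → ⊥-elim (w∉ w∈)
          (inj₂ (inj₁ refl)) → here refl
          (inj₂ (inj₂ refl)) → ⊥-elim (w∉ x∈S)

    complete : ∀ {M} → Peelable M → Unique M → M ⊆ U → ∀ h r → Unique (h ++ r) → h ++ r ⊆ U →
      length (h ++ r) ≤ K → K ≤ length (h ++ r) + length (M ∖ (h ++ r)) → Completion M h r
    complete {M} pl uM M⊆ h r uhr hr⊆ le ge
      with P , uP , lP , P⊆ , fresh , slim ← peel pl (h ++ r) (K ∸ length (h ++ r)) (m≤n+o⇒m∸n≤o K (length (h ++ r)) ge) uM = record
      { filler = P
      ; filler⊆ = P⊆
      ; length-filler = lenP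
      ; uniqueS = Unique-resp (↭-sym shuffled) (++-unique uP uhr λ p q → fresh p q)
      ; S⊆ = λ w∈ → [ M⊆ ∘ P⊆ , hr⊆ ]′ (∈-++⁻ P (∈-resp-↭ shuffled w∈))
      ; lengthS = trans (↭-length shuffled) (trans (length-++ P) lenP)
      ; core = λ w∈ → ∈-resp-↭ (↭-sym shuffled) (∈-++⁺ʳ P w∈)
      ; slim = λ e∈ → case slim e∈ of λ where
          (p , q , f) → p , q , λ {w} ew → case f ew of λ where
            (inj₁ (a , b)) → inj₁ (a , ∈-resp-↭ (↭-sym shuffled) b)
            (inj₂ b) → inj₂ b
      }
      where
      shuffled : h ++ P ++ r ↭ P ++ h ++ r
      shuffled = PermP.shifts h P
      lenP : length P + length (h ++ r) ≡ K
      lenP = trans (cong (_+ length (h ++ r)) lP) (m∸n+n≡m le)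

    -- Configurations that contain a removable set.

    ∖-++-unique : ∀ {M} L → Unique M → Unique L → Unique ((M ∖ L) ++ L)
    ∖-++-unique {M} L uM uL = ++-unique (∖-unique L uM) uL λ p q → proj₂ (∈-∖⁻ M p) q

    ∈-∖-++ : ∀ {M} L {w} → w ∈ M → w ∈ (M ∖ L) ++ L
    ∈-∖-++ {M} L {w} w∈ = case w ∈? L of λ where
      (yes r) → ∈-++⁺ʳ (M ∖ L) r
      (no r) → ∈-++⁺ˡ (∈-∖⁺ w∈ r)

    ∖-++-⊆ : ∀ {M} L → L ⊆ M → (M ∖ L) ++ L ⊆ M
    ∖-++-⊆ {M} L L⊆ w∈ = [ proj₁ ∘ ∈-∖⁻ M , L⊆ ]′ (∈-++⁻ (M ∖ L) w∈)

    length-∖-++ : ∀ {M} L → Unique M → Unique L → L ⊆ M → length ((M ∖ L) ++ L) ≡ length M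
    length-∖-++ {M} L uM uL L⊆ = trans (length-++ (M ∖ L)) (trans (+-comm (length (M ∖ L)) (length L)) (sym (length-∖ uM uL L⊆)))

    pair-unique : ∀ {u v : V} → u ≢ v → Unique (u ∷ v ∷ [])
    pair-unique u≢v = cons-unique (λ { (here r) → u≢v r ; (there ()) }) ([] ∷ [])

    pair-⊆ : ∀ {M u v} → u ∈ M → v ∈ M → u ∷ v ∷ [] ⊆ M
    pair-⊆ u∈ v∈ (here refl) = u∈
    pair-⊆ u∈ v∈ (there (here refl)) = v∈

    -- All of `M` goes into S, so outside S the vertex `u` sees at most `x` and `v` at most `y`: the
    -- situation of `remove-pair`. The fillers may come from anywhere in `U`.
    spread-pair : Peelable U → K ≤ length U → ∀ {x y M u v} → Closed x y M → Unique M → M ⊆ U → length M ≤ K →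
      u ∈ M → v ∈ M → u ≢ v → u ≁ y → v ≁ x → x — y → x ≢ y → Good adj U
    spread-pair pU enough {x} {y} {M} {u} {v} cl uM M⊆ le u∈ v∈ u≢v u≁y v≁x x—y x≢y =
      remove-pair valid smaller S uniqueS S⊆ lengthS (inS u∈) (inS v∈) x—y x≢y
        (λ w∈ uw → case cl u∈ uw of λ where
          (inj₁ r) → ⊥-elim (proj₂ (∈-∖⁻ U w∈) (inS r))
          (inj₂ (inj₁ r)) → r
          (inj₂ (inj₂ refl)) → ⊥-elim (true≢false uw u≁y))
        (λ w∈ vw → case cl v∈ vw of λ where
          (inj₁ r) → ⊥-elim (proj₂ (∈-∖⁻ U w∈) (inS r))
          (inj₂ (inj₁ refl)) → ⊥-elim (true≢false vw v≁x)
          (inj₂ (inj₂ r)) → r)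
        λ α asg → assign-++ filler filler≤2 (≤-trans (m≤n+m 2 (length M′)) (≤-reflexive (sym (length-++ M′))))
          (assign-++ M′ (λ d∈ → outside S (x ∷ y ∷ []) λ dw w∉ → case cl (proj₁ (∈-∖⁻ M d∈)) dw of λ where
            (inj₁ r) → ⊥-elim (w∉ (inS r))
            (inj₂ (inj₁ refl)) → here refl
            (inj₂ (inj₂ refl)) → there (here refl)) ≤-refl asg)
      where
      L = u ∷ v ∷ []
      M′ = M ∖ L
      uL = pair-unique u≢v
      L⊆ = pair-⊆ u∈ v∈
      len = length-∖-++ L uM uL L⊆
      uS₀ = ∖-++-unique L uM uL
      S₀⊆ : M′ ++ L ⊆ U
      S₀⊆ = M⊆ ∘ ∖-++-⊆ L L⊆
      open Completion (complete pU unique id [] (M′ ++ L) uS₀ S₀⊆ (subst (_≤ K) (sym len) le)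
        (≤-trans enough (≤-reflexive (length-∖ unique uS₀ S₀⊆))))
      inS : M ⊆ S
      inS w∈ = core (∈-∖-++ L w∈)

    -- The apex `x` joins S at the front. It sees the `j` vertices of S other than itself and `v₀`,
    -- hence at most `j + 1 = K − 1` vertices outside. With `x` in S, fillers from `N₂` and the rest
    -- of `N₁` keep at most one neighbour each, and `v₀` keeps none.
    spread-apex : ∀ {x y N₁ N₂ v₀} → Closed x y N₁ → Peelable N₂ → Unique N₁ → Unique N₂ → N₁ ⊆ U → N₂ ⊆ U →
      (∀ {w} → w ∈ N₁ → w ∈ N₂ → ⊥) → x ∉ N₁ → x ∉ N₂ → v₀ ∈ N₁ → v₀ ≁ y → (∀ {w} → w ∈ N₁ → w ≢ v₀ → w ~ x) → (∀ {w} → w ∈ N₂ → w ~ x) →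
      length N₁ ≤ 1 + j → 1 + j ≤ length N₁ + length N₂ → Good adj U
    spread-apex {x} {y} {N₁} {N₂} {v₀} cl pl u₁ u₂ N₁⊆ N₂⊆ disj x∉₁ x∉₂ v₀∈ v₀≁y see₁ see₂ le ge =
      remove valid smaller S uniqueS S⊆ lengthS λ α →
        assign-∷ x-bound (assign-++ filler (λ e∈ → filler≤1 e∈ (see₂ (filler⊆ e∈)) x∉₂ (here refl))
          (≤-trans (m≤n+m 1 (length N₁′)) (≤-reflexive (sym (length-++ N₁′))))
          (assign-++ N₁′ (λ d∈ → outside S [ y ] λ dw w∉ → case cl (proj₁ (∈-∖⁻ N₁ d∈)) dw of λ where
              (inj₁ r) → ⊥-elim (w∉ (inS r))
              (inj₂ (inj₁ refl)) → ⊥-elim (w∉ (here refl))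
              (inj₂ (inj₂ refl)) → here refl) ≤-refl
            (assign-∷ (outside S [] λ dw w∉ → case cl v₀∈ dw of λ where
              (inj₁ r) → ⊥-elim (w∉ (inS r))
              (inj₂ (inj₁ refl)) → ⊥-elim (w∉ (here refl))
              (inj₂ (inj₂ refl)) → ⊥-elim (true≢false dw v₀≁y)) assign-[])))
      where
      L = [ v₀ ]
      uL : Unique L
      uL = [] ∷ []
      L⊆ : L ⊆ N₁
      L⊆ (here refl) = v₀∈
      N₁′ = N₁ ∖ L
      r = N₁′ ++ L
      r⊆ : r ⊆ N₁
      r⊆ = ∖-++-⊆ L L⊆
      len : length r ≡ length N₁
      len = length-∖-++ L u₁ uL L⊆
      -- The tree still contains deleted vertices, so the presence of `x` needs a witness: a
      -- neighbour of `v₀` either is `x` or lies in `N₁` and sees `x`.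
      x∈U : x ∈ U
      x∈U with w , vw ← nonisolated (N₁⊆ v₀∈) with cl v₀∈ vw
      ... | inj₁ w∈ = inside (see₁ w∈ λ { refl → irr vw })
      ... | inj₂ (inj₁ refl) = inside vw
      ... | inj₂ (inj₂ refl) = ⊥-elim (true≢false vw v₀≁y)
      uhr : Unique (x ∷ r)
      uhr = cons-unique (x∉₁ ∘ r⊆) (∖-++-unique L u₁ uL)
      hr⊆ : x ∷ r ⊆ U
      hr⊆ (here refl) = x∈U
      hr⊆ (there w∈) = N₁⊆ (r⊆ w∈)
      N₂-left : length N₂ ≤ length (N₂ ∖ (x ∷ r))
      N₂-left = length-⊆ (N₂ ∖ (x ∷ r)) u₂ λ w∈ → ∈-∖⁺ w∈ λ { (here refl) → x∉₂ w∈ ; (there w∈r) → disj (r⊆ w∈r) w∈ }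
      open Completion (complete pl u₂ N₂⊆ [ x ] r uhr hr⊆ (s≤s (≤-trans (≤-reflexive len) le))
        (s≤s (≤-trans ge (+-mono-≤ (≤-reflexive (sym len)) N₂-left))))
      inS : N₁ ⊆ S
      inS w∈ = core (there (∈-∖-++ L w∈))
      seen : length filler + length N₁′ ≡ j
      seen = arith (length filler) (length N₁′) (trans (cong (λ n → length filler + suc n) (sym (length-++ N₁′))) length-filler)
        where
        arith : ∀ a b → a + suc (b + 1) ≡ 2 + j → a + b ≡ j
        arith a b e = suc-injective (suc-injective (trans (sym (trans (+-suc a (b + 1)) (cong suc (trans (cong (a +_) (+-comm b 1)) (+-suc a b))))) e))
      x-sees : j ≤ count (adj x) S
      x-sees = begin
        j                                                       ≡⟨ seen ⟨
        length filler + length N₁′                              ≡⟨ cong₂ _+_ (count-all {f = adj x} filler λ w∈ → symm (see₂ (filler⊆ w∈)))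
          (count-all {f = adj x} N₁′ λ w∈ → symm (see₁ (proj₁ (∈-∖⁻ N₁ w∈)) λ { refl → proj₂ (∈-∖⁻ N₁ w∈) (here refl) })) ⟨
        count (adj x) filler + count (adj x) N₁′                ≤⟨ +-monoʳ-≤ (count (adj x) filler) (≤-trans (m≤m+n (count (adj x) N₁′) (count (adj x) L)) (≤-reflexive (sym (count-++ (adj x) N₁′)))) ⟩
        count (adj x) filler + count (adj x) r                  ≡⟨ count-++ (adj x) filler ⟨
        count (adj x) (filler ++ r)                             ≤⟨ m≤n+m _ (bit (adj x x)) ⟩
        count (adj x) S                                         ∎
        where open ≤-Reasoning
      x-bound : count (adj x) (U ∖ S) ≤ length (filler ++ r)
      x-bound = ≤-trans (halve (≤-trans (+-monoˡ-≤ _ x-sees) (degree-rest valid smaller uniqueS S⊆ x))) (≤-reflexive (sym (suc-injective lengthS)))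
        where
        halve : ∀ {c} → j + c ≤ 1 + 2 * j → c ≤ 1 + j
        halve {c} h = +-cancelˡ-≤ j _ _ (≤-trans h (≤-reflexive (trans (cong (λ n → suc (j + n)) (+-identityʳ j)) (sym (+-suc j j)))))

    -- With `p` and all of `N₂` in S, `e` sees at most `x` and `v` at most `y` outside. The vertex
    -- `p` comes first: `x`, `y` and `N₁` without `e` and `p` amount to `length N₁ ≤ K − 1` possible
    -- neighbours.
    spread-twig : ∀ {x y N₁ N₂ e p v} → Closed x y N₁ → Closed x y N₂ → Peelable N₁ → Unique N₁ → Unique N₂ → N₁ ⊆ U → N₂ ⊆ U →
      (∀ {w} → w ∈ N₁ → w ∈ N₂ → ⊥) → length N₁ ≤ 1 + j → length N₂ ≤ j → K ≤ length N₁ + length N₂ →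
      e ∈ N₁ → p ∈ N₁ → e ≢ p → (∀ {w} → e ~ w → w ≡ x ⊎ w ≡ p) → v ∈ N₂ → v ≁ x → x — y → x ≢ y → Good adj U
    spread-twig {x} {y} {N₁} {N₂} {e} {p} {v} cl₁ cl₂ pl u₁ u₂ N₁⊆ N₂⊆ disj le₁ le₂ ge e∈ p∈ e≢p he v∈ v≁x x—y x≢y =
      remove-pair valid smaller S uniqueS S⊆ lengthS (core (there (∈-++⁺ʳ N₂′ (here refl)))) (inS v∈) x—y x≢y
        (λ w∈ ew → case he ew of λ where
          (inj₁ r) → r
          (inj₂ refl) → ⊥-elim (proj₂ (∈-∖⁻ U w∈) (here refl)))
        (λ w∈ vw → case cl₂ v∈ vw of λ where
          (inj₁ r) → ⊥-elim (proj₂ (∈-∖⁻ U w∈) (inS r))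
          (inj₂ (inj₁ refl)) → ⊥-elim (true≢false vw v≁x)
          (inj₂ (inj₂ r)) → r)
        λ α asg → assign-∷ p-bound (assign-++ filler filler≤2 (≤-trans (m≤n+m 2 (length N₂′)) (≤-reflexive (sym (length-++ N₂′))))
          (assign-++ N₂′ (λ d∈ → outside S (x ∷ y ∷ []) λ dw w∉ → case cl₂ (proj₁ (∈-∖⁻ N₂ d∈)) dw of λ where
            (inj₁ r) → ⊥-elim (w∉ (inS r))
            (inj₂ (inj₁ refl)) → here refl
            (inj₂ (inj₂ refl)) → there (here refl)) ≤-refl asg))
      where
      N₂′ = N₂ ∖ [ v ]
      r = N₂′ ++ e ∷ v ∷ []
      N₂-len : length N₂ ≡ suc (length N₂′)
      N₂-len = length-∖ u₂ ([] ∷ []) λ { (here refl) → v∈ }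
      r-len : length r ≡ suc (length N₂)
      r-len = trans (length-++ N₂′) (trans (+-comm (length N₂′) 2) (cong suc (sym N₂-len)))
      uhr : Unique (p ∷ r)
      uhr = cons-unique (λ p∈r → case ∈-++⁻ N₂′ p∈r of λ where
          (inj₁ q) → disj p∈ (proj₁ (∈-∖⁻ N₂ q))
          (inj₂ (here q)) → e≢p (sym q)
          (inj₂ (there (here refl))) → disj p∈ v∈)
        (++-unique (∖-unique [ v ] u₂) (pair-unique λ { refl → disj e∈ v∈ }) λ where
          q (here refl) → disj e∈ (proj₁ (∈-∖⁻ N₂ q))
          q (there (here refl)) → proj₂ (∈-∖⁻ N₂ q) (here refl))
      hr⊆ : p ∷ r ⊆ U
      hr⊆ (here refl) = N₁⊆ p∈
      hr⊆ (there w∈) = case ∈-++⁻ N₂′ w∈ of λ where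
        (inj₁ q) → N₂⊆ (proj₁ (∈-∖⁻ N₂ q))
        (inj₂ (here refl)) → N₁⊆ e∈
        (inj₂ (there (here refl))) → N₂⊆ v∈
      N₁-left : length N₁ ≤ 2 + length (N₁ ∖ (p ∷ r))
      N₁-left = length-⊆ (p ∷ e ∷ (N₁ ∖ (p ∷ r))) u₁ λ {w} w∈ → case w ∈? (p ∷ r) of λ where
        (no n) → there (there (∈-∖⁺ w∈ n))
        (yes (here refl)) → here refl
        (yes (there q)) → case ∈-++⁻ N₂′ q of λ where
          (inj₁ s) → ⊥-elim (disj w∈ (proj₁ (∈-∖⁻ N₂ s)))
          (inj₂ (here refl)) → there (here refl)
          (inj₂ (there (here refl))) → ⊥-elim (disj w∈ v∈)
      open Completion (complete pl u₁ N₁⊆ [ p ] r uhr hr⊆ (s≤s (≤-trans (≤-reflexive r-len) (s≤s le₂)))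
        (≤-trans ge (≤-trans (+-monoˡ-≤ (length N₂) N₁-left) (≤-reflexive (cong suc (trans (cong suc (+-comm (length (N₁ ∖ (p ∷ r))) (length N₂))) (cong (_+ length (N₁ ∖ (p ∷ r))) (sym r-len))))))))
      inS : N₂ ⊆ S
      inS {w} w∈ = case w ≟ v of λ where
        (yes refl) → core (there (∈-++⁺ʳ N₂′ (there (here refl))))
        (no n) → core (there (∈-++⁺ˡ (∈-∖⁺ w∈ λ { (here q) → n q })))
      p-bound : count (adj p) (U ∖ S) ≤ length (filler ++ r)
      p-bound = ≤-trans (outside S (x ∷ y ∷ (N₁ ∖ (e ∷ p ∷ []))) λ pw w∉ → case cl₁ p∈ pw of λ where
          (inj₁ w∈) → there (there (∈-∖⁺ w∈ λ where
            (here refl) → w∉ (core (there (∈-++⁺ʳ N₂′ (here refl))))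
            (there (here refl)) → irr pw))
          (inj₂ (inj₁ refl)) → here refl
          (inj₂ (inj₂ refl)) → there (here refl))
        (≤-trans (≤-reflexive (sym (length-∖ u₁ (pair-unique e≢p) (pair-⊆ e∈ p∈)))) (≤-trans le₁ (≤-reflexive (sym (suc-injective lengthS)))))

    -- Neither `A` nor `B` need be contained in S. Once `p`, `q` and `z` (if present) are in S, `u`
    -- sees at most `x` and `v` at most `y` outside. Since `Z`, `A` and `B` have at most `2 j + 1`
    -- vertices together, at most `j − 1` of them are left out of S; with `x` and `y` this gives `z`
    -- at most `K − 1` neighbours.
    spread-branch : ∀ {x y z Z A B u p v q} → Unique Z → (∀ {w} → w ∈ Z → w ≡ z) → Z ⊆ U → (z ∈ U → z ∈ Z) →
      Closed x z A → Closed z y B → Closed x y (Z ++ (A ++ B)) → Peelable (A ++ B) → Unique A → Unique B → A ⊆ U → B ⊆ U →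
      (∀ {w} → w ∈ A → w ∈ B → ⊥) → (∀ {w} → w ∈ Z → w ∈ A ++ B → ⊥) → x — y → x ≢ y →
      length A ≤ j → length B ≤ j → length Z + 4 ≤ K → K ≤ length Z + length (A ++ B) →
      u ∈ A → p ∈ A → u ≢ p → (∀ {w} → u ~ w → w ∈ A → w ≡ p) →
      v ∈ B → q ∈ B → v ≢ q → (∀ {w} → v ~ w → w ∈ B → w ≡ q) → Good adj U
    spread-branch {x} {y} {z} {Z} {A} {B} {u} {p} {v} {q} uZ Z≡ Z⊆ z∈Z clA clB cl pl uA uB A⊆ B⊆ disj disjZ x—y x≢y leA leB le ge u∈ p∈ u≢p hu v∈ q∈ v≢q hv =
      fill (complete pl uAB AB⊆ h r uhr hr⊆ (≤-trans (≤-reflexive hr-len) le)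
        (≤-trans ge (≤-trans (+-monoʳ-≤ (length Z) AB-left) (≤-reflexive (trans (sym (+-assoc (length Z) 4 _)) (cong (_+ length ((A ++ B) ∖ (h ++ r))) (sym hr-len)))))))
      where
      open ≤-Reasoning
      h = Z ++ p ∷ q ∷ []
      r = u ∷ v ∷ []
      four = p ∷ q ∷ u ∷ v ∷ []
      four⊆ : four ⊆ A ++ B
      four⊆ (here refl) = ∈-++⁺ˡ p∈
      four⊆ (there (here refl)) = ∈-++⁺ʳ A q∈
      four⊆ (there (there (here refl))) = ∈-++⁺ˡ u∈
      four⊆ (there (there (there (here refl)))) = ∈-++⁺ʳ A v∈
      uAB : Unique (A ++ B)
      uAB = ++-unique uA uB disj
      AB⊆ : A ++ B ⊆ U
      AB⊆ w∈ = [ A⊆ , B⊆ ]′ (∈-++⁻ A w∈)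
      u-four : Unique four
      u-four = cons-unique (λ where
          (here refl) → disj p∈ q∈
          (there (here refl)) → u≢p refl
          (there (there (here refl))) → disj p∈ v∈)
        (cons-unique (λ where
          (here refl) → disj u∈ q∈
          (there (here refl)) → v≢q refl) (pair-unique λ { refl → disj u∈ v∈ }))
      assoc : h ++ r ≡ Z ++ four
      assoc = ++-assoc Z (p ∷ q ∷ []) r
      hr-len : length (h ++ r) ≡ length Z + 4
      hr-len = trans (cong length assoc) (length-++ Z)
      uhr : Unique (h ++ r)
      uhr = subst Unique (sym assoc) (++-unique uZ u-four λ a b → disjZ a (four⊆ b))
      hr⊆ : h ++ r ⊆ U
      hr⊆ w∈ = [ Z⊆ , AB⊆ ∘ four⊆ ]′ (∈-++⁻ Z (subst (_ ∈_) assoc w∈))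
      AB-left : length (A ++ B) ≤ 4 + length ((A ++ B) ∖ (h ++ r))
      AB-left = length-⊆ (four ++ ((A ++ B) ∖ (h ++ r))) uAB λ {w} w∈ → case w ∈? (h ++ r) of λ where
        (no n) → ∈-++⁺ʳ four (∈-∖⁺ w∈ n)
        (yes s) → ∈-++⁺ˡ ([ (λ w∈Z → ⊥-elim (disjZ w∈Z w∈)) , id ]′ (∈-++⁻ Z (subst (w ∈_) assoc s)))
      fill : Completion (A ++ B) h r → Good adj U
      fill C =
        remove-pair valid smaller S uniqueS S⊆ lengthS (core u∈S₀) (core v∈S₀) x—y x≢y
          (λ w∈ uw → case clA u∈ uw of λ where
            (inj₁ r) → case hu uw r of λ { refl → ⊥-elim (proj₂ (∈-∖⁻ U w∈) (core p∈S₀)) }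
            (inj₂ (inj₁ r)) → r
            (inj₂ (inj₂ refl)) → ⊥-elim (proj₂ (∈-∖⁻ U w∈) (zS (inside uw))))
          (λ w∈ vw → case clB v∈ vw of λ where
            (inj₁ r) → case hv vw r of λ { refl → ⊥-elim (proj₂ (∈-∖⁻ U w∈) (core q∈S₀)) }
            (inj₂ (inj₁ refl)) → ⊥-elim (proj₂ (∈-∖⁻ U w∈) (zS (inside vw)))
            (inj₂ (inj₂ r)) → r)
          λ α asg → subst (Assignable adj α (U ∖ S)) (sym (++-assoc Z (p ∷ q ∷ []) tail))
            (assign-++ Z z-bound (+-cancelˡ-≤ (length Z) _ _ (≤-trans (+-monoˡ-≤ (1 + j) Z≤1) (≤-reflexive (sym rest-len))))
              (assign-∷ p-bound (assign-∷ q-bound (assign-++ filler filler≤2 ≤-refl asg))))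
        where
        open Completion C
        tail = filler ++ r
        in-four : four ⊆ h ++ r
        in-four w∈ = subst (_ ∈_) (sym assoc) (∈-++⁺ʳ Z w∈)
        p∈S₀ = in-four (here refl)
        q∈S₀ = in-four (there (here refl))
        u∈S₀ = in-four (there (there (here refl)))
        v∈S₀ = in-four (there (there (there (here refl))))
        zS : z ∈ U → z ∈ S
        zS z∈ = core (∈-++⁺ˡ (∈-++⁺ˡ (z∈Z z∈)))
        Z≤1 : length Z ≤ 1
        Z≤1 = length-⊆ [ z ] uZ λ w∈ → here (Z≡ w∈)
        rest-len : length Z + (2 + length tail) ≡ K
        rest-len = trans (sym (length-++ Z)) (trans (cong length (sym (++-assoc Z (p ∷ q ∷ []) tail))) lengthS)
        j<rest : j < 2 + length tail
        j<rest = +-cancelˡ-≤ 1 _ _ (≤-trans (≤-reflexive (sym rest-len)) (+-monoˡ-≤ _ Z≤1))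
        p-bound : count (adj p) (U ∖ S) ≤ 1 + length tail
        p-bound = ≤-trans (outside S (x ∷ (A ∖ (u ∷ p ∷ []))) λ pw w∉ → case clA p∈ pw of λ where
            (inj₁ w∈) → there (∈-∖⁺ w∈ λ where
              (here refl) → w∉ (core u∈S₀)
              (there (here refl)) → w∉ (core p∈S₀))
            (inj₂ (inj₁ refl)) → here refl
            (inj₂ (inj₂ refl)) → ⊥-elim (w∉ (zS (inside pw))))
          (≤-trans (<⇒≤ (≤-reflexive (sym (length-∖ uA (pair-unique u≢p) (pair-⊆ u∈ p∈))))) (≤-trans leA (s≤s⁻¹ j<rest)))
        q-bound : count (adj q) (U ∖ S) ≤ length tail
        q-bound = ≤-trans (outside S (y ∷ (B ∖ (v ∷ q ∷ []))) λ qw w∉ → case clB q∈ qw of λ where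
            (inj₁ w∈) → there (∈-∖⁺ w∈ λ where
              (here refl) → w∉ (core v∈S₀)
              (there (here refl)) → w∉ (core q∈S₀))
            (inj₂ (inj₁ refl)) → ⊥-elim (w∉ (zS (inside qw)))
            (inj₂ (inj₂ refl)) → here refl)
          (s≤s⁻¹ (≤-trans (≤-reflexive (sym (length-∖ uB (pair-unique v≢q) (pair-⊆ v∈ q∈)))) (≤-trans leB (s≤s⁻¹ j<rest))))
        N = Z ++ (A ++ B)
        S⊆N : S ⊆ N
        S⊆N w∈ = case ∈-++⁻ h w∈ of λ where
          (inj₁ w∈h) → [ ∈-++⁺ˡ , (λ s → ∈-++⁺ʳ Z (four⊆ (∈-++⁺ˡ s))) ]′ (∈-++⁻ Z w∈h)
          (inj₂ w∈t) → ∈-++⁺ʳ Z ([ filler⊆ , (λ s → four⊆ (there (there s))) ]′ (∈-++⁻ filler w∈t))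
        N-left : K + length (N ∖ S) ≤ 1 + (j + j)
        N-left = begin
          K + length (N ∖ S)              ≡⟨ cong (_+ length (N ∖ S)) lengthS ⟨
          length S + length (N ∖ S)       ≡⟨ length-∖ (++-unique uZ uAB disjZ) uniqueS S⊆N ⟨
          length N                        ≡⟨ trans (length-++ Z) (cong (length Z +_) (length-++ A)) ⟩
          length Z + (length A + length B) ≤⟨ +-mono-≤ Z≤1 (+-mono-≤ leA leB) ⟩
          1 + (j + j)                     ∎
        z-bound : ∀ {w} → w ∈ Z → count (adj w) (U ∖ S) ≤ 1 + j
        z-bound w∈ = ≤-trans (outside S (x ∷ y ∷ (N ∖ S)) λ wt t∉ → case cl (∈-++⁺ˡ w∈) wt of λ where
            (inj₁ t∈) → there (there (∈-∖⁺ t∈ t∉))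
            (inj₂ (inj₁ refl)) → here refl
            (inj₂ (inj₂ refl)) → there (here refl))
          (+-cancelˡ-≤ j _ _ (≤-trans (≤-reflexive (trans (+-suc j _) (cong suc (+-suc j _)))) (≤-trans N-left (≤-reflexive (sym (+-suc j j))))))

    spread-four : ∀ {c w e′ e} → j ≡ 2 → (∀ {v} → v ∈ c ∷ w ∷ e′ ∷ e ∷ [] → v ∈ U) → Unique (c ∷ w ∷ e′ ∷ e ∷ []) →
      (let S = c ∷ w ∷ e′ ∷ e ∷ [] in count (adj c) (U ∖ S) ≤ 3 → count (adj w) (U ∖ S) ≤ 2 → count (adj e′) (U ∖ S) ≤ 1 →
      count (adj e) (U ∖ S) ≤ 0 → Good adj U)
    spread-four refl S⊆ uS b₃ b₂ b₁ b₀ = remove valid smaller _ uS S⊆ refl λ α →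
      assign-∷ b₃ (assign-∷ b₂ (assign-∷ b₁ (assign-∷ b₀ assign-[])))

    -- `T` consists of `S` and `w`. When `S` has `K` vertices, `T` is one too large for `extend`;
    -- giving `w` the rarest colour first absorbs the surplus.
    recolour-one : ∀ {S T w σ α} → w ∈ U → w ∉ S → (∀ {v} → v ∈ T → v ≡ w ⊎ v ∈ S) → (∀ {v} → v ∈ S → v ∈ T) → w ∈ T →
      ProperOn adj (U ∖ T) α → Balanced (U ∖ T) α → (∀ i → size α (U ∖ T) σ ≤ size α (U ∖ T) i) → Fits adj α (U ∖ T) w σ →
      ProperOn adj (U ∖ S) (paint [ w ] [ σ ] α) × Balanced (U ∖ S) (paint [ w ] [ σ ] α)
    recolour-one {S} {T} {w} {σ} {α} w∈U w∉S T⊆ S⊆T w∈T pr bal least fits =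
      add-to-smallest symm irr (∖-unique S unique) (∈-∖⁺ w∈U w∉S) (λ {a} {b} a∈ b∈ → pr {a} {b} (to a∈) (to b∈))
        (λ i i′ → subst₂ (λ m n → m ≤ n + 1) (same i) (same i′) (bal i i′))
        (λ i → subst₂ _≤_ (same σ) (same i) (least i)) (λ v∈ → fits (to v∈))
      where
      R = (U ∖ S) ∖ [ w ]
      to : R ⊆ U ∖ T
      to v∈ with v∈′ , v≢w ← ∈-∖⁻ (U ∖ S) v∈ with v∈U , v∉S ← ∈-∖⁻ U v∈′ =
        ∈-∖⁺ v∈U λ v∈T → [ (λ { refl → v≢w (here refl) }) , v∉S ]′ (T⊆ v∈T)
      from : U ∖ T ⊆ R
      from v∈ with v∈U , v∉T ← ∈-∖⁻ U v∈ = ∈-∖⁺ (∈-∖⁺ v∈U (v∉T ∘ S⊆T)) λ { (here refl) → v∉T w∈T }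
      same : ∀ i → size α (U ∖ T) i ≡ size α R i
      same i = ≤-antisym (count-⊆ _ (∖-unique T unique) (λ v∈ _ → from v∈)) (count-⊆ _ (∖-unique [ w ] (∖-unique S unique)) (λ v∈ _ → to v∈))


    fresh-colour : ∀ (F : List (Fin K)) c → length F ≤ j → ∃[ d ] (d ≢ c × d ∉ F)
    fresh-colour F c l with d , _ , d∉ ← missing-colour (allFin K) (c ∷ F) (UniqueP.allFin⁺ K)
      (s≤s (≤-trans (s≤s l) (≤-reflexive (cong suc (sym (length-tabulate {n = j} (λ i → Fin.suc (Fin.suc i)))))))) = d , d∉ ∘ here , d∉ ∘ there

    -- With `K = j + 2` colours, one more colour can be avoided besides each list. If the choices
    -- avoiding `σ` clash at `c`, one of them is redone avoiding `c` instead; this fails only when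
    -- both new choices are `σ`, and then `σ` is missing from both lists.
    two-colours : ∀ (F G : List (Fin K)) σ → length F ≤ j → length G ≤ j →
      (∃[ c ] ∃[ d ] (c ∉ F × d ∉ G × c ≢ d × c ≢ σ × d ≢ σ)) ⊎ (σ ∉ F × σ ∉ G)
    two-colours F G σ lF lG
      with c , c≢σ , c∉ ← fresh-colour F σ lF | d , d≢σ , d∉ ← fresh-colour G σ lG
      with c FinP.≟ d
    ... | no c≢d = inj₁ (c , d , c∉ , d∉ , c≢d , c≢σ , d≢σ)
    ... | yes refl with c′ , c′≢c , c′∉ ← fresh-colour F c lF | d′ , d′≢c , d′∉ ← fresh-colour G c lG
      with c′ FinP.≟ σ | d′ FinP.≟ σ
    ... | no c′≢σ | _ = inj₁ (c′ , c , c′∉ , d∉ , c′≢c , c′≢σ , c≢σ)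
    ... | yes _ | no d′≢σ = inj₁ (c , d′ , c∉ , d′∉ , d′≢c ∘ sym , c≢σ , d′≢σ)
    ... | yes refl | yes refl = inj₂ (c′∉ , d′∉)

    fit-all : ∀ {α U′} vs L → length vs ≡ length L → (∀ {v c} → v ∈ vs → c ∈ L → Fits adj α U′ v c) → Pointwise (Fits adj α U′) vs L
    fit-all [] [] e h = []
    fit-all (v ∷ vs) (c ∷ L) e h = h (here refl) (here refl) ∷ fit-all vs L (suc-injective e) λ a b → h (there a) (there b)

    -- The apexes x and y may be unable to avoid using the same colour twice. The vertex z leaves a slack of one:
    -- either x and y get distinct colours other than the rarest colour σ, which then goes to z, or both get σ.
    both-apexes : ∀ {x y z R} → Unique (x ∷ y ∷ z ∷ R) → x ∷ y ∷ z ∷ R ⊆ U → length R ≡ j →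
      (∀ {d} → d ∈ z ∷ R → x ~ d × y ~ d) → (∀ {w} → z ~ w → w ≡ x ⊎ w ≡ y) → Closed x y R → Good adj U
    both-apexes {x} {y} {z} {R} uT T⊆ lR sees hz cl with bool (adj x y)
    -- Adjacent apexes each see `j + 1` vertices of S, namely `R` and one another, so both keep at
    -- most `j` neighbours and `z` can be left out.
    ... | inj₁ xy = remove valid smaller S uS S⊆ (cong (2 +_) lR) λ α →
      assign-∷ (≤-trans (x-bound′) (≤-reflexive (cong suc (sym lR)))) (assign-∷ (≤-trans y-bound (≤-reflexive (sym lR)))
        (subst (Assignable adj α (U ∖ S)) (++-identityʳ R) (assign-++ R (λ d∈ → outside S [] λ dw w∉ → case cl d∈ dw of λ where
          (inj₁ r) → ⊥-elim (w∉ (there (there r)))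
          (inj₂ (inj₁ refl)) → ⊥-elim (w∉ (here refl))
          (inj₂ (inj₂ refl)) → ⊥-elim (w∉ (there (here refl)))) z≤n assign-[])))
      where
      S = x ∷ y ∷ R
      uS : Unique S
      uS = cons-unique (λ { (here q) → head∉ uT (here q) ; (there q) → head∉ uT (there (there q)) })
        (cons-unique (λ q → head∉ (tail-unique uT) (there q)) (tail-unique (tail-unique (tail-unique uT))))
      S⊆ : S ⊆ U
      S⊆ (here q) = T⊆ (here q)
      S⊆ (there (here q)) = T⊆ (there (here q))
      S⊆ (there (there q)) = T⊆ (there (there (there q)))
      R-all : ∀ {a} → (∀ {d} → d ∈ R → a ~ d) → count (adj a) R ≡ j
      R-all h = trans (count-all R h) lR
      cancel : ∀ {c} → 1 + j + c ≤ 1 + 2 * j → c ≤ j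
      cancel {c} h = +-cancelˡ-≤ (1 + j) _ _ (≤-trans h (≤-reflexive (cong (λ n → suc (j + n)) (+-identityʳ j))))
      x-sees : 1 + j ≤ count (adj x) S
      x-sees = ≤-trans (+-mono-≤ (≤-reflexive (cong bit (sym xy))) (≤-reflexive (sym (R-all λ d∈ → proj₁ (sees (there d∈)))))) (m≤n+m _ (bit (adj x x)))
      y-sees : 1 + j ≤ count (adj y) S
      y-sees = +-mono-≤ (≤-reflexive (cong bit (sym (symm xy)))) (≤-trans (≤-reflexive (sym (R-all λ d∈ → proj₂ (sees (there d∈))))) (m≤n+m _ (bit (adj y y))))
      x-bound′ : count (adj x) (U ∖ S) ≤ 1 + j
      x-bound′ = m≤n⇒m≤1+n (cancel (≤-trans (+-monoˡ-≤ _ x-sees) (degree-rest valid smaller uS S⊆ x)))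
      y-bound : count (adj y) (U ∖ S) ≤ j
      y-bound = cancel (≤-trans (+-monoˡ-≤ _ y-sees) (degree-rest valid smaller uS S⊆ y))
    ... | inj₂ x≁y
      with α , pr , bal ← colour-rest valid smaller adj uT T⊆ (here refl) symm irr support
        (λ {w} _ → m+n≤o⇒n≤o _ (degree-rest valid smaller uT T⊆ w))
      with σ , least ← smallest (size α (U ∖ (x ∷ y ∷ z ∷ R)))
      = finish
      where
      T = x ∷ y ∷ z ∷ R
      bound : ∀ {a} → (∀ {d} → d ∈ z ∷ R → a ~ d) → count (adj a) (U ∖ T) ≤ j
      bound {a} h = +-cancelˡ-≤ (1 + j) _ _ (≤-trans (+-monoˡ-≤ _ (begin
          1 + j                        ≡⟨ trans (count-all {f = adj a} (z ∷ R) h) (cong suc lR) ⟨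
          count (adj a) (z ∷ R)        ≤⟨ m≤n+m _ (bit (adj a x) + bit (adj a y)) ⟩
          (bit (adj a x) + bit (adj a y)) + count (adj a) (z ∷ R) ≡⟨ +-assoc (bit (adj a x)) _ _ ⟩
          count (adj a) T ∎))
        (≤-trans (degree-rest valid smaller uT T⊆ a) (≤-reflexive (cong (λ n → suc (j + n)) (+-identityʳ j)))))
        where open ≤-Reasoning
      F = nbrColours {adj} {α} {U ∖ T} x
      G = nbrColours {adj} {α} {U ∖ T} y
      lF : length F ≤ j
      lF = ≤-trans (≤-reflexive (length-nbrColours {adj} {α} {U ∖ T} x)) (bound (proj₁ ∘ sees))
      lG : length G ≤ j
      lG = ≤-trans (≤-reflexive (length-nbrColours {adj} {α} {U ∖ T} y)) (bound (proj₂ ∘ sees))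
      x∉ = head∉ uT
      uy = tail-unique uT
      uz = tail-unique uy
      y∈U = T⊆ (there (here refl))
      z∈U = T⊆ (there (there (here refl)))
      none : ∀ {d w} → d ∈ z ∷ R → d ~ w → w ∈ T
      none (here refl) dw = [ (λ { refl → here refl }) , (λ { refl → there (here refl) }) ]′ (hz dw)
      none (there d∈) dw = case cl d∈ dw of λ where
        (inj₁ r) → there (there (there r))
        (inj₂ (inj₁ refl)) → here refl
        (inj₂ (inj₂ refl)) → there (here refl)
      two-lists : ∀ {c : Fin K} → ∃[ L ] (allFin K ↭ c ∷ L × length L ≡ 1 + j × Unique (c ∷ L))
      two-lists {c} with L , p ← ∈⇒↭ (∈-allFin c) = L , p , suc-injective (trans (sym (↭-length p)) (length-tabulate {n = K} id)) , Unique-resp p (UniqueP.allFin⁺ K)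

      -- Here `y` is the surplus vertex. The second `σ`, from the full palette, goes to `x`, which
      -- does not see `y`; thus `z ∷ R` is left with colours other than `σ`.
      same-colour : σ ∉ F → σ ∉ G → Good adj U
      same-colour σ∉F σ∉G
        with L , p , lL , uL ← two-lists {σ}
        with pr′ , bal′ ← recolour-one {S = x ∷ z ∷ R} {T} {y} {σ} y∈U
          (λ { (here r) → x∉ (here (sym r)) ; (there r) → head∉ uy r })
          (λ { (here r) → inj₂ (here r) ; (there (here r)) → inj₁ r ; (there (there r)) → inj₂ (there r) })
          (λ { (here r) → here r ; (there r) → there (there r) }) (there (here refl)) (λ {a} {b} → pr {a} {b}) bal least (∉nbrColours {adj} {α} {U ∖ T} σ∉G) =
        extend symm irr unique uS S⊆ (λ {a} {b} → pr′ {a} {b}) bal′ (↭-sym p) (x-fits ∷ fit-all (z ∷ R) L (trans (cong suc lR) (sym lL)) zR-fits)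
        where
        S = x ∷ z ∷ R
        uS : Unique S
        uS = cons-unique (x∉ ∘ there) uz
        S⊆ : S ⊆ U
        S⊆ (here r) = T⊆ (here r)
        S⊆ (there r) = T⊆ (there (there r))
        to-T : ∀ {w} → w ∈ U ∖ S → w ≢ y → w ∈ U ∖ T
        to-T w∈ w≢y with w∈U , w∉S ← ∈-∖⁻ U w∈ = ∈-∖⁺ w∈U λ where
          (here r) → w∉S (here r)
          (there (here r)) → w≢y r
          (there (there r)) → w∉S (there r)
        x-fits : Fits adj (paint [ y ] [ σ ] α) (U ∖ S) x σ
        x-fits {w} w∈ xw eq = case w ≟ y of λ where
          (yes refl) → true≢false xw x≁y
          (no n) → ∉nbrColours {adj} {α} {U ∖ T} σ∉F (to-T w∈ n) xw (trans (sym (paint-tail y [] σ [] {α} n)) eq)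
        zR-fits : ∀ {d c} → d ∈ z ∷ R → c ∈ L → Fits adj (paint [ y ] [ σ ] α) (U ∖ S) d c
        zR-fits d∈ c∈ {w} w∈ dw eq = case w ≟ y of λ where
          (yes refl) → head∉ uL (subst (_∈ L) (trans (sym eq) (paint-head y [] σ [] {α})) c∈)
          (no n) → proj₂ (∈-∖⁻ U (to-T w∈ n)) (none d∈ dw)

      finish : Good adj U
      finish with two-colours F G σ lF lG
      ... | inj₂ (σ∉F , σ∉G) = same-colour σ∉F σ∉G
      ... | inj₁ (c , d , c∉ , d∉ , c≢d , c≢σ , d≢σ)
        with L , p , lL , uL ← two-lists {c}
        with L′ , p′ ← ∈⇒↭ {x = d} {L} (case ∈-resp-↭ p (∈-allFin d) of λ { (here r) → ⊥-elim (c≢d (sym r)) ; (there r) → r })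
        with pr′ , bal′ ← recolour-one {S = x ∷ y ∷ R} {T} {z} {σ} z∈U
          (λ { (here r) → x∉ (there (here (sym r))) ; (there (here r)) → head∉ uy (here (sym r)) ; (there (there r)) → head∉ uz r })
          (λ { (here r) → inj₂ (here r) ; (there (here r)) → inj₂ (there (here r)) ; (there (there (here r))) → inj₁ r ; (there (there (there r))) → inj₂ (there (there r)) })
          (λ { (here r) → here r ; (there (here r)) → there (here r) ; (there (there r)) → there (there (there r)) }) (there (there (here refl)))
          (λ {a} {b} → pr {a} {b}) bal least (λ w∈ zw → ⊥-elim (proj₂ (∈-∖⁻ U w∈) (none (here refl) zw))) =
        extend symm irr unique uS S⊆ (λ {a} {b} → pr′ {a} {b}) bal′ (↭-sym (Perm.trans p (prep c p′)))
          (fits c≢σ c∉ ∷ fits d≢σ d∉ ∷ fit-all R L′ (trans lR (sym (suc-injective (trans (sym (↭-length p′)) lL)))) R-fits)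
        where
        S = x ∷ y ∷ R
        uS : Unique S
        uS = cons-unique (λ { (here r) → x∉ (here r) ; (there r) → x∉ (there (there r)) }) (cons-unique (head∉ uy ∘ there) (tail-unique uz))
        S⊆ : S ⊆ U
        S⊆ (here r) = T⊆ (here r)
        S⊆ (there (here r)) = T⊆ (there (here r))
        S⊆ (there (there r)) = T⊆ (there (there (there r)))
        to-T : ∀ {w} → w ∈ U ∖ S → w ≢ z → w ∈ U ∖ T
        to-T w∈ w≢z with w∈U , w∉S ← ∈-∖⁻ U w∈ = ∈-∖⁺ w∈U λ where
          (here r) → w∉S (here r)
          (there (here r)) → w∉S (there (here r))
          (there (there (here r))) → w≢z r
          (there (there (there r))) → w∉S (there (there r))
        fits : ∀ {a e} → e ≢ σ → e ∉ nbrColours {adj} {α} {U ∖ T} a → Fits adj (paint [ z ] [ σ ] α) (U ∖ S) a e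
        fits e≢σ e∉ {w} w∈ aw eq = case w ≟ z of λ where
          (yes refl) → e≢σ (trans (sym eq) (paint-head z [] σ [] {α}))
          (no n) → ∉nbrColours {adj} {α} {U ∖ T} e∉ (to-T w∈ n) aw (trans (sym (paint-tail z [] σ [] {α} n)) eq)
        -- No vertex of `R` sees `z`, so the `σ` of the full palette may be used again in `R`.
        R-fits : ∀ {a e} → a ∈ R → e ∈ L′ → Fits adj (paint [ z ] [ σ ] α) (U ∖ S) a e
        R-fits a∈ _ {w} w∈ aw _ = case cl a∈ aw of λ where
          (inj₁ r) → proj₂ (∈-∖⁻ U w∈) (there (there r))
          (inj₂ (inj₁ refl)) → proj₂ (∈-∖⁻ U w∈) (here refl)
          (inj₂ (inj₂ refl)) → proj₂ (∈-∖⁻ U w∈) (there (here refl))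

    -- No two vertices of M can play the roles of u and v in spread-pair.
    Tame : V → V → List V → Set
    Tame x y M = ∀ {u v} → u ∈ M → v ∈ M → u ≢ v → u ≁ y → v ~ x

    -- Tame parts and their twigs.

    tame? : ∀ x y M → (∃[ u ] ∃[ v ] (u ∈ M × v ∈ M × u ≢ v × u ≁ y × v ≁ x)) ⊎ Tame x y M
    tame? x y M with any? (λ u → (adj u y Data.Bool.≟ false) ×-dec any? (λ v → ¬? (u ≟ v) ×-dec (adj v x Data.Bool.≟ false)) M) M
    ... | yes p with u , u∈ , u≁y , q ← find p with v , v∈ , u≢v , v≁x ← find q = inj₁ (u , v , u∈ , v∈ , u≢v , u≁y , v≁x)
    ... | no n = inj₂ λ {u} {v} u∈ v∈ u≢v u≁y → case bool (adj v x) of λ where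
      (inj₁ vx) → vx
      (inj₂ v≁x) → ⊥-elim (n (lose u∈ (u≁y , lose v∈ (u≢v , v≁x))))

    tame-sym : ∀ {x y M} → Tame x y M → Tame y x M
    tame-sym {y = y} t {u} {v} u∈ v∈ u≢v u≁x = case bool (adj v y) of λ where
      (inj₁ vy) → vy
      (inj₂ v≁y) → ⊥-elim (true≢false (t v∈ u∈ (u≢v ∘ sym) v≁y) u≁x)

    blind : ∀ x M → (∃[ v ] (v ∈ M × v ≁ x)) ⊎ (∀ {w} → w ∈ M → w ~ x)
    blind x M with any? (λ v → adj v x Data.Bool.≟ false) M
    ... | yes p with v , v∈ , h ← find p = inj₁ (v , v∈ , h)
    ... | no n = inj₂ λ {w} w∈ → case bool (adj w x) of λ where
      (inj₁ wx) → wx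
      (inj₂ w≁x) → ⊥-elim (n (lose w∈ w≁x))

    -- The outcome of an unsuccessful search: `small` and `tame` negate the two properties searched
    -- for, and the other fields are what placing fillers and bounding neighbours requires.
    record Part (x y : V) (M : List V) : Set where
      field
        closed   : Closed x y M
        peelable : Peelable M
        small    : length M ≤ j
        tame     : Tame x y M

    closed-sym : ∀ {x y M} → Closed x y M → Closed y x M
    closed-sym cl d∈ dw = case cl d∈ dw of λ where
      (inj₁ r) → inj₁ r
      (inj₂ (inj₁ r)) → inj₂ (inj₂ r)
      (inj₂ (inj₂ r)) → inj₂ (inj₁ r)

    part-sym : ∀ {x y M} → Part x y M → Part y x M
    part-sym p = record { closed = closed-sym (Part.closed p) ; peelable = Part.peelable p ; small = Part.small p ; tame = tame-sym (Part.tame p) }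

    -- `M` is peeled completely before `N`. `Peelable` speaks about all neighbours of a vertex, so
    -- edges between the two lists are already accounted for.
    peelable-++ : ∀ {M N} → Peelable M → Peelable N → Peelable (M ++ N)
    peelable-++ {M} {N} plM plN X X⊆ {x} x∈ with any? (_∈? M) X
    ... | yes p with m , m∈X , m∈M ← find p
      with e , e∈ , a , b , h ← plM (filter (_∈? M) X) (λ w∈ → proj₂ (∈-filter⁻ (_∈? M) {xs = X} w∈)) (∈-filter⁺ (_∈? M) m∈X m∈M) =
      e , proj₁ (∈-filter⁻ (_∈? M) {xs = X} e∈) , a , b , λ ew → case h ew of λ where
        (inj₁ (w∈ , w∉)) → inj₁ (∈-++⁺ˡ w∈ , λ w∈X → w∉ (∈-filter⁺ (_∈? M) w∈X w∈))
        (inj₂ r) → inj₂ r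
    ... | no n with e , e∈ , a , b , h ← plN X (λ w∈ → [ (λ w∈M → ⊥-elim (n (lose w∈ w∈M))) , id ]′ (∈-++⁻ M (X⊆ w∈))) x∈ =
      e , e∈ , a , b , λ ew → case h ew of λ where
        (inj₁ (w∈ , w∉)) → inj₁ (∈-++⁺ʳ M w∈ , w∉)
        (inj₂ r) → inj₂ r

    -- `z` is peeled last: with `N` gone, only `x` and `y` can remain as neighbours.
    peelable-top : ∀ {x y z Z N} → (∀ {w} → w ∈ Z → w ≡ z) → Peelable N → Closed x y (Z ++ N) → Peelable (Z ++ N)
    peelable-top {x} {y} {z} {Z} {N} Z≡ pl cl X X⊆ {x′} x∈ with any? (_∈? N) X
    ... | yes p with m , m∈X , m∈N ← find p
      with e , e∈ , a , b , h ← pl (filter (_∈? N) X) (λ w∈ → proj₂ (∈-filter⁻ (_∈? N) {xs = X} w∈)) (∈-filter⁺ (_∈? N) m∈X m∈N) =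
      e , proj₁ (∈-filter⁻ (_∈? N) {xs = X} e∈) , a , b , λ ew → case h ew of λ where
        (inj₁ (w∈ , w∉)) → inj₁ (∈-++⁺ʳ Z w∈ , λ w∈X → w∉ (∈-filter⁺ (_∈? N) w∈X w∈))
        (inj₂ r) → inj₂ r
    ... | no n = x′ , x∈ , x , y , λ {w} ew → case cl (X⊆ x∈) ew of λ where
        (inj₁ w∈) → inj₁ (w∈ , λ w∈X → irr (subst (λ v → v ~ w) (trans (top x∈) (sym (top w∈X))) ew))
        (inj₂ r) → inj₂ r
      where
      top : ∀ {w} → w ∈ X → w ≡ z
      top w∈ = [ Z≡ , (λ w∈N → ⊥-elim (n (lose w∈ w∈N))) ]′ (∈-++⁻ Z (X⊆ w∈))

    -- The second neighbour `p′` of a peeled vertex may be spurious: outside `M`, or `e` itself. It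
    -- is then replaced by any other vertex of `M`, because the later bounds subtract `e` and `p` as
    -- two distinct vertices of `M`.
    partner : ∀ {M e} → Unique M → 2 ≤ length M → ∀ p′ → ∃[ p ] (p ∈ M × e ≢ p × (p′ ∈ M → e ≢ p′ → p′ ≡ p))
    partner {M} {e} uM le p′ with p′ ∈? M | e ≟ p′
    ... | yes p′∈ | no n = p′ , p′∈ , n , λ _ _ → refl
    ... | no n | _ with p , p∈ , p∉ ← missing M [ e ] uM le = p , p∈ , (λ { refl → p∉ (here refl) }) , λ p′∈ → ⊥-elim (n p′∈)
    ... | yes _ | yes refl with p , p∈ , p∉ ← missing M [ e ] uM le = p , p∈ , (λ { refl → p∉ (here refl) }) , λ _ n → ⊥-elim (n refl)

    other : ∀ {p q x : V} → x ≡ p ⊎ x ≡ q → ∃[ p′ ] (∀ {w} → w ≡ p ⊎ w ≡ q → w ≡ x ⊎ w ≡ p′)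
    other {p} {q} (inj₁ refl) = q , id
    other {p} {q} (inj₂ refl) = p , λ { (inj₁ r) → inj₂ r ; (inj₂ r) → inj₁ r }

    first-peeled : ∀ {M x} → Peelable M → 0 < length M → (∀ {w} → w ∈ M → w ~ x) →
      x ∉ M → ∃[ e ] ∃[ p ] (e ∈ M × (∀ {w} → e ~ w → w ≡ x ⊎ w ≡ p))
    first-peeled {M@(_ ∷ _)} {x} pl _ see x∉
      with e , e∈ , p , q , h ← pl M id (here refl) =
      let h′ : ∀ {w} → e ~ w → w ≡ p ⊎ w ≡ q
          h′ ew = [ (λ (a , b) → ⊥-elim (b a)) , id ]′ (h ew)
          p′ , o = other (h′ (see e∈))
      in e , p′ , e∈ , o ∘ h′

    Twig : List V → Set
    Twig M = ∃[ u ] ∃[ p ] (u ∈ M × p ∈ M × u ≢ p × (∀ {w} → u ~ w → w ∈ M → w ≡ p))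

    twig-of-seen : ∀ {M x} → Peelable M → Unique M → 2 ≤ length M → (∀ {w} → w ∈ M → w ~ x) → x ∉ M → Twig M
    twig-of-seen pl uM le see x∉ with e , p′ , e∈ , h ← first-peeled pl (≤-trans (s≤s z≤n) le) see x∉
      with p , p∈ , e≢p , f ← partner {e = e} uM le p′ = e , p , e∈ , p∈ , e≢p , λ ew w∈ → case h ew of λ where
        (inj₁ refl) → ⊥-elim (x∉ w∈)
        (inj₂ refl) → f w∈ λ { refl → irr ew }

    -- If all of `M` sees the same end, the first peeled vertex has at most one further neighbour.
    -- Otherwise some vertex misses `x` and some vertex misses `y`; by tameness these are one vertex
    -- `a`, and all others see both ends. The first vertex peeled from `M ∖ [ a ]` then spends its
    -- two exceptional neighbours on `x` and `y`, so only `a` is left for it inside `M`.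
    twig : ∀ {x y M} → Part x y M → Unique M → 2 ≤ length M → x ∉ M → y ∉ M → x ≢ y → Twig M
    twig {x} {y} {M} part uM le x∉ y∉ x≢y with blind x M | blind y M
    ... | inj₂ see | _ = twig-of-seen (Part.peelable part) uM le see x∉
    ... | inj₁ _ | inj₂ see = twig-of-seen (Part.peelable part) uM le see y∉
    ... | inj₁ (a , a∈ , a≁x) | inj₁ (b , b∈ , b≁y) with a ≟ b
    ...   | no n = ⊥-elim (true≢false (Part.tame part b∈ a∈ (n ∘ sym) b≁y) a≁x)
    ...   | yes refl with m , m∈ , m∉ ← missing M [ a ] uM le
      with e , e∈ , p , q , h ← Part.peelable part (M ∖ [ a ]) (proj₁ ∘ ∈-∖⁻ M) (∈-∖⁺ m∈ m∉)
      with e∈M , e∉ ← ∈-∖⁻ M e∈ = e , a , e∈M , a∈ , e≢a , λ ew w∈ → case h ew of λ where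
        (inj₁ (_ , w∉)) → outside-∖ w∈ w∉
        (inj₂ r) → ⊥-elim ([ (λ { refl → x∉ w∈ }) , (λ { refl → y∉ w∈ }) ]′ (proj₂ rest r))
      where
      e≢a : e ≢ a
      e≢a refl = e∉ (here refl)
      ex : e ~ x
      ex = Part.tame part a∈ e∈M (e≢a ∘ sym) b≁y
      ey : e ~ y
      ey = tame-sym (Part.tame part) a∈ e∈M (e≢a ∘ sym) a≁x
      h′ : ∀ {w} → e ~ w → w ∉ M → w ≡ p ⊎ w ≡ q
      h′ ew w∉ = [ (λ (w∈ , _) → ⊥-elim (w∉ w∈)) , id ]′ (h ew)
      rest : ∃[ p′ ] (∀ {w} → w ≡ p ⊎ w ≡ q → w ≡ x ⊎ w ≡ y)
      rest with p′ , o ← other (h′ ex x∉) = p′ , λ r → case o r of λ where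
        (inj₁ s) → inj₁ s
        (inj₂ s) → case o (h′ ey y∉) of λ where
          (inj₁ t) → ⊥-elim (x≢y (sym t))
          (inj₂ t) → inj₂ (trans s (sym t))
      outside-∖ : ∀ {w} → w ∈ M → w ∉ M ∖ [ a ] → w ≡ a
      outside-∖ {w} w∈ w∉ = case w ≟ a of λ where
        (yes r) → r
        (no n) → ⊥-elim (w∉ (∈-∖⁺ w∈ λ { (here r) → n r }))

    two-cover : ∀ {M u v} → Unique M → length M ≤ 2 → u ∈ M → v ∈ M → u ≢ v → ∀ {w} → w ∈ M → w ≡ u ⊎ w ≡ v
    two-cover {M} {u} {v} uM le u∈ v∈ u≢v {w} w∈ = case w ∈? (u ∷ v ∷ []) of λ where
      (yes (here r)) → inj₁ r
      (yes (there (here r))) → inj₂ r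
      (no n) → ⊥-elim (1+n≰n (≤-trans (length-⊆ M (cons-unique n (pair-unique u≢v)) λ { (here refl) → w∈ ; (there r) → pair-⊆ u∈ v∈ r }) le))

    -- Z is [ z ] or [], depending on whether the vertex z is still present.
    record Branch (x y z : V) (Z A B : List V) : Set where
      field
        uZ    : Unique Z
        Z≡    : ∀ {w} → w ∈ Z → w ≡ z
        Z⊆    : Z ⊆ U
        z∈Z   : z ∈ U → z ∈ Z
        uA    : Unique A
        uB    : Unique B
        A⊆    : A ⊆ U
        B⊆    : B ⊆ U
        disj  : ∀ {w} → w ∈ A → w ∈ B → ⊥
        disjZ : ∀ {w} → w ∈ Z → w ∈ A ++ B → ⊥
        x≢y   : x ≢ y
        x≢z   : x ≢ z
        y≢z   : y ≢ z
        x∉A   : x ∉ A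
        x∉B   : x ∉ B
        y∉A   : y ∉ A
        y∉B   : y ∉ B
        z∉A   : z ∉ A
        z∉B   : z ∉ B
        x—y   : x — y
        partA : Part x z A
        partB : Part z y B
        cl    : Closed x y (Z ++ (A ++ B))

      M₀ : List V
      M₀ = Z ++ (A ++ B)

      uM₀ : Unique M₀
      uM₀ = ++-unique uZ (++-unique uA uB disj) disjZ

      M₀⊆ : M₀ ⊆ U
      M₀⊆ w∈ = [ Z⊆ , (λ r → [ A⊆ , B⊆ ]′ (∈-++⁻ A r)) ]′ (∈-++⁻ Z w∈)

      peelable₀ : Peelable M₀
      peelable₀ = peelable-top {N = A ++ B} Z≡ (peelable-++ (Part.peelable partA) (Part.peelable partB)) cl

      A-blind : ∀ {a} → a ∈ A → a ~ y → ⊥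
      A-blind a∈ ay = case Part.closed partA a∈ ay of λ where
        (inj₁ r) → y∉A r
        (inj₂ (inj₁ r)) → x≢y (sym r)
        (inj₂ (inj₂ r)) → y≢z r

      B-blind : ∀ {b} → b ∈ B → b ~ x → ⊥
      B-blind b∈ bx = case Part.closed partB b∈ bx of λ where
        (inj₁ r) → x∉B r
        (inj₂ (inj₁ r)) → x≢z r
        (inj₂ (inj₂ r)) → x≢y r

      Z≤1 : length Z ≤ 1
      Z≤1 = length-⊆ [ z ] uZ λ w∈ → here (Z≡ w∈)

      length-M₀ : length M₀ ≡ length Z + (length A + length B)
      length-M₀ = trans (length-++ Z) (cong (length Z +_) (length-++ A))

      inA : A ⊆ M₀
      inA w∈ = ∈-++⁺ʳ Z (∈-++⁺ˡ w∈)

      inB : B ⊆ M₀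
      inB w∈ = ∈-++⁺ʳ Z (∈-++⁺ʳ A w∈)

      x∉M₀ : x ∉ M₀
      x∉M₀ w∈ = [ x≢z ∘ Z≡ , (λ r → [ x∉A , x∉B ]′ (∈-++⁻ A r)) ]′ (∈-++⁻ Z w∈)

    -- Oversized configurations around a vertex z.

    mirror : ∀ {x y z Z A B} → Branch x y z Z A B → Branch y x z Z B A
    mirror {x} {y} {Z = Z} {A} {B} b = record
      { uZ = uZ ; Z≡ = Z≡ ; Z⊆ = Z⊆ ; z∈Z = z∈Z ; uA = uB ; uB = uA ; A⊆ = B⊆ ; B⊆ = A⊆
      ; disj = λ p q → disj q p ; disjZ = λ p q → disjZ p (flip-∈ B q) ; x≢y = x≢y ∘ sym ; x≢z = y≢z ; y≢z = x≢z
      ; x∉A = y∉B ; x∉B = y∉A ; y∉A = x∉B ; y∉B = x∉A ; z∉A = z∉B ; z∉B = z∉A ; x—y = —-sym x—y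
      ; partA = part-sym partB ; partB = part-sym partA
      ; cl = λ d∈ dw → case cl (flip₀ B d∈) dw of λ where
          (inj₁ r) → inj₁ (flip₀ A r)
          (inj₂ (inj₁ r)) → inj₂ (inj₂ r)
          (inj₂ (inj₂ r)) → inj₂ (inj₁ r)
      }
      where
      open Branch b
      flip-∈ : ∀ M {N} → M ++ N ⊆ N ++ M
      flip-∈ M {N} r = [ ∈-++⁺ʳ N , ∈-++⁺ˡ ]′ (∈-++⁻ M r)
      flip₀ : ∀ M {N} → Z ++ (M ++ N) ⊆ Z ++ (N ++ M)
      flip₀ M r = [ ∈-++⁺ˡ , (λ s → ∈-++⁺ʳ Z (flip-∈ M s)) ]′ (∈-++⁻ Z r)

    inhabited? : ∀ (L : List V) → L ≡ [] ⊎ ∃[ w ] w ∈ L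
    inhabited? []      = inj₁ refl
    inhabited? (w ∷ _) = inj₂ (w , here refl)

    -- By tameness all of `M₀` sees `x`. No vertex of `B` can, so `M₀` lies in `Z ++ A`, and the
    -- first vertex peeled from `A` sees `x` and at most one other vertex. It serves as `e` in
    -- `spread-twig`, with `M₀` and `R` as the two lists.
    cross : ∀ {x y z Z A B R u v} (b : Branch x y z Z A B) → let open Branch b in Tame x y M₀ → Part x y R → Unique R → R ⊆ U →
      (∀ {w} → w ∈ M₀ → w ∈ R → ⊥) → length M₀ ≤ 1 + j → K < length M₀ + length R →
      u ∈ M₀ → u ≁ y → v ∈ R → v ≁ x → Good adj U
    cross {x} {y} {z} {Z} {A} {B} {R} {u} {v} b tame₀ partR uR R⊆ disjR le lt u∈ u≁y v∈ v≁x = goal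
      where
      open Branch b
      3≤M₀ : 3 ≤ length M₀
      3≤M₀ = +-cancelʳ-≤ j 3 (length M₀) (≤-trans lt (+-monoʳ-≤ (length M₀) (Part.small partR)))
      -- If `u` missed `x` too, all other vertices of `M₀` would see both ends. Nothing in `A` or
      -- `B` does, so `M₀` would contain at most `u` and `z`.
      u~x : u ~ x
      u~x = case bool (adj u x) of λ where
        (inj₁ ux) → ux
        (inj₂ u≁x) → ⊥-elim (1+n≰n (≤-trans 3≤M₀ (length-⊆ (u ∷ z ∷ []) uM₀ λ {w} w∈ → case w ≟ u of λ where
          (yes refl) → here refl
          (no n) → case ∈-++⁻ Z w∈ of λ where
            (inj₁ r) → there (here (Z≡ r))
            (inj₂ r) → case ∈-++⁻ A r of λ where
              (inj₁ a) → ⊥-elim (A-blind a (tame-sym tame₀ u∈ w∈ (n ∘ sym) u≁x))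
              (inj₂ s) → ⊥-elim (B-blind s (tame₀ u∈ w∈ (n ∘ sym) u≁y)))))
      see : ∀ {w} → w ∈ M₀ → w ~ x
      see {w} w∈ = case u ≟ w of λ where
        (yes refl) → u~x
        (no n) → tame₀ u∈ w∈ n u≁y
      0<A : 0 < length A
      0<A = case missing M₀ [ z ] uM₀ (≤-trans (s≤s (s≤s z≤n)) 3≤M₀) of λ where
        (w , w∈ , w∉) → case ∈-++⁻ Z w∈ of λ where
          (inj₁ r) → ⊥-elim (w∉ (here (Z≡ r)))
          (inj₂ r) → case ∈-++⁻ A r of λ where
            (inj₁ a) → length>0 a
            (inj₂ s) → ⊥-elim (B-blind s (see (inB s)))
      goal : Good adj U
      goal with e , p′ , e∈ , h ← first-peeled (Part.peelable partA) 0<A (see ∘ inA) x∉A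
        with p , p∈ , e≢p , f ← partner {e = e} uM₀ (≤-trans (s≤s (s≤s z≤n)) 3≤M₀) p′ =
        spread-twig cl (Part.closed partR) peelable₀ uM₀ uR M₀⊆ R⊆ disjR le (Part.small partR) (<⇒≤ lt) (inA e∈) p∈ e≢p
          (λ ew → case h ew of λ where
            (inj₁ r) → inj₁ r
            (inj₂ refl) → case cl (inA e∈) ew of λ where
              (inj₁ r) → inj₂ (f r λ { refl → irr ew })
              (inj₂ (inj₁ r)) → inj₁ r
              (inj₂ (inj₂ refl)) → ⊥-elim (A-blind e∈ ew))
          v∈ v≁x x—y x≢y

    -- With four colours the five vertices of spread-branch do not fit into a single block.
    four-colours : ∀ {x y z Z A B} → Branch x y z Z A B → j ≡ 2 → z ∈ Z → length A ≡ 2 → length B ≡ 2 → Good adj U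
    four-colours {x} {y} {z} {Z} {A} {B} b j≡2 z∈ lA lB
      with e , e∈ , p , q , he ← Part.peelable (Branch.partA b) A id (proj₁ (proj₂ (missing A [] (Branch.uA b) (subst (0 <_) (sym lA) (s≤s z≤n)))))
      with e′ , e′∈ , e′∉ ← missing A [ e ] (Branch.uA b) (≤-reflexive (sym lA))
      with w , w∈ , s , t , hw ← Part.peelable (Branch.partB b) B id (proj₁ (proj₂ (missing B [] (Branch.uB b) (subst (0 <_) (sym lB) (s≤s z≤n))))) = goal
      where
      open Branch b
      e≢e′ : e ≢ e′
      e≢e′ refl = e′∉ (here refl)
      A⊆ee′ : ∀ {d} → d ∈ A → d ≡ e ⊎ d ≡ e′
      A⊆ee′ = two-cover uA (≤-reflexive lA) e∈ e′∈ e≢e′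
      he′ : ∀ {d} → e ~ d → d ≡ p ⊎ d ≡ q
      he′ ed = [ (λ (a , n) → ⊥-elim (n a)) , id ]′ (he ed)
      lZ : length Z ≡ 1
      lZ = ≤-antisym Z≤1 (length>0 z∈)
      z∈U = Z⊆ z∈
      w-slim : ∀ S → count (adj w) (U ∖ S) ≤ 2
      w-slim S = outside S (s ∷ t ∷ []) λ wd _ → case hw wd of λ where
        (inj₁ (a , n)) → ⊥-elim (n a)
        (inj₂ (inj₁ r)) → here r
        (inj₂ (inj₂ r)) → there (here r)
      unique-four : ∀ {c d} → c ≢ d → c ≢ e′ → c ≢ e → d ∈ B → Unique (c ∷ d ∷ e′ ∷ e ∷ [])
      unique-four c≢d c≢e′ c≢e d∈ = cons-unique (λ { (here r) → c≢d r ; (there (here r)) → c≢e′ r ; (there (there (here r))) → c≢e r })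
        (cons-unique (λ { (here refl) → disj e′∈ d∈ ; (there (here refl)) → disj e∈ d∈ }) (pair-unique (e≢e′ ∘ sym)))
      z-bound : ∀ S → Unique S → S ⊆ M₀ → length S ≡ 4 → count (adj z) (U ∖ S) ≤ 3
      z-bound S uS S⊆ lS = ≤-trans (outside S (x ∷ y ∷ (M₀ ∖ S)) λ zd d∉ → case cl (∈-++⁺ˡ z∈) zd of λ where
          (inj₁ r) → there (there (∈-∖⁺ r d∉))
          (inj₂ (inj₁ r)) → here r
          (inj₂ (inj₂ r)) → there (here r))
        (s≤s (s≤s (≤-reflexive (+-cancelˡ-≡ 4 _ _ (trans (cong (_+ length (M₀ ∖ S)) (sym lS)) (trans (sym (length-∖ uM₀ uS S⊆))
          (trans length-M₀ (cong₂ _+_ lZ (cong₂ _+_ lA lB)))))))))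
      goal : Good adj U
      goal with bool (adj e x) | bool (adj e z)
      -- With `A` and `z` in S, `e` has no neighbour left and `e′` at most `x`; `z` can still see
      -- `x`, `y` and the other vertex of `B`.
      ... | inj₂ e≁x | _ = spread-four j≡2 (M₀⊆ ∘ S⊆) uS (z-bound _ uS S⊆ refl) (w-slim _)
          (outside _ [ x ] λ ed d∉ → case Part.closed partA e′∈ ed of λ where
            (inj₁ r) → ⊥-elim (d∉ (A∈S r))
            (inj₂ (inj₁ r)) → here r
            (inj₂ (inj₂ refl)) → ⊥-elim (d∉ (here refl)))
          (outside _ [] λ ed d∉ → case Part.closed partA e∈ ed of λ where
            (inj₁ r) → ⊥-elim (d∉ (A∈S r))
            (inj₂ (inj₁ refl)) → ⊥-elim (true≢false ed e≁x)
            (inj₂ (inj₂ refl)) → ⊥-elim (d∉ (here refl)))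
        where
        S = z ∷ w ∷ e′ ∷ e ∷ []
        S⊆ : S ⊆ M₀
        S⊆ (here refl) = ∈-++⁺ˡ z∈
        S⊆ (there (here refl)) = inB w∈
        S⊆ (there (there (here refl))) = inA e′∈
        S⊆ (there (there (there (here refl)))) = inA e∈
        uS : Unique S
        uS = unique-four (λ { refl → z∉B w∈ }) (λ { refl → z∉A e′∈ }) (λ { refl → z∉A e∈ }) w∈
        A∈S : A ⊆ S
        A∈S d∈ = [ (λ { refl → there (there (there (here refl))) }) , (λ { refl → there (there (here refl)) }) ]′ (A⊆ee′ d∈)
      -- Tameness of `A` over `x` and `z` makes `e′` see `x` as well, so `x` has two of its at most
      -- five neighbours in S.
      ... | inj₁ ex | inj₂ e≁z = spread-four j≡2 S⊆ uS
          (+-cancelˡ-≤ 2 _ _ (≤-trans (+-monoˡ-≤ _ x-sees) (≤-trans (degree-rest valid smaller uS S⊆ x) (≤-reflexive (cong (λ n → 1 + 2 * n) j≡2)))))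
          (w-slim _)
          (outside _ [ z ] λ ed d∉ → case Part.closed partA e′∈ ed of λ where
            (inj₁ r) → ⊥-elim (d∉ (A∈S r))
            (inj₂ (inj₁ refl)) → ⊥-elim (d∉ (here refl))
            (inj₂ (inj₂ r)) → here r)
          (outside _ [] λ ed d∉ → case Part.closed partA e∈ ed of λ where
            (inj₁ r) → ⊥-elim (d∉ (A∈S r))
            (inj₂ (inj₁ refl)) → ⊥-elim (d∉ (here refl))
            (inj₂ (inj₂ refl)) → ⊥-elim (true≢false ed e≁z))
        where
        S = x ∷ w ∷ e′ ∷ e ∷ []
        S⊆ : S ⊆ U
        S⊆ (here refl) = inside ex
        S⊆ (there (here refl)) = B⊆ w∈
        S⊆ (there (there (here refl))) = A⊆ e′∈
        S⊆ (there (there (there (here refl)))) = A⊆ e∈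
        uS : Unique S
        uS = unique-four (λ { refl → x∉B w∈ }) (λ { refl → x∉A e′∈ }) (λ { refl → x∉A e∈ }) w∈
        A∈S : A ⊆ S
        A∈S d∈ = [ (λ { refl → there (there (there (here refl))) }) , (λ { refl → there (there (here refl)) }) ]′ (A⊆ee′ d∈)
        e′x : e′ ~ x
        e′x = Part.tame partA e∈ e′∈ e≢e′ e≁z
        x-sees : 2 ≤ count (adj x) S
        x-sees = ≤-trans (≤-reflexive (sym (count-all {f = adj x} (e′ ∷ e ∷ []) λ { (here refl) → symm e′x ; (there (here refl)) → symm ex })))
          (≤-trans (m≤n+m _ (bit (adj x w))) (m≤n+m _ (bit (adj x x))))
      -- Now `x` and `z` exhaust the neighbours of `e`, so `e′` may stay outside S. `B`, split into
      -- its twig, is included entirely, and `remove-pair` applies to `e` and `v`.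
      ... | inj₁ ex | inj₁ ez with v , q′ , v∈ , q∈ , v≢q , hv ← twig partB uB (≤-reflexive (sym lB)) z∉B y∉B (y≢z ∘ sym) =
        remove-pair valid smaller S uS S⊆U (cong (2 +_) (sym j≡2)) (there (there (here refl))) (there (there (there (here refl)))) x—y x≢y
          (λ {d} d∈ ed → case x-or-z (he′ ed) of λ where
            (inj₁ r) → r
            (inj₂ refl) → ⊥-elim (proj₂ (∈-∖⁻ U d∈) (here refl)))
          (λ d∈ vd → case Part.closed partB v∈ vd of λ where
            (inj₁ r) → ⊥-elim (proj₂ (∈-∖⁻ U d∈) (B∈S r))
            (inj₂ (inj₁ refl)) → ⊥-elim (proj₂ (∈-∖⁻ U d∈) (here refl))
            (inj₂ (inj₂ r)) → r)
          λ α asg → assign-∷ (z-bound S uS S⊆ refl) (assign-∷ (m≤n⇒m≤1+n (outside S [ y ] λ qd d∉ → case Part.closed partB q∈ qd of λ where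
            (inj₁ r) → ⊥-elim (d∉ (B∈S r))
            (inj₂ (inj₁ refl)) → ⊥-elim (d∉ (here refl))
            (inj₂ (inj₂ r)) → here r)) asg)
        where
        S = z ∷ q′ ∷ e ∷ v ∷ []
        S⊆ : S ⊆ M₀
        S⊆ (here refl) = ∈-++⁺ˡ z∈
        S⊆ (there (here refl)) = inB q∈
        S⊆ (there (there (here refl))) = inA e∈
        S⊆ (there (there (there (here refl)))) = inB v∈
        S⊆U : S ⊆ U
        S⊆U d∈ = M₀⊆ (S⊆ d∈)
        uS : Unique S
        uS = cons-unique (λ { (here refl) → z∉B q∈ ; (there (here refl)) → z∉A e∈ ; (there (there (here refl))) → z∉B v∈ })
          (cons-unique (λ { (here refl) → disj e∈ q∈ ; (there (here refl)) → v≢q refl }) (pair-unique λ { refl → disj e∈ v∈ }))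
        B∈S : B ⊆ S
        B∈S d∈ = [ (λ { refl → there (there (there (here refl))) }) , (λ { refl → there (here refl) }) ]′ (two-cover uB (≤-reflexive lB) v∈ q∈ v≢q d∈)
        x-or-z : ∀ {d} → d ≡ p ⊎ d ≡ q → d ≡ x ⊎ d ≡ z
        x-or-z r with c , o ← other (he′ ex) = case o r of λ where
          (inj₁ a) → inj₁ a
          (inj₂ a) → case o (he′ ez) of λ where
            (inj₁ a′) → ⊥-elim (x≢z (sym a′))
            (inj₂ a′) → inj₂ (trans a (sym a′))

    -- As `A` and `B` have at most `j` vertices each, more than `K` in total forces at least two
    -- into either, so both contain a twig. Together with `z` this prescribes up to five vertices of
    -- S, which is too many only for `K = 4` with `z` present.
    big : ∀ {x y z Z A B} (b : Branch x y z Z A B) → let open Branch b in K < length M₀ → Good adj U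
    big {x} {y} {z} {Z} {A} {B} b lt = by-size
      where
      open Branch b
      lA = Part.small partA
      lB = Part.small partB
      lt′ : 3 + j ≤ length Z + (length A + length B)
      lt′ = subst (K <_) length-M₀ lt
      sum≤ : 3 + j ≤ 1 + (length A + length B)
      sum≤ = ≤-trans lt′ (+-monoˡ-≤ _ Z≤1)
      2≤A : 2 ≤ length A
      2≤A = +-cancelʳ-≤ j 2 (length A) (≤-trans (s≤s⁻¹ sum≤) (+-monoʳ-≤ (length A) lB))
      2≤B : 2 ≤ length B
      2≤B = +-cancelˡ-≤ j 2 (length B) (≤-trans (≤-reflexive (+-comm j 2)) (≤-trans (s≤s⁻¹ sum≤) (+-monoˡ-≤ (length B) lA)))
      generic : length Z + 4 ≤ K → Good adj U
      generic le
        with u , p , u∈ , p∈ , u≢p , hu ← twig partA uA 2≤A x∉A z∉A x≢z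
        with v , q , v∈ , q∈ , v≢q , hv ← twig partB uB 2≤B z∉B y∉B (y≢z ∘ sym) =
        spread-branch uZ Z≡ Z⊆ z∈Z (Part.closed partA) (Part.closed partB) cl (peelable-++ (Part.peelable partA) (Part.peelable partB))
          uA uB A⊆ B⊆ disj disjZ x—y x≢y lA lB le (≤-trans (<⇒≤ lt′) (≤-reflexive (cong (length Z +_) (sym (length-++ A)))))
          u∈ p∈ u≢p hu v∈ q∈ v≢q hv
      2≤j : 2 ≤ j
      2≤j = ≤-trans 2≤A lA
      by-size : Good adj U
      by-size with length Z + 4 ≤? K
      ... | yes le = generic le
      ... | no n = four-colours b j≡2 z∈ (≤-antisym (≤-trans lA (≤-reflexive j≡2)) 2≤A) (≤-antisym (≤-trans lB (≤-reflexive j≡2)) 2≤B)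
        where
        j≡2 : j ≡ 2
        j≡2 = ≤-antisym (s≤s⁻¹ (s≤s⁻¹ (s≤s⁻¹ (≤-trans (≰⇒> n) (+-monoˡ-≤ 4 Z≤1))))) 2≤j
        z∈ : z ∈ Z
        z∈ = case inhabited? Z of λ where
          (inj₁ r) → ⊥-elim (n (≤-trans (≤-reflexive (cong (λ L → length L + 4) r)) (s≤s (s≤s 2≤j))))
          (inj₂ (w , w∈)) → subst (_∈ Z) (Z≡ w∈) w∈

    -- Merging the three parts at a node.

    module _ (enough : K ≤ length U) (peelU : Peelable U) where

      -- `M₀` is tested before `M₀ ++ R`. If it is tame, `A` or `B` is empty, since `A` never sees
      -- `y` and `B` never sees `x`; this brings `M₀` down to `j + 1` vertices. For the union, a
      -- pair violating tameness is settled by `spread-pair` or, beyond `K` vertices, by `cross`; a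
      -- tame union of more than `j` vertices has an end seen by all but at most one of them.
      merge-parts : ∀ {x y z Z A B R} (b : Branch x y z Z A B) → let open Branch b in Part x y R → Unique R → R ⊆ U →
        (∀ {w} → w ∈ M₀ → w ∈ R → ⊥) → x ∉ R → y ∉ R → Good adj U ⊎ Part x y (M₀ ++ R)
      merge-parts {x} {y} {z} {Z} {A} {B} {R} b partR uR R⊆ disjR x∉R y∉R with tame? x y (Branch.M₀ b)
      ... | inj₁ (u , v , u∈ , v∈ , u≢v , u≁y , v≁x) = case length M₀ ≤? K of λ where
          (yes le) → inj₁ (spread-pair peelU enough cl uM₀ M₀⊆ le u∈ v∈ u≢v u≁y v≁x x—y x≢y)
          (no n) → inj₁ (big b (≰⇒> n))
        where open Branch b
      ... | inj₂ tame₀ = by-tame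
        where
        open Branch b
        b′ = mirror b
        module b′ = Branch b′
        M = M₀ ++ R
        closed-M : Closed x y M
        closed-M d∈ dw = case ∈-++⁻ M₀ d∈ of λ where
          (inj₁ r) → case cl r dw of λ where
            (inj₁ s) → inj₁ (∈-++⁺ˡ s)
            (inj₂ s) → inj₂ s
          (inj₂ r) → case Part.closed partR r dw of λ where
            (inj₁ s) → inj₁ (∈-++⁺ʳ M₀ s)
            (inj₂ s) → inj₂ s
        uM : Unique M
        uM = ++-unique uM₀ uR disjR
        M⊆ : M ⊆ U
        M⊆ d∈ = [ M₀⊆ , R⊆ ]′ (∈-++⁻ M₀ d∈)
        M₀↔ : ∀ {w} → w ∈ M₀ → w ∈ b′.M₀
        M₀↔ w∈ = [ ∈-++⁺ˡ , (λ r → ∈-++⁺ʳ Z ([ ∈-++⁺ʳ B , ∈-++⁺ˡ ]′ (∈-++⁻ A r))) ]′ (∈-++⁻ Z w∈)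
        M₀↔⁻ : ∀ {w} → w ∈ b′.M₀ → w ∈ M₀
        M₀↔⁻ w∈ = [ ∈-++⁺ˡ , (λ r → ∈-++⁺ʳ Z ([ ∈-++⁺ʳ A , ∈-++⁺ˡ ]′ (∈-++⁻ B r))) ]′ (∈-++⁻ Z w∈)
        length-M₀′ : length b′.M₀ ≡ length M₀
        length-M₀′ = trans b′.length-M₀ (trans (cong (length Z +_) (+-comm (length B) (length A))) (sym length-M₀))
        one-sided : A ≡ [] ⊎ B ≡ []
        one-sided with inhabited? A | inhabited? B
        ... | inj₁ r | _ = inj₁ r
        ... | inj₂ _ | inj₁ r = inj₂ r
        ... | inj₂ (a , a∈) | inj₂ (c , c∈) = ⊥-elim (B-blind c∈ (tame₀ (inA a∈) (inB c∈) (λ { refl → disj a∈ c∈ }) (case bool (adj a y) of λ where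
          (inj₁ ay) → ⊥-elim (A-blind a∈ ay)
          (inj₂ n) → n)))
        M₀≤ : length M₀ ≤ 1 + j
        M₀≤ = ≤-trans (≤-reflexive length-M₀) (+-mono-≤ Z≤1 (case one-sided of λ where
          (inj₁ r) → ≤-trans (≤-reflexive (cong (λ L → length L + length B) r)) (Part.small partB)
          (inj₂ r) → ≤-trans (≤-reflexive (trans (cong (λ L → length A + length L) r) (+-identityʳ _))) (Part.small partA)))
        length-M : length M ≡ length M₀ + length R
        length-M = length-++ M₀
        -- The list containing `v₀` must go into S entirely, so it plays the role of `N₁`; the other
        -- one supplies the fillers.
        apex : ∀ {v₀} → 1 + j ≤ length M → v₀ ∈ M → v₀ ≁ y → (∀ {w} → w ∈ M → w ≢ v₀ → w ~ x) → Good adj U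
        apex le v₀∈ v₀≁y see = case ∈-++⁻ M₀ v₀∈ of λ where
          (inj₁ r) → spread-apex cl (Part.peelable partR) uM₀ uR M₀⊆ R⊆ disjR x∉M₀ x∉R r v₀≁y (see ∘ ∈-++⁺ˡ)
            (λ w∈ → see (∈-++⁺ʳ M₀ w∈) λ { refl → disjR r w∈ }) M₀≤ (≤-trans le (≤-reflexive length-M))
          (inj₂ r) → spread-apex (Part.closed partR) peelable₀ uR uM₀ R⊆ M₀⊆ (λ p q → disjR q p) x∉R x∉M₀ r v₀≁y (see ∘ ∈-++⁺ʳ M₀)
            (λ w∈ → see (∈-++⁺ˡ w∈) λ { refl → disjR w∈ r }) (m≤n⇒m≤1+n (Part.small partR)) (≤-trans le (≤-reflexive (trans length-M (+-comm (length M₀) (length R)))))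
        y∉M₀ : y ∉ M₀
        y∉M₀ = b′.x∉M₀ ∘ M₀↔
        apex′ : ∀ {v₀} → 1 + j ≤ length M → v₀ ∈ M → v₀ ≁ x → (∀ {w} → w ∈ M → w ≢ v₀ → w ~ y) → Good adj U
        apex′ le v₀∈ v₀≁x see = case ∈-++⁻ M₀ v₀∈ of λ where
          (inj₁ r) → spread-apex (closed-sym cl) (Part.peelable partR) uM₀ uR M₀⊆ R⊆ disjR y∉M₀ y∉R r v₀≁x (see ∘ ∈-++⁺ˡ)
            (λ w∈ → see (∈-++⁺ʳ M₀ w∈) λ { refl → disjR r w∈ }) M₀≤ (≤-trans le (≤-reflexive length-M))
          (inj₂ r) → spread-apex (closed-sym (Part.closed partR)) peelable₀ uR uM₀ R⊆ M₀⊆ (λ p q → disjR q p) y∉R y∉M₀ r v₀≁x (see ∘ ∈-++⁺ʳ M₀)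
            (λ w∈ → see (∈-++⁺ˡ w∈) λ { refl → disjR w∈ r }) (m≤n⇒m≤1+n (Part.small partR)) (≤-trans le (≤-reflexive (trans length-M (+-comm (length M₀) (length R)))))
        -- There is no `v₀` to end the list with. But `A` and `B` are empty now, so the union is
        -- exactly `z` and the `j` vertices of `R`, all of them seeing both ends.
        seen-by-both : 1 + j ≤ length M → (∀ {w} → w ∈ M → w ~ x) → (∀ {w} → w ∈ M → w ~ y) → Good adj U
        seen-by-both le seex seey = case missing M₀ [] uM₀ 0<M₀ of λ where
            (w , w∈ , _) → case ∈-++⁻ Z w∈ of λ where
              (inj₁ r) → with-top (subst (_∈ Z) (Z≡ r) r)
              (inj₂ r) → ⊥-elim (no-AB r)
          where
          no-AB : ∀ {w} → w ∈ A ++ B → ⊥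
          no-AB r = case ∈-++⁻ A r of λ where
            (inj₁ a) → A-blind a (seey (∈-++⁺ˡ (inA a)))
            (inj₂ c) → B-blind c (seex (∈-++⁺ˡ (inB c)))
          M₀≤1 : length M₀ ≤ 1
          M₀≤1 = length-⊆ [ z ] uM₀ λ w∈ → [ (λ r → here (Z≡ r)) , ⊥-elim ∘ no-AB ]′ (∈-++⁻ Z w∈)
          le′ : 1 + j ≤ length M₀ + length R
          le′ = ≤-trans le (≤-reflexive length-M)
          0<M₀ : 0 < length M₀
          0<M₀ = +-cancelʳ-≤ j 1 (length M₀) (≤-trans le′ (+-monoʳ-≤ (length M₀) (Part.small partR)))
          lR : length R ≡ j
          lR = ≤-antisym (Part.small partR) (+-cancelˡ-≤ 1 _ _ (≤-trans le′ (+-monoˡ-≤ (length R) M₀≤1)))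
          with-top : z ∈ Z → Good adj U
          with-top z∈ = both-apexes uT T⊆ lR sees hz (Part.closed partR)
            where
            z∈M₀ : z ∈ M₀
            z∈M₀ = ∈-++⁺ˡ z∈
            uT : Unique (x ∷ y ∷ z ∷ R)
            uT = cons-unique (λ { (here r) → x≢y r ; (there (here r)) → x≢z r ; (there (there r)) → x∉R r })
              (cons-unique (λ { (here r) → y≢z r ; (there r) → y∉R r }) (cons-unique (disjR z∈M₀) uR))
            T⊆ : x ∷ y ∷ z ∷ R ⊆ U
            T⊆ (here refl) = inside (seex (∈-++⁺ˡ z∈M₀))
            T⊆ (there (here refl)) = inside (seey (∈-++⁺ˡ z∈M₀))
            T⊆ (there (there (here refl))) = Z⊆ z∈
            T⊆ (there (there (there r))) = R⊆ r
            sees : ∀ {d} → d ∈ z ∷ R → x ~ d × y ~ d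
            sees (here refl) = symm (seex (∈-++⁺ˡ z∈M₀)) , symm (seey (∈-++⁺ˡ z∈M₀))
            sees (there r) = symm (seex (∈-++⁺ʳ M₀ r)) , symm (seey (∈-++⁺ʳ M₀ r))
            hz : ∀ {w} → z ~ w → w ≡ x ⊎ w ≡ y
            hz zw = case cl z∈M₀ zw of λ where
              (inj₁ r) → case ∈-++⁻ Z r of λ where
                (inj₁ s) → ⊥-elim (irr (subst (z ~_) (Z≡ s) zw))
                (inj₂ s) → ⊥-elim (no-AB s)
              (inj₂ r) → r
        tame-M : 1 + j ≤ length M → Tame x y M → Good adj U
        tame-M le tame with blind y M | blind x M
        ... | inj₁ (v₀ , v₀∈ , v₀≁y) | _ = apex le v₀∈ v₀≁y λ w∈ n → tame v₀∈ w∈ (n ∘ sym) v₀≁y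
        ... | inj₂ _ | inj₁ (v₀ , v₀∈ , v₀≁x) = apex′ le v₀∈ v₀≁x λ w∈ n → tame-sym tame v₀∈ w∈ (n ∘ sym) v₀≁x
        ... | inj₂ seey | inj₂ seex = seen-by-both le seex seey
        -- `M₀` and `R` are tame separately, so the offending pair has one vertex in each.
        wild : ∀ {u v} → K < length M → u ∈ M → v ∈ M → u ≢ v → u ≁ y → v ≁ x → Good adj U
        wild lt u∈ v∈ u≢v u≁y v≁x with ∈-++⁻ M₀ u∈ | ∈-++⁻ M₀ v∈
        ... | inj₁ p | inj₁ q = ⊥-elim (true≢false (tame₀ p q u≢v u≁y) v≁x)
        ... | inj₂ p | inj₂ q = ⊥-elim (true≢false (Part.tame partR p q u≢v u≁y) v≁x)
        ... | inj₁ p | inj₂ q = cross b tame₀ partR uR R⊆ disjR M₀≤ (≤-trans lt (≤-reflexive length-M)) p u≁y q v≁x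
        ... | inj₂ p | inj₁ q = cross b′ (λ a∈ c∈ → tame-sym tame₀ (M₀↔⁻ a∈) (M₀↔⁻ c∈)) (part-sym partR) uR R⊆ (λ r → disjR (M₀↔⁻ r))
          (≤-trans (≤-reflexive length-M₀′) M₀≤) (≤-trans lt (≤-reflexive (trans length-M (cong (_+ length R) (sym length-M₀′))))) (M₀↔ q) v≁x p u≁y
        by-tame : Good adj U ⊎ Part x y M
        by-tame with tame? x y M | length M ≤? K | length M ≤? j
        ... | inj₁ (u , v , u∈ , v∈ , u≢v , u≁y , v≁x) | yes le | _ = inj₁ (spread-pair peelU enough closed-M uM M⊆ le u∈ v∈ u≢v u≁y v≁x x—y x≢y)
        ... | inj₁ (u , v , u∈ , v∈ , u≢v , u≁y , v≁x) | no n | _ = inj₁ (wild (≰⇒> n) u∈ v∈ u≢v u≁y v≁x)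
        ... | inj₂ tame | _ | yes le = inj₂ record { closed = closed-M ; peelable = peelable-++ peelable₀ (Part.peelable partR) ; small = le ; tame = tame }
        ... | inj₂ tame | _ | no n = inj₁ (tame-M (≰⇒> n) tame)

  -- A tree is read over a pair x y of vertices: node z a b r joins z to both, and a, b, r are read over x z, z y and x y.
  -- The pairs met in this way are the edges of a 2-tree, Edge t x y u v.
  data Tree : Set where
    leaf : Tree
    node : V → Tree → Tree → Tree → Tree

  labels : Tree → List V
  labels leaf           = []
  labels (node z a b r) = (z ∷ (labels a ++ labels b)) ++ labels r

  data Edge : Tree → V → V → V → V → Set where
    base  : ∀ {t x y} → Edge t x y x y
    left  : ∀ {z a b r x y u v} → Edge a x z u v → Edge (node z a b r) x y u v
    right : ∀ {z a b r x y u v} → Edge b z y u v → Edge (node z a b r) x y u v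
    rest  : ∀ {z a b r x y u v} → Edge r x y u v → Edge (node z a b r) x y u v

  ends : ∀ {t x y u v} → Edge t x y u v → u ∈ x ∷ y ∷ labels t × v ∈ x ∷ y ∷ labels t
  ends base = here refl , there (here refl)
  ends {node z a b r} {x} {y} (left e) with p , q ← ends e = up p , up q
    where
    up : ∀ {w} → w ∈ x ∷ z ∷ labels a → w ∈ x ∷ y ∷ labels (node z a b r)
    up (here s) = here s
    up (there (here s)) = there (there (here s))
    up (there (there s)) = there (there (there (∈-++⁺ˡ (∈-++⁺ˡ s))))
  ends {node z a b r} {x} {y} (right e) with p , q ← ends e = up p , up q
    where
    up : ∀ {w} → w ∈ z ∷ y ∷ labels b → w ∈ x ∷ y ∷ labels (node z a b r)
    up (here s) = there (there (here s))
    up (there (here s)) = there (here s)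
    up (there (there s)) = there (there (there (∈-++⁺ˡ (∈-++⁺ʳ (labels a) s))))
  ends {node z a b r} {x} {y} (rest e) with p , q ← ends e = up p , up q
    where
    up : ∀ {w} → w ∈ x ∷ y ∷ labels r → w ∈ x ∷ y ∷ labels (node z a b r)
    up (here s) = here s
    up (there (here s)) = there (here s)
    up (there (there s)) = there (there (∈-++⁺ʳ (z ∷ (labels a ++ labels b)) s))

  record Apart (x y z : V) (A B R : List V) : Set where
    field
      uA   : Unique (x ∷ z ∷ A)
      uB   : Unique (z ∷ y ∷ B)
      uR   : Unique (x ∷ y ∷ R)
      x≢z  : x ≢ z
      y≢z  : y ≢ z
      x∉B  : x ∉ B
      y∉A  : y ∉ A
      A∩B  : ∀ {w} → w ∈ A → w ∈ B → ⊥
      A∩R  : ∀ {w} → w ∈ A → w ∈ R → ⊥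
      B∩R  : ∀ {w} → w ∈ B → w ∈ R → ⊥
      z∉R  : z ∉ R
    x≢y : x ≢ y
    x≢y refl = head∉ uR (here refl)
    x∉A : x ∉ A
    x∉A = head∉ uA ∘ there
    x∉R : x ∉ R
    x∉R = head∉ uR ∘ there
    y∉B : y ∉ B
    y∉B = head∉ (tail-unique uB)
    y∉R : y ∉ R
    y∉R = head∉ (tail-unique uR)
    z∉A : z ∉ A
    z∉A = head∉ (tail-unique uA)
    z∉B : z ∉ B
    z∉B = head∉ uB ∘ there

  apart : ∀ {x y z A B R} → Unique (x ∷ y ∷ (z ∷ (A ++ B)) ++ R) → Apart x y z A B R
  apart {x} {y} {z} {A} {B} {R} u
    with uy ← tail-unique u with uz ← tail-unique uy
    with uAB , uR , AB∩R ← ++-unique⁻ (A ++ B) (tail-unique uz)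
    with uA , uB , A∩B ← ++-unique⁻ A uAB = record
    { uA = cons-unique (λ { (here s) → x∉ (there (here s)) ; (there s) → x∉ (there (there (toA s))) }) (cons-unique (z∉ ∘ toA) uA)
    ; uB = cons-unique (λ { (here s) → y∉ (here (sym s)) ; (there s) → z∉ (toB s) }) (cons-unique (y∉ ∘ there ∘ toB) uB)
    ; uR = cons-unique (λ { (here s) → x∉ (here s) ; (there s) → x∉ (there (there (toR s))) }) (cons-unique (y∉ ∘ there ∘ toR) uR)
    ; x≢z = λ s → x∉ (there (here s))
    ; y≢z = λ s → y∉ (here s)
    ; x∉B = x∉ ∘ there ∘ there ∘ toB
    ; y∉A = y∉ ∘ there ∘ toA
    ; A∩B = A∩B
    ; A∩R = λ p q → AB∩R (∈-++⁺ˡ p) q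
    ; B∩R = λ p q → AB∩R (∈-++⁺ʳ A p) q
    ; z∉R = z∉ ∘ toR
    }
    where
    x∉ = head∉ u
    y∉ = head∉ uy
    z∉ = head∉ uz
    toA : ∀ {w} → w ∈ A → w ∈ (A ++ B) ++ R
    toA s = ∈-++⁺ˡ (∈-++⁺ˡ s)
    toB : ∀ {w} → w ∈ B → w ∈ (A ++ B) ++ R
    toB s = ∈-++⁺ˡ (∈-++⁺ʳ A s)
    toR : ∀ {w} → w ∈ R → w ∈ (A ++ B) ++ R
    toR s = ∈-++⁺ʳ (A ++ B) s

  -- Searching the 2-tree for a removable set.

  module Search (t₀ : Tree) (x₀ y₀ : V) (unique₀ : Unique (x₀ ∷ y₀ ∷ labels t₀)) (j : ℕ) where
    open ListDiff _≟_
    open Colour j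

    infix 4 _—_
    _—_ : V → V → Set
    u — v = Edge t₀ x₀ y₀ u v ⊎ Edge t₀ x₀ y₀ v u

    —-sym : ∀ {u v} → u — v → v — u
    —-sym = [ inj₂ , inj₁ ]′

    -- `full` makes a subtree a part hanging on `x y`: combined with `ends`, it says that an edge of
    -- the whole 2-tree leaves the labels of `t` only towards `x` or `y`.
    record Subtree (t : Tree) (x y : V) : Set where
      field
        unique : Unique (x ∷ y ∷ labels t)
        sound  : ∀ {u v} → Edge t x y u v → u — v
        full   : ∀ {u v} → u ∈ labels t → u — v → Edge t x y u v ⊎ Edge t x y v u

    module _ {z : V} {a b r : Tree} {x y : V} (s : Subtree (node z a b r) x y) where
      open Subtree s
      open Apart (apart {x} {y} {z} {labels a} {labels b} {labels r} unique)

      private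
        a∈ : ∀ {d} → d ∈ labels a → d ∈ labels (node z a b r)
        a∈ p = ∈-++⁺ˡ (there (∈-++⁺ˡ p))
        b∈ : ∀ {d} → d ∈ labels b → d ∈ labels (node z a b r)
        b∈ p = ∈-++⁺ˡ (there (∈-++⁺ʳ (labels a) p))
        r∈ : ∀ {d} → d ∈ labels r → d ∈ labels (node z a b r)
        r∈ p = ∈-++⁺ʳ (z ∷ (labels a ++ labels b)) p

        A-B : ∀ {d} → d ∈ labels a → d ∈ z ∷ y ∷ labels b → ⊥
        A-B d∈ (here refl) = z∉A d∈
        A-B d∈ (there (here refl)) = y∉A d∈
        A-B d∈ (there (there q)) = A∩B d∈ q
        A-R : ∀ {d} → d ∈ labels a → d ∈ x ∷ y ∷ labels r → ⊥
        A-R d∈ (here refl) = x∉A d∈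
        A-R d∈ (there (here refl)) = y∉A d∈
        A-R d∈ (there (there q)) = A∩R d∈ q
        B-A : ∀ {d} → d ∈ labels b → d ∈ x ∷ z ∷ labels a → ⊥
        B-A d∈ (here refl) = x∉B d∈
        B-A d∈ (there (here refl)) = z∉B d∈
        B-A d∈ (there (there q)) = A∩B q d∈
        B-R : ∀ {d} → d ∈ labels b → d ∈ x ∷ y ∷ labels r → ⊥
        B-R d∈ (here refl) = x∉B d∈
        B-R d∈ (there (here refl)) = y∉B d∈
        B-R d∈ (there (there q)) = B∩R d∈ q
        R-A : ∀ {d} → d ∈ labels r → d ∈ x ∷ z ∷ labels a → ⊥
        R-A d∈ (here refl) = x∉R d∈
        R-A d∈ (there (here refl)) = z∉R d∈
        R-A d∈ (there (there q)) = A∩R q d∈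
        R-B : ∀ {d} → d ∈ labels r → d ∈ z ∷ y ∷ labels b → ⊥
        R-B d∈ (here refl) = z∉R d∈
        R-B d∈ (there (here refl)) = y∉R d∈
        R-B d∈ (there (there q)) = B∩R q d∈

      left-subtree : Subtree a x z
      left-subtree = record
        { unique = uA
        ; sound = sound ∘ left
        ; full = λ d∈ dw → case full (a∈ d∈) dw of λ where
            (inj₁ base) → ⊥-elim (x∉A d∈)
            (inj₁ (left e)) → inj₁ e
            (inj₁ (right e)) → ⊥-elim (A-B d∈ (proj₁ (ends e)))
            (inj₁ (rest e)) → ⊥-elim (A-R d∈ (proj₁ (ends e)))
            (inj₂ base) → ⊥-elim (y∉A d∈)
            (inj₂ (left e)) → inj₂ e
            (inj₂ (right e)) → ⊥-elim (A-B d∈ (proj₂ (ends e)))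
            (inj₂ (rest e)) → ⊥-elim (A-R d∈ (proj₂ (ends e)))
        }

      right-subtree : Subtree b z y
      right-subtree = record
        { unique = uB
        ; sound = sound ∘ right
        ; full = λ d∈ dw → case full (b∈ d∈) dw of λ where
            (inj₁ base) → ⊥-elim (x∉B d∈)
            (inj₁ (right e)) → inj₁ e
            (inj₁ (left e)) → ⊥-elim (B-A d∈ (proj₁ (ends e)))
            (inj₁ (rest e)) → ⊥-elim (B-R d∈ (proj₁ (ends e)))
            (inj₂ base) → ⊥-elim (y∉B d∈)
            (inj₂ (right e)) → inj₂ e
            (inj₂ (left e)) → ⊥-elim (B-A d∈ (proj₂ (ends e)))
            (inj₂ (rest e)) → ⊥-elim (B-R d∈ (proj₂ (ends e)))
        }

      rest-subtree : Subtree r x y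
      rest-subtree = record
        { unique = uR
        ; sound = sound ∘ rest
        ; full = λ d∈ dw → case full (r∈ d∈) dw of λ where
            (inj₁ base) → ⊥-elim (x∉R d∈)
            (inj₁ (rest e)) → inj₁ e
            (inj₁ (left e)) → ⊥-elim (R-A d∈ (proj₁ (ends e)))
            (inj₁ (right e)) → ⊥-elim (R-B d∈ (proj₁ (ends e)))
            (inj₂ base) → ⊥-elim (y∉R d∈)
            (inj₂ (rest e)) → inj₂ e
            (inj₂ (left e)) → ⊥-elim (R-A d∈ (proj₂ (ends e)))
            (inj₂ (right e)) → ⊥-elim (R-B d∈ (proj₂ (ends e)))
        }

      top-closed : ∀ {d w} → d ∈ z ∷ (labels a ++ labels b) → d — w → w ∈ z ∷ (labels a ++ labels b) ⊎ w ≡ x ⊎ w ≡ y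
      top-closed {d} {w} d∈ dw = case full (∈-++⁺ˡ d∈) dw of λ where
          (inj₁ base) → ⊥-elim (x-out d∈)
          (inj₁ (left e)) → in-a (proj₂ (ends e))
          (inj₁ (right e)) → in-b (proj₂ (ends e))
          (inj₁ (rest e)) → ⊥-elim (r-out d∈ (proj₁ (ends e)))
          (inj₂ base) → ⊥-elim (y-out d∈)
          (inj₂ (left e)) → in-a (proj₁ (ends e))
          (inj₂ (right e)) → in-b (proj₁ (ends e))
          (inj₂ (rest e)) → ⊥-elim (r-out d∈ (proj₂ (ends e)))
        where
        x-out : x ∉ z ∷ (labels a ++ labels b)
        x-out (here p) = x≢z p
        x-out (there p) = [ x∉A , x∉B ]′ (∈-++⁻ (labels a) p)
        y-out : y ∉ z ∷ (labels a ++ labels b)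
        y-out (here p) = y≢z p
        y-out (there p) = [ y∉A , y∉B ]′ (∈-++⁻ (labels a) p)
        r-out : ∀ {d} → d ∈ z ∷ (labels a ++ labels b) → d ∈ x ∷ y ∷ labels r → ⊥
        r-out p (here refl) = x-out p
        r-out p (there (here refl)) = y-out p
        r-out (here refl) (there (there q)) = z∉R q
        r-out (there p) (there (there q)) = [ (λ s → A∩R s q) , (λ s → B∩R s q) ]′ (∈-++⁻ (labels a) p)
        in-a : w ∈ x ∷ z ∷ labels a → w ∈ z ∷ (labels a ++ labels b) ⊎ w ≡ x ⊎ w ≡ y
        in-a (here p) = inj₂ (inj₁ p)
        in-a (there (here p)) = inj₁ (here p)
        in-a (there (there p)) = inj₁ (there (∈-++⁺ˡ p))
        in-b : w ∈ z ∷ y ∷ labels b → w ∈ z ∷ (labels a ++ labels b) ⊎ w ≡ x ⊎ w ≡ y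
        in-b (here p) = inj₁ (here p)
        in-b (there (here p)) = inj₂ (inj₂ p)
        in-b (there (there p)) = inj₁ (there (∈-++⁺ʳ (labels a) p))

    open Reductions j _—_ —-sym

    module _ {adj : Adjacency} {U : List V} (valid : Valid adj U) (smaller : Smaller valid)
      (nonisolated : ∀ {v} → v ∈ U → ∃[ w ] adj v w ≡ true) (enough : K < length U) (U⊆ : ∀ {w} → w ∈ U → w ∈ labels t₀) where
      open Valid valid
      open Configurations j _—_ —-sym valid smaller nonisolated

      top : V → List V
      top z = filter (_∈? U) [ z ]

      active : Tree → List V
      active leaf           = []
      active (node z a b r) = (top z ++ (active a ++ active b)) ++ active r

      ∈-top : ∀ {z w} → w ∈ top z → w ≡ z × w ∈ U
      ∈-top {z} w∈ with ∈-filter⁻ (_∈? U) {xs = [ z ]} w∈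
      ... | here p , q = p , q

      ∈-active⁻ : ∀ t {w} → w ∈ active t → w ∈ labels t × w ∈ U
      ∈-active⁻ (node z a b r) w∈ with ∈-++⁻ (top z ++ (active a ++ active b)) w∈
      ... | inj₂ q with p , u ← ∈-active⁻ r q = ∈-++⁺ʳ (z ∷ (labels a ++ labels b)) p , u
      ... | inj₁ q with ∈-++⁻ (top z) q
      ...   | inj₁ s with refl , u ← ∈-top s = here refl , u
      ...   | inj₂ s with ∈-++⁻ (active a) s
      ...     | inj₁ q′ with p , u ← ∈-active⁻ a q′ = ∈-++⁺ˡ (there (∈-++⁺ˡ p)) , u
      ...     | inj₂ q′ with p , u ← ∈-active⁻ b q′ = ∈-++⁺ˡ (there (∈-++⁺ʳ (labels a) p)) , u

      ∈-active⁺ : ∀ t {w} → w ∈ labels t → w ∈ U → w ∈ active t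
      ∈-top⁺ : ∀ z a b {w} → w ∈ z ∷ (labels a ++ labels b) → w ∈ U → w ∈ top z ++ (active a ++ active b)
      ∈-active⁺ (node z a b r) w∈ u with ∈-++⁻ (z ∷ (labels a ++ labels b)) w∈
      ... | inj₁ p = ∈-++⁺ˡ (∈-top⁺ z a b p u)
      ... | inj₂ p = ∈-++⁺ʳ (top z ++ (active a ++ active b)) (∈-active⁺ r p u)
      ∈-top⁺ z a b (here refl) u = ∈-++⁺ˡ (∈-filter⁺ (_∈? U) (here refl) u)
      ∈-top⁺ z a b (there p) u with ∈-++⁻ (labels a) p
      ... | inj₁ q = ∈-++⁺ʳ (top z) (∈-++⁺ˡ (∈-active⁺ a q u))
      ... | inj₂ q = ∈-++⁺ʳ (top z) (∈-++⁺ʳ (active a) (∈-active⁺ b q u))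

      ∈-top⁻ : ∀ z a b {w} → w ∈ top z ++ (active a ++ active b) → w ∈ z ∷ (labels a ++ labels b)
      ∈-top⁻ z a b w∈ with ∈-++⁻ (top z) w∈
      ... | inj₁ p = here (proj₁ (∈-top p))
      ... | inj₂ p with ∈-++⁻ (active a) p
      ...   | inj₁ q = there (∈-++⁺ˡ (proj₁ (∈-active⁻ a q)))
      ...   | inj₂ q = there (∈-++⁺ʳ (labels a) (proj₁ (∈-active⁻ b q)))

      active-unique : ∀ {t x y} → Subtree t x y → Unique (active t)
      active-unique {leaf} s = []
      active-unique {node z a b r} {x} {y} s = ++-unique
          (++-unique (UniqueP.filter⁺ (_∈? U) ([] ∷ [])) (++-unique (active-unique (left-subtree s)) (active-unique (right-subtree s))
            λ p q → A∩B (proj₁ (∈-active⁻ a p)) (proj₁ (∈-active⁻ b q)))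
            λ p q → case ∈-top p of λ { (refl , _) → [ z∉A ∘ proj₁ ∘ ∈-active⁻ a , z∉B ∘ proj₁ ∘ ∈-active⁻ b ]′ (∈-++⁻ (active a) q) })
          (active-unique (rest-subtree s))
          λ p q → case ∈-top⁻ z a b p of λ where
            (here refl) → z∉R (proj₁ (∈-active⁻ r q))
            (there p′) → [ (λ w∈ → A∩R w∈ (proj₁ (∈-active⁻ r q))) , (λ w∈ → B∩R w∈ (proj₁ (∈-active⁻ r q))) ]′ (∈-++⁻ (labels a) p′)
        where open Apart (apart {x} {y} {z} {labels a} {labels b} {labels r} (Subtree.unique s))

      active-top-closed : ∀ {z a b r x y} → Subtree (node z a b r) x y → Closed x y (top z ++ (active a ++ active b))
      active-top-closed {z} {a} {b} s d∈ dw = case top-closed s (∈-top⁻ z a b d∈) (support dw) of λ where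
        (inj₁ p) → inj₁ (∈-top⁺ z a b p (inside dw))
        (inj₂ p) → inj₂ p

      peelable-[] : Peelable []
      peelable-[] X X⊆ x∈ = case X⊆ x∈ of λ ()

      active-peelable : ∀ {t x y} → Subtree t x y → Peelable (active t)
      active-peelable {leaf} s = peelable-[]
      active-peelable {node z a b r} s = peelable-++
        (peelable-top {N = active a ++ active b} (proj₁ ∘ ∈-top) (peelable-++ (active-peelable (left-subtree s)) (active-peelable (right-subtree s))) (active-top-closed s))
        (active-peelable (rest-subtree s))

      whole : Subtree t₀ x₀ y₀
      whole = record { unique = unique₀ ; sound = inj₁ ; full = λ _ → id }

      peelable-U : Peelable U
      peelable-U X X⊆ x∈ with e , e∈ , p , q , h ← active-peelable whole X (λ w∈ → ∈-active⁺ t₀ (U⊆ (X⊆ w∈)) (X⊆ w∈)) x∈ =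
        e , e∈ , p , q , λ ew → case h ew of λ where
          (inj₁ (w∈ , w∉)) → inj₁ (proj₂ (∈-active⁻ t₀ w∈) , w∉)
          (inj₂ r) → inj₂ r

      -- The recursion takes the place of choosing a smallest part: at a node, the three parts below
      -- are already known to be small and tame.
      search : ∀ {t x y} → Subtree t x y → Good adj U ⊎ Part x y (active t)
      search {leaf} s = inj₂ record { closed = λ () ; peelable = peelable-[] ; small = z≤n ; tame = λ () }
      search {node z a b r} {x} {y} s with search (left-subtree s) | search (right-subtree s) | search (rest-subtree s)
      ... | inj₁ g | _ | _ = inj₁ g
      ... | inj₂ _ | inj₁ g | _ = inj₁ g
      ... | inj₂ _ | inj₂ _ | inj₁ g = inj₁ g
      ... | inj₂ pa | inj₂ pb | inj₂ pr = merge-parts (<⇒≤ enough) peelable-U branch pr (active-unique (rest-subtree s)) (proj₂ ∘ ∈-active⁻ r)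
          (λ p q → case ∈-top⁻ z a b p of λ where
            (here refl) → z∉R (proj₁ (∈-active⁻ r q))
            (there p′) → [ (λ w∈ → A∩R w∈ (proj₁ (∈-active⁻ r q))) , (λ w∈ → B∩R w∈ (proj₁ (∈-active⁻ r q))) ]′ (∈-++⁻ (labels a) p′))
          (x∉R ∘ proj₁ ∘ ∈-active⁻ r) (y∉R ∘ proj₁ ∘ ∈-active⁻ r)
        where
        open Apart (apart {x} {y} {z} {labels a} {labels b} {labels r} (Subtree.unique s))
        branch : Branch x y z (top z) (active a) (active b)
        branch = record
          { uZ = UniqueP.filter⁺ (_∈? U) ([] ∷ [])
          ; Z≡ = proj₁ ∘ ∈-top
          ; Z⊆ = proj₂ ∘ ∈-top
          ; z∈Z = ∈-filter⁺ (_∈? U) (here refl)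
          ; uA = active-unique (left-subtree s)
          ; uB = active-unique (right-subtree s)
          ; A⊆ = proj₂ ∘ ∈-active⁻ a
          ; B⊆ = proj₂ ∘ ∈-active⁻ b
          ; disj = λ p q → A∩B (proj₁ (∈-active⁻ a p)) (proj₁ (∈-active⁻ b q))
          ; disjZ = λ p q → case ∈-top p of λ { (refl , _) → [ z∉A ∘ proj₁ ∘ ∈-active⁻ a , z∉B ∘ proj₁ ∘ ∈-active⁻ b ]′ (∈-++⁻ (active a) q) }
          ; x≢y = x≢y ; x≢z = x≢z ; y≢z = y≢z
          ; x∉A = x∉A ∘ proj₁ ∘ ∈-active⁻ a
          ; x∉B = x∉B ∘ proj₁ ∘ ∈-active⁻ b
          ; y∉A = y∉A ∘ proj₁ ∘ ∈-active⁻ a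
          ; y∉B = y∉B ∘ proj₁ ∘ ∈-active⁻ b
          ; z∉A = z∉A ∘ proj₁ ∘ ∈-active⁻ a
          ; z∉B = z∉B ∘ proj₁ ∘ ∈-active⁻ b
          ; x—y = Subtree.sound s base
          ; partA = pa
          ; partB = pb
          ; cl = active-top-closed s
          }

      -- Failure at the root would confine all of `U`, more than `K` vertices, to a part of at most
      -- `j`.
      reducible : Good adj U
      reducible = case search whole of λ where
        (inj₁ g) → g
        (inj₂ p) → ⊥-elim (1+n≰n (≤-trans (≤-trans (s≤s (m≤n+m j 2)) enough)
          (≤-trans (length-⊆ (active t₀) unique λ w∈ → ∈-active⁺ t₀ (U⊆ w∈) w∈) (Part.small p))))

    equitable : ∀ n {adj U} → length U ≤ n → (∀ {w} → w ∈ U → w ∈ labels t₀) → Valid adj U → Good adj U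
    equitable zero le U⊆ valid = few-vertices (Valid.symm valid) (Valid.irr valid) (Valid.unique valid) (≤-trans le z≤n)
    equitable (suc n) {adj} {U} le U⊆ valid with length U ≤? K
    ... | yes le′ = few-vertices (Valid.symm valid) (Valid.irr valid) (Valid.unique valid) le′
    ... | no ≰K with any? (λ v → ¬? (any? (λ w → adj v w Data.Bool.≟ true) U)) U
    -- Isolated vertices go first, so that in the other case every vertex has an edge.
    ...   | yes p with v , v∈ , iso ← find p = isolated valid smaller v∈ λ vw → iso (lose (Valid.inside valid vw) vw)
      where
      smaller : Smaller valid
      smaller lt U′⊆ valid′ = equitable n (s≤s⁻¹ (≤-trans lt le)) (U⊆ ∘ U′⊆) valid′
    ...   | no none = reducible valid smaller nonisolated (≰⇒> ≰K) U⊆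
      where
      smaller : Smaller valid
      smaller lt U′⊆ valid′ = equitable n (s≤s⁻¹ (≤-trans lt le)) (U⊆ ∘ U′⊆) valid′
      nonisolated : ∀ {v} → v ∈ U → ∃[ w ] adj v w ≡ true
      nonisolated {v} v∈ with any? (λ w → adj v w Data.Bool.≟ true) U
      ... | yes q with w , _ , vw ← find q = w , vw
      ... | no q = ⊥-elim (none (lose v∈ q))

-- Vertices with at most two neighbours in graphs without K₄-minor.

module Minors {n : ℕ} where
  open ListDiff (FinP._≟_ {n})

  V = Fin n

  adj-sym′ : ∀ (G : Graph n) {u v} → Adj G u v → Adj G v u
  adj-sym′ G {u} {v} e = trans (adj-sym G v u) e

  adj-irr : ∀ (G : Graph n) {u} → Adj G u u → ⊥
  adj-irr G {u} e = true≢false e (irrfl G u)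

  module _ (G : Graph n) where

    infix 4 _~_
    _~_ : V → V → Set
    u ~ v = Adj G u v

    ~-sym : ∀ {u v} → u ~ v → v ~ u
    ~-sym = adj-sym′ G

    Path : List V → Set
    Path = Linked _~_

    module _ {S : V → Set} where

      walk-start : ∀ {u v} → WalkIn G S u v → S u
      walk-start (here s) = s
      walk-start (step s _ _) = s

      walk-snoc : ∀ {u v w} → WalkIn G S u v → v ~ w → S w → WalkIn G S u w
      walk-snoc (here s) e t = step s e (here t)
      walk-snoc (step s e′ p) e t = step s e′ (walk-snoc p e t)

      walk-++ : ∀ {u v w} → WalkIn G S u v → WalkIn G S v w → WalkIn G S u w
      walk-++ (here _) q = q
      walk-++ (step s e p) q = step s e (walk-++ p q)

      path-connected : ∀ {l} → Path l → (∀ {w} → w ∈ l → S w) → ∀ {u v} → u ∈ l → v ∈ l → WalkIn G S u v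
      path-connected [-] s (here refl) (here refl) = here (s (here refl))
      path-connected (e ∷ p) s (here refl) (here refl) = here (s (here refl))
      path-connected (e ∷ p) s (here refl) (there v∈) = step (s (here refl)) e (path-connected p (s ∘ there) (here refl) v∈)
      path-connected (e ∷ p) s (there u∈) (here refl) = walk-snoc (path-connected p (s ∘ there) u∈ (here refl)) (~-sym e) (s (here refl))
      path-connected (e ∷ p) s (there u∈) (there v∈) = path-connected p (s ∘ there) u∈ v∈

    path-split : ∀ x xs {y ys} → Path (x ∷ xs ++ y ∷ ys) → Path (x ∷ xs) × Path (y ∷ ys) × ∃[ w ] (w ∈ x ∷ xs × w ~ y)
    path-split x [] (e ∷ p) = [-] , p , x , here refl , e
    path-split x (x′ ∷ xs) (e ∷ p) with a , b , w , w∈ , wy ← path-split x′ xs p = e ∷ a , b , w , there w∈ , wy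

    reverse-onto : ∀ x xs {y ys} → Path (x ∷ xs) → x ~ y → Path (y ∷ ys) → Path ((x ∷ xs) ʳ++ (y ∷ ys))
    reverse-onto x [] p e q = e ∷ q
    reverse-onto x (x′ ∷ xs) (e′ ∷ p) e q = reverse-onto x′ xs p (~-sym e′) (e ∷ q)

    module _ (segment : Fin 4 → List V) (path : ∀ i → Path (segment i)) (inhabited : ∀ i → ∃[ v ] v ∈ segment i)
      (disjoint : ∀ i i′ {v} → i Fin.< i′ → v ∈ segment i → v ∈ segment i′ → ⊥)
      (linked : ∀ i i′ → i Fin.< i′ → ∃[ u ] ∃[ v ] (u ∈ segment i × v ∈ segment i′ × u ~ v)) where

      branch? : ∀ v → Dec (∃[ i ] v ∈ segment i)
      branch? v = FinP.any? λ i → v ∈? segment i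

      branch : ∀ {v} → Dec (∃[ i ] v ∈ segment i) → Maybe (Fin 4)
      branch (yes (i , _)) = just i
      branch (no _) = nothing

      branch⁺ : ∀ {i v} → v ∈ segment i → branch (branch? v) ≡ just i
      branch⁺ {i} {v} v∈ with branch? v
      ... | no none = ⊥-elim (none (i , v∈))
      ... | yes (i′ , v∈′) with FinP.<-cmp i i′
      ...   | tri< lt _ _ = ⊥-elim (disjoint i i′ lt v∈ v∈′)
      ...   | tri≈ _ refl _ = refl
      ...   | tri> _ _ gt = ⊥-elim (disjoint i′ i gt v∈′ v∈)

      branch⁻ : ∀ {i v} → branch (branch? v) ≡ just i → v ∈ segment i
      branch⁻ {i} {v} eq with branch? v
      branch⁻ refl | yes (_ , v∈) = v∈

      segments⇒K₄ : HasK4Minor G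
      segments⇒K₄ = (λ v → branch (branch? v)) , (λ i → let v , v∈ = inhabited i in v , branch⁺ v∈) ,
        (λ i u v bu bv → path-connected (path i) branch⁺ (branch⁻ bu) (branch⁻ bv)) , joined
        where
        joined : ∀ i i′ → i ≢ i′ → ∃[ u ] ∃[ v ] (branch (branch? u) ≡ just i × branch (branch? v) ≡ just i′ × u ~ v)
        joined i i′ i≢i′ with FinP.<-cmp i i′
        ... | tri≈ _ eq _ = ⊥-elim (i≢i′ eq)
        ... | tri< lt _ _ with u , v , u∈ , v∈ , uv ← linked i i′ lt = u , v , branch⁺ u∈ , branch⁺ v∈ , uv
        ... | tri> _ _ gt with u , v , u∈ , v∈ , uv ← linked i′ i gt = v , u , branch⁺ v∈ , branch⁺ u∈ , ~-sym uv

    -- The branch sets are `h ∷ init`, `y`, `c ∷ c₁` and `d ∷ r`. Edges of the path join consecutive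
    -- ones; the chords at `c`, `a` and `e` account for the other three pairs.
    four-segments : ∀ {h init y c c₁ d r a e} → Path (h ∷ init ++ y ∷ c ∷ c₁ ++ d ∷ r) → Unique (h ∷ init ++ y ∷ c ∷ c₁ ++ d ∷ r) →
      h ~ c → a ∈ d ∷ r → h ~ a → e ∈ d ∷ r → y ~ e → HasK4Minor G
    four-segments {h} {init} {y} {c} {c₁} {d} {r} {a} {e} path uniq hc a∈ ha e∈ ye
      with pA , p₁ , w , w∈ , wy ← path-split h init path
      with yc ∷ p₂ ← p₁
      with pC , pD , w′ , w′∈ , w′d ← path-split c c₁ p₂ = segments⇒K₄ segment segment-path inhabited disjoint linked
      where
      C = c ∷ c₁
      segment : Fin 4 → List V
      segment 0F = h ∷ init
      segment 1F = [ y ]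
      segment 2F = C
      segment 3F = d ∷ r
      segment-path : ∀ i → Path (segment i)
      segment-path 0F = pA
      segment-path 1F = [-]
      segment-path 2F = pC
      segment-path 3F = pD
      inhabited : ∀ i → ∃[ v ] v ∈ segment i
      inhabited 0F = h , here refl
      inhabited 1F = y , here refl
      inhabited 2F = c , here refl
      inhabited 3F = d , here refl
      split₁ = ++-unique⁻ (h ∷ init) uniq
      split₂ = ++-unique⁻ C (tail-unique (proj₁ (proj₂ split₁)))
      y∉ : y ∉ C ++ d ∷ r
      y∉ = head∉ (proj₁ (proj₂ split₁))
      disjoint : ∀ i i′ {v} → i Fin.< i′ → v ∈ segment i → v ∈ segment i′ → ⊥
      disjoint 0F 1F _ p (here refl) = proj₂ (proj₂ split₁) p (here refl)
      disjoint 0F 2F _ p q = proj₂ (proj₂ split₁) p (there (∈-++⁺ˡ q))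
      disjoint 0F 3F _ p q = proj₂ (proj₂ split₁) p (there (∈-++⁺ʳ C q))
      disjoint 1F 2F _ (here refl) q = y∉ (∈-++⁺ˡ q)
      disjoint 1F 3F _ (here refl) q = y∉ (∈-++⁺ʳ C q)
      disjoint 2F 3F _ p q = proj₂ (proj₂ split₂) p q
      disjoint (Fin.suc _) 1F (s≤s ())
      disjoint (Fin.suc (Fin.suc _)) 2F (s≤s (s≤s ()))
      disjoint (Fin.suc (Fin.suc (Fin.suc _))) 3F (s≤s (s≤s (s≤s ())))
      linked : ∀ i i′ → i Fin.< i′ → ∃[ u ] ∃[ v ] (u ∈ segment i × v ∈ segment i′ × u ~ v)
      linked 0F 1F _ = w , y , w∈ , here refl , wy
      linked 0F 2F _ = h , c , here refl , here refl , hc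
      linked 0F 3F _ = h , a , here refl , a∈ , ha
      linked 1F 2F _ = y , c , here refl , here refl , yc
      linked 1F 3F _ = y , e , here refl , e∈ , ye
      linked 2F 3F _ = w′ , d , w′∈ , here refl , w′d
      linked (Fin.suc _) 1F (s≤s ())
      linked (Fin.suc (Fin.suc _)) 2F (s≤s (s≤s ()))
      linked (Fin.suc (Fin.suc (Fin.suc _))) 3F (s≤s (s≤s (s≤s ())))

    first : ∀ {P : V → Set} → (∀ v → Dec (P v)) → ∀ {l v} → v ∈ l → P v →
      ∃[ l₁ ] ∃[ c ] ∃[ l₂ ] (l ≡ l₁ ++ c ∷ l₂ × P c × (∀ {w} → w ∈ l₁ → P w → ⊥))
    first P? {x ∷ l} v∈ pv with P? x
    first P? {x ∷ l} v∈ pv | yes px = [] , x , l , refl , px , λ ()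
    first P? {x ∷ l} (here refl) pv | no n = ⊥-elim (n pv)
    first P? {x ∷ l} (there v∈) pv | no n with l₁ , c , l₂ , refl , pc , none ← first P? v∈ pv =
      x ∷ l₁ , c , l₂ , refl , pc , λ { (here refl) → n ; (there w∈) → none w∈ }

    two-neighbours : V → Set
    two-neighbours v = ∃[ p ] ∃[ q ] (∀ {w} → v ~ w → w ≡ p ⊎ w ≡ q)

    -- At least three neighbours, in the form in which it is used: to find a neighbour other than
    -- two given vertices.
    Rich : V → Set
    Rich v = ∀ p q → ∃[ w ] (v ~ w × w ≢ p × w ≢ q)

    ~? : ∀ u v → Dec (u ~ v)
    ~? u v = adj G u v Data.Bool.≟ true

    rich? : ∀ v → two-neighbours v ⊎ Rich v
    rich? v with FinP.any? (λ p → FinP.any? (λ q → FinP.all? (λ w → ¬? (~? v w) ⊎-dec ((w FinP.≟ p) ⊎-dec (w FinP.≟ q)))))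
    ... | yes (p , q , h) = inj₁ (p , q , λ {w} vw → [ (λ n → ⊥-elim (n vw)) , id ]′ (h w))
    ... | no none = inj₂ λ p q → case FinP.any? (λ w → ~? v w ×-dec (¬? (w FinP.≟ p) ×-dec ¬? (w FinP.≟ q))) of λ where
      (yes (w , vw , a , b)) → w , vw , a , b
      (no m) → ⊥-elim (none (p , q , λ w → case ~? v w of λ where
        (no n) → inj₁ n
        (yes vw) → case w FinP.≟ p of λ where
          (yes r) → inj₂ (inj₁ r)
          (no r) → case w FinP.≟ q of λ where
            (yes s) → inj₂ (inj₂ s)
            (no s) → ⊥-elim (m (w , vw , r , s))))

    -- Take a path that cannot be extended at its head h, and the first neighbour c of h beyond the second vertex.
    -- The predecessor y of c is the head of another path on the same vertices. If y has no neighbour beyond c, then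
    -- the first neighbour of y beyond the second vertex of the new path is closer to the head than c was.
    module _ {W : List V} (inW : ∀ {u v} → u ~ v → v ∈ W) (rich : ∀ {v} → v ∈ W → Rich v) where

      escapes? : ∀ v l → (∃[ w ] (v ~ w × w ∉ l)) ⊎ (∀ {w} → v ~ w → w ∈ l)
      escapes? v l with FinP.any? (λ w → ~? v w ×-dec ¬? (w ∈? l))
      ... | yes p = inj₁ p
      ... | no none = inj₂ λ {w} vw → case w ∈? l of λ where
        (yes r) → r
        (no r) → ⊥-elim (none (w , vw , r))

      too-long : ∀ {l : List V} → Unique l → n < length l → ⊥
      too-long {l} u lt = <⇒≱ lt (subst (length l ≤_) (length-tabulate {n = n} id) (length-⊆ (allFin n) u λ {w} _ → ∈-allFin w))

      snoc-view : ∀ (x : V) xs → ∃[ init ] ∃[ y ] (x ∷ xs ≡ init ++ [ y ] × length init ≡ length xs)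
      snoc-view x [] = [] , x , refl , refl
      snoc-view x (x′ ∷ xs) with init , y , eq , len ← snoc-view x′ xs = x ∷ init , y , cong (x ∷_) eq , cong suc len

      -- The recursion is lexicographic: `fuel` bounds how much the path can still grow, and a
      -- rotation, which keeps the vertices of the path, lowers `bound` instead. In `rotate`, `s₁`
      -- is a stretch containing a chord from the head.
      extend : ∀ fuel h t → Path (h ∷ t) → Unique (h ∷ t) → (∀ {w} → w ∈ h ∷ t → w ∈ W) → n < fuel + length (h ∷ t) → HasK4Minor G
      rotate : ∀ fuel bound h v₁ s₁ s₂ {c} → Path (h ∷ v₁ ∷ s₁ ++ s₂) → Unique (h ∷ v₁ ∷ s₁ ++ s₂) → (∀ {w} → w ∈ h ∷ v₁ ∷ s₁ ++ s₂ → w ∈ W) →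
        n < suc fuel + length (h ∷ v₁ ∷ s₁ ++ s₂) → (∀ {w} → h ~ w → w ∈ v₁ ∷ s₁ ++ s₂) → c ∈ s₁ → h ~ c → length s₁ ≤ bound → HasK4Minor G

      extend zero h t path uniq ⊆W lt = ⊥-elim (too-long uniq lt)
      extend (suc fuel) h t path uniq ⊆W lt with escapes? h (h ∷ t)
      ... | inj₁ (w , hw , w∉) = extend fuel w (h ∷ t) (~-sym hw ∷ path) (cons-unique w∉ uniq) (λ { (here refl) → inW hw ; (there p) → ⊆W p })
            (≤-trans lt (≤-reflexive (sym (+-suc fuel (length (h ∷ t))))))
      ... | inj₂ inside = go t path uniq ⊆W lt inside
        where
        inside′ : ∀ {t} → (∀ {w} → h ~ w → w ∈ h ∷ t) → ∀ {w} → h ~ w → w ∈ t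
        inside′ ins hw with ins hw
        ... | here refl = ⊥-elim (adj-irr G hw)
        ... | there p = p
        go : ∀ t → Path (h ∷ t) → Unique (h ∷ t) → (∀ {w} → w ∈ h ∷ t → w ∈ W) → n < suc fuel + length (h ∷ t) → (∀ {w} → h ~ w → w ∈ h ∷ t) → HasK4Minor G
        go [] path uniq ⊆W lt ins with w , hw , _ ← rich (⊆W (here refl)) h h with () ← inside′ ins hw
        go (v₁ ∷ t) path uniq ⊆W lt ins with w , hw , w≢v₁ , _ ← rich (⊆W (here refl)) v₁ v₁ with inside′ ins hw
        ... | here r = ⊥-elim (w≢v₁ r)
        ... | there w∈ = rotate fuel (length t) h v₁ t [] (subst Path eq path) (subst Unique eq uniq) (⊆W ∘ ∈-subst (sym eq))
            (subst (λ l → n < suc fuel + length l) eq lt) (λ hw′ → ∈-subst (cong (v₁ ∷_) (sym (++-identityʳ t))) (inside′ ins hw′)) w∈ hw ≤-refl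
          where
          eq : h ∷ v₁ ∷ t ≡ h ∷ v₁ ∷ t ++ []
          eq = cong (λ l → h ∷ v₁ ∷ l) (sym (++-identityʳ t))

      rotate fuel zero h v₁ [] s₂ path uniq ⊆W lt ins () hc le
      rotate fuel (suc bound) h v₁ s₁ s₂ path uniq ⊆W lt ins c∈ hc le
        with t₁ , c , s₁′ , refl , hc , none ← first (~? h) c∈ hc
        with init , y , eq , len ← snoc-view v₁ t₁
        = goal
        where
        later = s₁′ ++ s₂
        l = h ∷ v₁ ∷ (t₁ ++ c ∷ s₁′) ++ s₂
        shape : l ≡ h ∷ (init ++ [ y ]) ++ c ∷ later
        shape = cong (h ∷_) (trans (cong (v₁ ∷_) (++-assoc t₁ (c ∷ s₁′) s₂)) (cong (_++ c ∷ later) eq))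
        shape′ : l ≡ h ∷ init ++ y ∷ c ∷ later
        shape′ = trans shape (cong (h ∷_) (++-assoc init [ y ] (c ∷ later)))
        -- `c` is the first neighbour of `h` past `v₁`, so a neighbour other than these two lies
        -- beyond `c`.
        far : ∀ {w} → h ~ w → w ≢ v₁ → w ≢ c → w ∈ later
        far {w} hw n₁ n₂ with ins hw
        ... | here r = ⊥-elim (n₁ r)
        ... | there p with ∈-++⁻ t₁ (∈-subst (++-assoc t₁ (c ∷ s₁′) s₂) p)
        ...   | inj₁ q = ⊥-elim (none q hw)
        ...   | inj₂ (here r) = ⊥-elim (n₂ r)
        ...   | inj₂ (there q) = q
        rot = y ∷ reverse (h ∷ init) ++ c ∷ later
        rot-shape : (h ∷ init ++ [ y ]) ʳ++ (c ∷ later) ≡ rot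
        rot-shape = trans (ʳ++-defn (h ∷ init ++ [ y ])) (cong (_++ c ∷ later) (reverse-++ (h ∷ init) [ y ]))
        rot-path : Path rot
        rot-path with pA , pC , _ ← path-split h (init ++ [ y ]) (subst Path shape path) = subst Path rot-shape (reverse-onto h (init ++ [ y ]) pA hc pC)
        rot-perm : rot ↭ l
        rot-perm = Perm.↭-trans (Perm.↭-reflexive (sym (trans (sym (ʳ++-defn (h ∷ init ++ [ y ]))) rot-shape)))
          (Perm.↭-trans (PermP.++⁺ʳ (c ∷ later) (PermP.↭-reverse (h ∷ init ++ [ y ]))) (Perm.↭-reflexive (sym shape)))
        rot-unique : Unique rot
        rot-unique = Unique-resp (↭-sym rot-perm) uniq
        rot⊆ : ∀ {w} → w ∈ rot → w ∈ W
        rot⊆ w∈ = ⊆W (∈-resp-↭ rot-perm w∈)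
        rot-lt : n < suc fuel + length rot
        rot-lt = subst (λ m → n < suc fuel + m) (sym (↭-length rot-perm)) lt
        -- `init` is as long as `t₁`, and `s₁` contains `c` in addition to `t₁`; this is the
        -- decrease of `bound`.
        short : length init ≤ bound
        short = s≤s⁻¹ (≤-trans (s≤s (≤-trans (≤-reflexive len) (m≤m+n (length t₁) (length s₁′))))
          (≤-trans (≤-reflexive (trans (sym (+-suc (length t₁) (length s₁′))) (sym (length-++ t₁)))) le))
        rotated : ∀ x xs → reverse (h ∷ init) ≡ x ∷ xs → (∀ {w} → y ~ w → w ∈ rot) → (∀ {w} → y ~ w → w ∉ later) → HasK4Minor G
        rotated x xs req insY noneY
          with w , yw , w≢x , w≢c ← rich (rot⊆ (here refl)) x c =
          rotate fuel bound y x xs (c ∷ later) (subst Path rq rot-path) (subst Unique rq rot-unique) (rot⊆ ∘ ∈-subst (sym rq))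
            (subst (λ l → n < suc fuel + length l) rq rot-lt) (λ yw′ → inside′ (∈-subst rq (insY yw′)) yw′)
            (chord (∈-subst rq (insY yw))) yw (≤-trans (≤-reflexive (suc-injective (trans (cong length (sym req)) (length-reverse (h ∷ init))))) short)
          where
          rq : rot ≡ y ∷ x ∷ xs ++ c ∷ later
          rq = cong (λ l → y ∷ l ++ c ∷ later) req
          inside′ : ∀ {w l} → w ∈ y ∷ l → y ~ w → w ∈ l
          inside′ (here refl) yy = ⊥-elim (adj-irr G yy)
          inside′ (there p) _ = p
          chord : w ∈ y ∷ x ∷ xs ++ c ∷ later → w ∈ xs
          chord p with inside′ p yw
          ... | here r = ⊥-elim (w≢x r)
          ... | there q with ∈-++⁻ xs q
          ...   | inj₁ r = r
          ...   | inj₂ (here r) = ⊥-elim (w≢c r)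
          ...   | inj₂ (there r) = ⊥-elim (noneY yw r)
        -- Cutting `later` at the first vertex seen by `h` or `y` puts a neighbour of each into the
        -- last segment.
        crossing : ∀ {a e} → a ∈ later → h ~ a → e ∈ later → y ~ e → HasK4Minor G
        crossing {a} {e} a∈ ha e∈ ye
          with c₁ , d , r , eq′ , _ , before ← first (λ v → ~? h v ⊎-dec ~? y v) a∈ (inj₁ ha) =
          four-segments (subst Path full path) (subst Unique full uniq) hc (after a∈ (inj₁ ha)) ha (after e∈ (inj₂ ye)) ye
          where
          full : l ≡ h ∷ init ++ y ∷ c ∷ c₁ ++ d ∷ r
          full = trans shape′ (cong (λ z → h ∷ init ++ y ∷ c ∷ z) eq′)
          after : ∀ {w} → w ∈ later → h ~ w ⊎ y ~ w → w ∈ d ∷ r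
          after w∈ adjacent with ∈-++⁻ c₁ (∈-subst eq′ w∈)
          ... | inj₁ q = ⊥-elim (before q adjacent)
          ... | inj₂ q = q
        goal : HasK4Minor G
        goal with escapes? y rot
        ... | inj₁ (w , yw , w∉) = extend fuel w rot (~-sym yw ∷ rot-path) (cons-unique w∉ rot-unique) (λ { (here refl) → inW yw ; (there p) → rot⊆ p })
              (≤-trans rot-lt (≤-reflexive (sym (+-suc fuel (length rot)))))
        ... | inj₂ insY with any? (~? y) later
        ...   | yes found with e , e∈ , ye ← find found with a , ha , n₁ , n₂ ← rich (⊆W (here refl)) v₁ c = crossing (far ha n₁ n₂) ha e∈ ye
        ...   | no noneY = by-shape (reverse (h ∷ init)) refl
          where
          by-shape : ∀ L → reverse (h ∷ init) ≡ L → HasK4Minor G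
          by-shape [] req = case trans (sym (length-reverse (h ∷ init))) (cong length req) of λ ()
          by-shape (x ∷ xs) req = rotated x xs req insY λ yw w∈ → noneY (lose w∈ yw)

      rich⇒K₄ : ∀ {v} → v ∈ W → HasK4Minor G
      rich⇒K₄ {v} v∈ = extend n v [] [-] ([] ∷ []) (λ { (here refl) → v∈ }) (≤-reflexive (+-comm 1 n))

    sparse? : ∀ v → Dec (two-neighbours v)
    sparse? v with rich? v
    ... | inj₁ p = yes p
    ... | inj₂ r = no λ (p , q , h) → case r p q of λ (w , vw , a , b) → [ a , b ]′ (h vw)

    sparse-vertex : ∀ {W v} → (∀ {u v} → u ~ v → v ∈ W) → ¬ HasK4Minor G → v ∈ W → ∃[ u ] (u ∈ W × two-neighbours u)
    sparse-vertex {W} inW minor-free v∈ with any? sparse? W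
    ... | yes p with u , u∈ , h ← find p = u , u∈ , h
    ... | no none = ⊥-elim (minor-free (rich⇒K₄ inW (λ {v} v∈ → [ (λ p → ⊥-elim (none (lose v∈ p))) , id ]′ (rich? v)) v∈))

-- Embedding the graph in a 2-tree.

module Elimination {n : ℕ} where
  open Minors {n} hiding (V)
  open ListDiff (FinP._≟_ {n})
  open Equitable (FinP._≟_ {2 + n}) using (Tree; leaf; node; labels; Edge; base; left; right; rest)

  -- Two artificial vertices `0F` and `1F` are reserved as the root pair, so that the construction
  -- has an edge to start from whatever the graph is.
  ι : Fin n → Fin (2 + n)
  ι v = Fin.suc (Fin.suc v)

  ι-injective : ∀ {u v} → ι u ≡ ι v → u ≡ v
  ι-injective refl = refl

  -- The usual growth of a 2-tree: a new vertex is joined to both ends of an edge, with nothing yet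
  -- hanging on the two new edges.
  insert : ∀ {t x y u v} → Edge t x y u v → Fin (2 + n) → Tree
  insert {t} base w = node w leaf leaf t
  insert {node z a b r} (left e) w = node z (insert e w) b r
  insert {node z a b r} (right e) w = node z a (insert e w) r
  insert {node z a b r} (rest e) w = node z a b (insert e w)

  insert-labels : ∀ {t x y u v} (e : Edge t x y u v) w → labels (insert e w) ↭ w ∷ labels t
  insert-labels base w = Perm.refl
  insert-labels {node z a b r} (left e) w = Perm.↭-trans (prep z (PermP.++⁺ʳ (labels r) (PermP.++⁺ʳ (labels b) (insert-labels e w)))) (Perm.swap z w Perm.refl)
  insert-labels {node z a b r} (right e) w = Perm.↭-trans (prep z (PermP.++⁺ʳ (labels r) (Perm.↭-trans (PermP.++⁺ˡ (labels a) (insert-labels e w)) (shift w (labels a) (labels b)))))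
    (Perm.swap z w Perm.refl)
  insert-labels {node z a b r} (rest e) w = Perm.↭-trans (PermP.++⁺ˡ (z ∷ (labels a ++ labels b)) (insert-labels e w)) (shift w (z ∷ (labels a ++ labels b)) (labels r))

  insert-old : ∀ {t x y u v} (e : Edge t x y u v) w {c d} → Edge t x y c d → Edge (insert e w) x y c d
  insert-old base w f = rest f
  insert-old (left e) w base = base
  insert-old (left e) w (left f) = left (insert-old e w f)
  insert-old (left e) w (right f) = right f
  insert-old (left e) w (rest f) = rest f
  insert-old (right e) w base = base
  insert-old (right e) w (left f) = left f
  insert-old (right e) w (right f) = right (insert-old e w f)
  insert-old (right e) w (rest f) = rest f
  insert-old (rest e) w base = base
  insert-old (rest e) w (left f) = left f
  insert-old (rest e) w (right f) = right f
  insert-old (rest e) w (rest f) = rest (insert-old e w f)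

  insert-new : ∀ {t x y u v} (e : Edge t x y u v) w → Edge (insert e w) x y u w × Edge (insert e w) x y w v
  insert-new base w = left base , right base
  insert-new (left e) w with p , q ← insert-new e w = left p , left q
  insert-new (right e) w with p , q ← insert-new e w = right p , right q
  insert-new (rest e) w with p , q ← insert-new e w = rest p , rest q

  -- Used for a vertex whose only neighbour is `p`: it can be attached to any edge at `p`.
  edge-at : ∀ t {x y p} → p ∈ labels t → ∃[ u ] Edge t x y u p
  edge-at (node z a b r) p∈ with ∈-++⁻ (z ∷ (labels a ++ labels b)) p∈
  ... | inj₁ (here refl) = _ , left base
  ... | inj₂ q with u , e ← edge-at r q = u , rest e
  ... | inj₁ (there q) with ∈-++⁻ (labels a) q
  ...   | inj₁ q′ with u , e ← edge-at a q′ = u , left e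
  ...   | inj₂ q′ with u , e ← edge-at b q′ = u , right e

  x₀ y₀ : Fin (2 + n)
  x₀ = 0F
  y₀ = 1F

  record Decomposition (G : Graph n) (W : List (Fin n)) : Set where
    field
      tree     : Tree
      unique   : Unique (x₀ ∷ y₀ ∷ labels tree)
      labels⁺  : ∀ {v} → v ∈ W → ι v ∈ labels tree
      labels⁻  : ∀ {l} → l ∈ labels tree → ∃[ v ] (v ∈ W × l ≡ ι v)
      covers   : ∀ {u v} → Adj G u v → Edge tree x₀ y₀ (ι u) (ι v) ⊎ Edge tree x₀ y₀ (ι v) (ι u)

  ∧-true : ∀ f {x} → f ∧ x ≡ true → f ≡ true × x ≡ true
  ∧-true true e = refl , e

  if-just : ∀ f {m : Maybe (Fin 4)} {i} → (if f then m else nothing) ≡ just i → f ≡ true × m ≡ just i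
  if-just true e = refl , e

  if-true : ∀ {f} {m : Maybe (Fin 4)} → f ≡ true → (if f then m else nothing) ≡ m
  if-true refl = refl

  -- With the flag set this is the contraction of the path p v q to an edge, keeping v as an isolated vertex.
  module Contract (G : Graph n) (v p q : Fin n) (flag : Bool) (p≢q : flag ≡ true → p ≢ q) where

    ends-pq : Fin n → Fin n → Bool
    ends-pq a b = (does (a FinP.≟ p) ∧ does (b FinP.≟ q)) ∨ (does (a FinP.≟ q) ∧ does (b FinP.≟ p))

    joins : Fin n → Fin n → Bool
    joins a b = flag ∧ ends-pq a b

    -- The decisions are arguments so that symmetry and irreflexivity can be proved by matching on
    -- them.
    adjacent : ∀ {a b} → Dec (a ≡ v) → Dec (b ≡ v) → Bool
    adjacent {a} {b} (no _) (no _) = adj G a b ∨ joins a b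
    adjacent _ _ = false

    ends-pq⁻ : ∀ {a b} → ends-pq a b ≡ true → (a ≡ p × b ≡ q) ⊎ (a ≡ q × b ≡ p)
    ends-pq⁻ {a} {b} e with a FinP.≟ p | b FinP.≟ q | a FinP.≟ q | b FinP.≟ p
    ... | yes r | yes s | _ | _ = inj₁ (r , s)
    ... | yes r | no s | yes r′ | yes s′ = inj₂ (r′ , s′)
    ... | no r | _ | yes r′ | yes s′ = inj₂ (r′ , s′)

    joins⁻ : ∀ {a b} → joins a b ≡ true → flag ≡ true × ((a ≡ p × b ≡ q) ⊎ (a ≡ q × b ≡ p))
    joins⁻ e with fl , e′ ← ∧-true flag e = fl , ends-pq⁻ e′

    joins⁺ : flag ≡ true → joins p q ≡ true
    joins⁺ fl = cong₂ _∧_ fl (cong₂ (λ c d → (c ∧ d) ∨ (does (p FinP.≟ q) ∧ does (q FinP.≟ p))) (dec-true (p FinP.≟ p) refl) (dec-true (q FinP.≟ q) refl))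

    joins-sym : ∀ a b → joins a b ≡ joins b a
    joins-sym a b = cong (flag ∧_) (trans (∨-comm (does (a FinP.≟ p) ∧ does (b FinP.≟ q)) _)
      (cong₂ _∨_ (∧-comm (does (a FinP.≟ q)) _) (∧-comm (does (a FinP.≟ p)) _)))

    adjacent-sym : ∀ {a b} (da : Dec (a ≡ v)) (db : Dec (b ≡ v)) → adjacent da db ≡ adjacent db da
    adjacent-sym {a} {b} (no _) (no _) = cong₂ _∨_ (adj-sym G a b) (joins-sym a b)
    adjacent-sym (yes _) (yes _) = refl
    adjacent-sym (yes _) (no _) = refl
    adjacent-sym (no _) (yes _) = refl

    adjacent-irr : ∀ {a} (da : Dec (a ≡ v)) → adjacent da da ≡ false
    adjacent-irr (yes _) = refl
    adjacent-irr {a} (no _) with bool (joins a a)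
    ... | inj₂ e = cong₂ _∨_ (irrfl G a) e
    ... | inj₁ e with joins⁻ {a} {a} e
    ...   | fl , inj₁ (refl , r) = ⊥-elim (p≢q fl r)
    ...   | fl , inj₂ (refl , r) = ⊥-elim (p≢q fl (sym r))

    H : Graph n
    H = record
      { adj = λ a b → adjacent (a FinP.≟ v) (b FinP.≟ v)
      ; sym = λ a b → adjacent-sym (a FinP.≟ v) (b FinP.≟ v)
      ; irrfl = λ a → adjacent-irr (a FinP.≟ v)
      }

    adjacent⁻ : ∀ {a b} da db → adjacent {a} {b} da db ≡ true → a ≢ v × b ≢ v × (Adj G a b ⊎ flag ≡ true × ((a ≡ p × b ≡ q) ⊎ (a ≡ q × b ≡ p)))
    adjacent⁻ {a} {b} (no a≢v) (no b≢v) e with bool (adj G a b)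
    ... | inj₁ ab = a≢v , b≢v , inj₁ ab
    ... | inj₂ ab = a≢v , b≢v , inj₂ (joins⁻ (trans (cong (_∨ joins a b) (sym ab)) e))

    H⁻ : ∀ {a b} → Adj H a b → a ≢ v × b ≢ v × (Adj G a b ⊎ flag ≡ true × ((a ≡ p × b ≡ q) ⊎ (a ≡ q × b ≡ p)))
    H⁻ {a} {b} = adjacent⁻ (a FinP.≟ v) (b FinP.≟ v)

    H⁺ : ∀ {a b} → a ≢ v → b ≢ v → Adj G a b → Adj H a b
    H⁺ {a} {b} a≢v b≢v ab with a FinP.≟ v | b FinP.≟ v
    ... | yes r | _ = ⊥-elim (a≢v r)
    ... | no _ | yes r = ⊥-elim (b≢v r)
    ... | no _ | no _ rewrite ab = refl

    H-pq : p ≢ v → q ≢ v → flag ≡ true → Adj H p q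
    H-pq p≢v q≢v fl with p FinP.≟ v | q FinP.≟ v
    ... | yes r | _ = ⊥-elim (p≢v r)
    ... | no _ | yes r = ⊥-elim (q≢v r)
    ... | no _ | no _ rewrite joins⁺ fl with adj G p q
    ...   | true = refl
    ...   | false = refl

    module _ (vp : flag ≡ true → Adj G v p) (vq : flag ≡ true → Adj G v q) where

      -- `v` is moved into the branch set of `p`. The contracted edge `p q` is thereby replaced by
      -- the path `p v q` within one set, or by the edge `v q` between two sets. Being isolated in
      -- `H`, `v` contributed no edge to the minor.
      minor-lift : HasK4Minor H → HasK4Minor G
      minor-lift (b , nonempty , connected , joined) = b′ , nonempty′ , connected′ , joined′
        where
        relabel : ∀ {a} → Dec (a ≡ v) → Maybe (Fin 4)
        relabel (yes _) = if flag then b p else nothing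
        relabel {a} (no _) = b a
        b′ : Fin n → Maybe (Fin 4)
        b′ a = relabel (a FinP.≟ v)
        keep : ∀ {a} → a ≢ v → b′ a ≡ b a
        keep {a} a≢v with a FinP.≟ v
        ... | yes r = ⊥-elim (a≢v r)
        ... | no _ = refl
        at-v : ∀ {i} → flag ≡ true → b p ≡ just i → b′ v ≡ just i
        at-v fl bp with v FinP.≟ v
        ... | yes _ = trans (if-true fl) bp
        ... | no n = ⊥-elim (n refl)
        from-v : ∀ {i} → b′ v ≡ just i → flag ≡ true × b p ≡ just i
        from-v eq with v FinP.≟ v
        ... | no n = ⊥-elim (n refl)
        ... | yes _ = if-just flag eq
        p≢v : flag ≡ true → p ≢ v
        p≢v fl refl = adj-irr G (vp fl)
        -- The witness must differ from `v`, whose label is overwritten. An end of an edge of `H`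
        -- does, and the edge to any other branch set provides one.
        nonempty′ : ∀ i → ∃[ a ] b′ a ≡ just i
        nonempty′ i with i FinP.≟ 0F
        ... | yes refl with a , _ , ba , _ , e ← joined 0F 1F (λ ()) = a , trans (keep (proj₁ (H⁻ e))) ba
        ... | no n with a , _ , ba , _ , e ← joined i 0F n = a , trans (keep (proj₁ (H⁻ e))) ba
        lift : ∀ {i a c} → a ≢ v → WalkIn H (λ x → b x ≡ just i) a c → WalkIn G (λ x → b′ x ≡ just i) a c
        lift a≢v (here s) = here (trans (keep a≢v) s)
        lift {i} {a} a≢v (step {w = w} s e walk) with H⁻ e
        ... | _ , w≢v , inj₁ aw = step (trans (keep a≢v) s) aw (lift w≢v walk)
        ... | _ , w≢v , inj₂ (fl , inj₁ (refl , refl)) = step (trans (keep a≢v) s) (adj-sym′ G (vp fl)) (step (at-v fl s) (vq fl) (lift w≢v walk))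
        ... | _ , w≢v , inj₂ (fl , inj₂ (refl , refl)) = step (trans (keep a≢v) s) (adj-sym′ G (vq fl)) (step (at-v fl (walk-start H walk)) (vp fl) (lift w≢v walk))
        representative : ∀ {i} a → b′ a ≡ just i → ∃[ a′ ] (a′ ≢ v × b a′ ≡ just i × WalkIn G (λ x → b′ x ≡ just i) a a′ × WalkIn G (λ x → b′ x ≡ just i) a′ a)
        representative a ba with a FinP.≟ v in eq
        ... | no n = a , n , ba , here (trans (keep n) ba) , here (trans (keep n) ba)
        ... | yes refl with fl , bp ← from-v (trans (cong relabel eq) ba) =
          p , p≢v fl , bp , step (at-v fl bp) (vp fl) (here (trans (keep (p≢v fl)) bp)) , step (trans (keep (p≢v fl)) bp) (adj-sym′ G (vp fl)) (here (at-v fl bp))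
        connected′ : ∀ i a c → b′ a ≡ just i → b′ c ≡ just i → WalkIn G (λ x → b′ x ≡ just i) a c
        connected′ i a c ba bc with a′ , a′≢v , ba′ , out , _ ← representative a ba | c′ , _ , bc′ , _ , back ← representative c bc =
          walk-++ G out (walk-++ G (lift a′≢v (connected i a′ c′ ba′ bc′)) back)
        joined′ : ∀ i i′ → i ≢ i′ → ∃[ a ] ∃[ c ] (b′ a ≡ just i × b′ c ≡ just i′ × Adj G a c)
        joined′ i i′ i≢i′ with a , c , ba , bc , e ← joined i i′ i≢i′ with H⁻ e
        ... | a≢v , c≢v , inj₁ ac = a , c , trans (keep a≢v) ba , trans (keep c≢v) bc , ac
        ... | a≢v , c≢v , inj₂ (fl , inj₁ (refl , refl)) = v , q , at-v fl ba , trans (keep c≢v) bc , vq fl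
        ... | a≢v , c≢v , inj₂ (fl , inj₂ (refl , refl)) = q , v , trans (keep a≢v) ba , at-v fl bc , adj-sym′ G (vq fl)

  module _ {G : Graph n} {W : List (Fin n)} {v : Fin n} (uW : Unique W) (v∈W : v ∈ W) {H : Graph n} (D : Decomposition H (W ∖ [ v ]))
    (H⁺ : ∀ {a b} → a ≢ v → b ≢ v → Adj G a b → Adj H a b) where
    open Decomposition D

    -- Stacking `v` on an edge whose ends include all its neighbours covers the edges at `v`; all
    -- other edges of `G` survive in `H`.
    attach : ∀ {c d} → Edge tree x₀ y₀ c d → (∀ {w} → Adj G v w → ι w ≡ c ⊎ ι w ≡ d) → Decomposition G W
    attach {c} {d} e nbrs = record
      { tree = insert e (ι v)
      ; unique = cons-unique (λ { (here ()) ; (there p) → case up p of λ { (here ()) ; (there q) → head∉ unique (there q) } })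
          (cons-unique (λ p → case up p of λ { (here ()) ; (there q) → head∉ (tail-unique unique) q })
            (Unique-resp (↭-sym perm) (cons-unique (λ p → case labels⁻ p of λ { (w , w∈ , refl) → proj₂ (∈-∖⁻ W w∈) (here refl) }) (tail-unique (tail-unique unique)))))
      ; labels⁺ = λ {w} w∈ → ∈-resp-↭ (↭-sym perm) (case w FinP.≟ v of λ where
          (yes refl) → here refl
          (no n) → there (labels⁺ (∈-∖⁺ w∈ λ { (here r) → n r })))
      ; labels⁻ = λ l∈ → case up l∈ of λ where
          (here refl) → v , v∈W , refl
          (there q) → case labels⁻ q of λ (w , w∈ , r) → w , proj₁ (∈-∖⁻ W w∈) , r
      ; covers = λ {a} {b} ab → case a FinP.≟ v of λ where
          (yes refl) → at-v ab
          (no n) → case b FinP.≟ v of λ where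
            (yes refl) → [ inj₂ , inj₁ ]′ (at-v (adj-sym′ G ab))
            (no m) → [ inj₁ ∘ insert-old e (ι v) , inj₂ ∘ insert-old e (ι v) ]′ (covers (H⁺ n m ab))
      }
      where
      perm : labels (insert e (ι v)) ↭ ι v ∷ labels tree
      perm = insert-labels e (ι v)
      up : ∀ {l} → l ∈ labels (insert e (ι v)) → l ∈ ι v ∷ labels tree
      up = ∈-resp-↭ perm
      at-v : ∀ {w} → Adj G v w → Edge (insert e (ι v)) x₀ y₀ (ι v) (ι w) ⊎ Edge (insert e (ι v)) x₀ y₀ (ι w) (ι v)
      at-v vw with nbrs vw
      ... | inj₁ refl = inj₂ (proj₁ (insert-new e (ι v)))
      ... | inj₂ refl = inj₁ (proj₂ (insert-new e (ι v)))

  Neighbourhood : Graph n → Fin n → Set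
  Neighbourhood G v = (∃[ p ] ∃[ q ] (p ≢ q × Adj G v p × Adj G v q × (∀ {w} → Adj G v w → w ≡ p ⊎ w ≡ q)))
    ⊎ (∃[ p ] (Adj G v p × (∀ {w} → Adj G v w → w ≡ p)))
    ⊎ (∀ {w} → Adj G v w → ⊥)

  -- The vertices in `two-neighbours` may coincide or fail to be adjacent to `v`; contraction needs
  -- two genuine, distinct neighbours.
  neighbourhood : ∀ {G v} → two-neighbours G v → Neighbourhood G v
  neighbourhood {G} {v} (p , q , h) with bool (adj G v p) | bool (adj G v q) | p FinP.≟ q
  ... | inj₂ ¬vp | inj₂ ¬vq | _ = inj₂ (inj₂ λ vw → case h vw of λ { (inj₁ refl) → true≢false vw ¬vp ; (inj₂ refl) → true≢false vw ¬vq })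
  ... | inj₂ ¬vp | inj₁ vq | _ = inj₂ (inj₁ (q , vq , λ vw → case h vw of λ { (inj₁ refl) → ⊥-elim (true≢false vw ¬vp) ; (inj₂ r) → r }))
  ... | inj₁ vp | inj₂ ¬vq | _ = inj₂ (inj₁ (p , vp , λ vw → case h vw of λ { (inj₁ r) → r ; (inj₂ refl) → ⊥-elim (true≢false vw ¬vq) }))
  ... | inj₁ vp | inj₁ vq | yes refl = inj₂ (inj₁ (p , vp , λ vw → case h vw of λ { (inj₁ r) → r ; (inj₂ r) → r }))
  ... | inj₁ vp | inj₁ vq | no p≢q = inj₁ (p , q , p≢q , vp , vq , h)

  module _ {G : Graph n} {W : List (Fin n)} {v : Fin n} (uW : Unique W) (inW : ∀ {a b} → Adj G a b → b ∈ W)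
    (minor-free : ¬ HasK4Minor G) (v∈W : v ∈ W)
    (recurse : ∀ H → (∀ {a b} → Adj H a b → b ∈ W ∖ [ v ]) → ¬ HasK4Minor H → Decomposition H (W ∖ [ v ])) where

    ∈-rest : ∀ {w} → w ∈ W → w ≢ v → w ∈ W ∖ [ v ]
    ∈-rest w∈ w≢v = ∈-∖⁺ w∈ λ { (here r) → w≢v r }

    -- In the contracted graph `p q` is an edge, hence an edge of its 2-tree, and `v` can be stacked
    -- on it; the orientation in the tree is unknown, which gives two cases. With fewer neighbours
    -- `v` is merely isolated, and some edge to stack it on always exists.
    reduce : Neighbourhood G v → Decomposition G W
    reduce (inj₁ (p , q , p≢q , vp , vq , h)) = [ (λ e → attach uW v∈W D (λ {a} {b} → H⁺ {a} {b}) e ([ inj₁ ∘ cong ι , inj₂ ∘ cong ι ]′ ∘ h))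
                                                , (λ e → attach uW v∈W D (λ {a} {b} → H⁺ {a} {b}) e ([ inj₂ ∘ cong ι , inj₁ ∘ cong ι ]′ ∘ h)) ]′
        (Decomposition.covers D {p} {q} (H-pq (λ { refl → adj-irr G vp }) (λ { refl → adj-irr G vq }) refl))
      where
      open Contract G v p q true (λ _ → p≢q)
      inside : ∀ {a b} → Adj H a b → b ∈ W ∖ [ v ]
      inside {a} {b} e with H⁻ {a} {b} e
      ... | _ , b≢v , inj₁ ab = ∈-rest (inW ab) b≢v
      ... | _ , b≢v , inj₂ (_ , inj₁ (_ , refl)) = ∈-rest (inW vq) b≢v
      ... | _ , b≢v , inj₂ (_ , inj₂ (_ , refl)) = ∈-rest (inW vp) b≢v
      D : Decomposition H (W ∖ [ v ])
      D = recurse H (λ {a} {b} → inside {a} {b}) (minor-free ∘ minor-lift (λ _ → vp) (λ _ → vq))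
    reduce (inj₂ small) = by-degree small
      where
      -- With the flag off no edge is created, so `v` merely fills the places of `p` and `q`.
      open Contract G v v v false (λ ())
      inside : ∀ {a b} → Adj H a b → b ∈ W ∖ [ v ]
      inside {a} {b} e with H⁻ {a} {b} e
      ... | _ , b≢v , inj₁ ab = ∈-rest (inW ab) b≢v
      D : Decomposition H (W ∖ [ v ])
      D = recurse H (λ {a} {b} → inside {a} {b}) (minor-free ∘ minor-lift (λ ()) (λ ()))
      by-degree : (∃[ p ] (Adj G v p × (∀ {w} → Adj G v w → w ≡ p))) ⊎ (∀ {w} → Adj G v w → ⊥) → Decomposition G W
      by-degree (inj₂ none) = attach uW v∈W D (λ {a} {b} → H⁺ {a} {b}) base λ vw → ⊥-elim (none vw)
      by-degree (inj₁ (p , vp , only)) with u , e ← edge-at (Decomposition.tree D) (Decomposition.labels⁺ D (∈-rest (inW vp) λ { refl → adj-irr G vp })) =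
        attach uW v∈W D (λ {a} {b} → H⁺ {a} {b}) e λ vw → inj₂ (cong ι (only vw))

  decompose : ∀ m G W → length W ≤ m → Unique W → (∀ {u v} → Adj G u v → v ∈ W) → ¬ HasK4Minor G → Decomposition G W
  decompose m G [] le uW inW minor-free = record
    { tree = leaf ; unique = ((λ ()) ∷ []) ∷ [] ∷ [] ; labels⁺ = λ () ; labels⁻ = λ () ; covers = λ uv → case inW uv of λ () }
  decompose (suc m) G (w ∷ W) le uW inW minor-free with v , v∈ , h ← sparse-vertex G inW minor-free (here refl) =
    reduce uW inW minor-free v∈
      (λ H → decompose m H ((w ∷ W) ∖ [ v ]) (s≤s⁻¹ (≤-trans (≤-reflexive (sym (length-∖ uW ([] ∷ []) λ { (here refl) → v∈ }))) le)) (∖-unique [ v ] uW))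
      (neighbourhood {G} {v} h)

-- Transfer to the given graph.

≤-maximum : ∀ {A : Set} (f : A → ℕ) {x} xs → x ∈ xs → f x ≤ foldr _⊔_ 0 (map f xs)
≤-maximum f (x ∷ xs) (here refl) = m≤m⊔n (f x) _
≤-maximum f (x ∷ xs) (there x∈) = ≤-trans (≤-maximum f xs x∈) (m≤n⊔m (f x) _)

module _ {n : ℕ} (G : Graph n) (j : ℕ) (degree≤ : maxDegree G ≤ 1 + 2 * j) (minor-free : ¬ HasK4Minor G) where
  open Minors {n} using (adj-sym′; adj-irr)
  open Elimination {n}
  open Equitable.Colour (FinP._≟_ {2 + n}) j using (Good; size)
  D : Decomposition G (allFin n)
  D = decompose n G (allFin n) (≤-reflexive (length-tabulate {n = n} id)) (UniqueP.allFin⁺ n) (λ {u} {v} _ → ∈-allFin v) minor-free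

  open Decomposition D
  open Equitable.Search (FinP._≟_ {2 + n}) tree x₀ y₀ unique j using (_—_; —-sym; equitable)
  open Equitable.Reductions (FinP._≟_ {2 + n}) j _—_ —-sym using (Valid)

  adj⁺ : Fin (2 + n) → Fin (2 + n) → Bool
  adj⁺ (Fin.suc (Fin.suc u)) (Fin.suc (Fin.suc v)) = adj G u v
  adj⁺ _ _ = false

  U : List (Fin (2 + n))
  U = map ι (allFin n)

  adj⁺-sym : ∀ u v → adj⁺ u v ≡ true → adj⁺ v u ≡ true
  adj⁺-sym (Fin.suc (Fin.suc u)) (Fin.suc (Fin.suc v)) e = adj-sym′ G e
  adj⁺-sym (Fin.suc (Fin.suc u)) 0F ()
  adj⁺-sym (Fin.suc (Fin.suc u)) 1F ()

  adj⁺-irr : ∀ u → adj⁺ u u ≡ true → ⊥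
  adj⁺-irr (Fin.suc (Fin.suc u)) e = adj-irr G e

  adj⁺-support : ∀ u v → adj⁺ u v ≡ true → u — v × v ∈ U
  adj⁺-support (Fin.suc (Fin.suc u)) (Fin.suc (Fin.suc v)) e = covers e , ∈-map⁺ ι (∈-allFin v)
  adj⁺-support (Fin.suc (Fin.suc u)) 0F ()
  adj⁺-support (Fin.suc (Fin.suc u)) 1F ()

  count-degree : ∀ u → count (adj G u) (allFin n) ≡ degree G u
  count-degree u = sym (trans (length-filter (λ v → adj G u v Data.Bool.≟ true) (allFin n)) (count-cong (allFin n) λ {v} _ → does-true (adj G u v)))
    where
    does-true : ∀ b → does (b Data.Bool.≟ true) ≡ b
    does-true true = refl
    does-true false = refl

  adj⁺-degree : ∀ u → count (adj⁺ u) U ≤ 1 + 2 * j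
  adj⁺-degree 0F = ≤-trans (≤-reflexive (count-none U λ _ ())) z≤n
  adj⁺-degree 1F = ≤-trans (≤-reflexive (count-none U λ _ ())) z≤n
  adj⁺-degree (Fin.suc (Fin.suc u)) = ≤-trans (≤-reflexive (trans (count-map _ ι (allFin n)) (count-degree u)))
    (≤-trans (≤-maximum (degree G) (allFin n) (∈-allFin u)) degree≤)

  valid : Valid adj⁺ U
  valid = record
    { unique  = UniqueP.map⁺ ι-injective (UniqueP.allFin⁺ n)
    ; symm    = λ {u} {v} → adj⁺-sym u v
    ; irr     = λ {u} → adj⁺-irr u
    ; support = λ {u} {v} e → proj₁ (adj⁺-support u v e)
    ; inside  = λ {u} {v} e → proj₂ (adj⁺-support u v e)
    ; degree≤ = adj⁺-degree
    }

  equitable-colouring : HasEquitableColoring G (2 + j)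
  equitable-colouring with α , proper , balanced ← equitable (length U) ≤-refl
    (λ w∈ → case ∈-map⁻ ι w∈ of λ { (v , v∈ , refl) → labels⁺ v∈ }) valid =
    α ∘ ι , (λ u v uv → proper (∈-map⁺ ι (∈-allFin u)) (∈-map⁺ ι (∈-allFin v)) uv) ,
    λ i i′ → subst₂ (λ a b → a ≤ b + 1) (size-class i) (size-class i′) (balanced i i′)
    where
    size-class : ∀ i → size α U i ≡ classSize (α ∘ ι) i
    size-class i = trans (count-map _ ι (allFin n)) (sym (length-filter (λ v → α (ι v) FinP.≟ i) (allFin n)))

theorem1p4 : ∀ {n} (G : Graph n) → ¬ HasK4Minor G →
    (k : ℕ) → 1 ≤ k → maxDegree G + 3 ≤ 2 * k →
    HasEquitableColoring G k
theorem1p4 G minor-free (suc zero) _ le = ⊥-elim (<⇒≱ (m≤n+m 3 (maxDegree G)) le)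
theorem1p4 G minor-free (suc (suc j)) _ le = equitable-colouring G j bound minor-free
  where
  bound : maxDegree G ≤ 1 + 2 * j
  bound = +-cancelʳ-≤ 3 (maxDegree G) (1 + 2 * j) (≤-trans le (≤-reflexive (trans (*-distribˡ-+ 2 2 j) (cong suc (+-comm 3 (2 * j))))))
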